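{- Let $n\ge 2$ be even. A configuration $(\sigma,\tau_{c_i},\rho_{c_i},\rho_{e_{i,j}},x,y_i)\in\mathcal{S}_{\text{conf}}$ of the $n\times n\times n$ Rubik's Cube is valid if it satisfies: (1) $\operatorname{sgn}(\sigma)=\operatorname{sgn}(\rho_{c_i})$ for every center corner orbit $i$; (2) $\operatorname{sgn}(\rho_{e_{i,j}})=\operatorname{sgn}(\sigma)\operatorname{sgn}(\tau_i)\operatorname{sgn}(\tau_j)$ for every center edge orbit $(i,j)$, where $\tau_k$ denotes $\tau_{c_k}$; (3) $\sum_{k=1}^8 x_k=0$ in $\mathbb{Z}_3$; (4) $y_i=0$ for every coupled edge orbit $i$.
   Context: Cube and moves: the $n\times n\times n$ Rubik's Cube has faces U, D, F, B, R, L, each an $n\times n$ grid of facelets carrying stickers; in the solved state each face is monochromatic with six distinct colors. For $1\le k\le n/2$, $F_k,B_k,R_k,L_k,U_k,D_k$ denote clockwise (seen from the named face) $90^\circ$ rotations of the $k$-th slice counted from the named face. A configuration is valid if it is obtained from the solved state by a sequence of these moves. Cubie types ($n$ even): 8 corners (3 stickers); along each of the 12 edges lie edge cubies at positions $2,\dots,n-1$; for $2\le i\le n/2$ the 24 edge cubies at positions $i$ and $n+1-i$ form coupled edge orbit $i$. On each face index facelets $(r,c)$, $1\le r,c\le n$; for $2\le i\le n/2$ the center corner orbit $i$ is the 24 facelets with $r,c\in\{i,n+1-i\}$; for $2\le i,j\le n/2$, $j\ne i$, the center edge orbit $(i,j)$ is the 24 facelets occupying on each face the positions $(i,j),(j,n+1-i),(n+1-i,n+1-j),(n+1-j,i)$.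 $\mathcal{S}_{\text{conf}}$ is the set of arrangements obtained from the solved cube by disassembling and reassembling cubies, each cubie placed in a position of its own orbit (corners among corner positions, coupled edges of orbit $i$ within orbit $i$, centers of an orbit within that orbit), corners in any of 3 rotations and edges in either of 2 orientations. Such an arrangement is the tuple: $\sigma\in S_8$ (corner permutation), $\tau_{c_i}\in S_{24}$ (coupled edges of orbit $i$), $\rho_{c_i}\in S_{24}$ (center corners of orbit $i$), $\rho_{e_{i,j}}\in S_{24}$ (center edges of orbit $(i,j)$), $x\in\mathbb{Z}_3^8$ (corner orientations), $y_i\in\mathbb{Z}_2^{24}$ (coupled edge orientations of orbit $i$); the solved state has identity permutations and zero orientations. Orientations: a corner has exactly one sticker of the color of the (solved) white or yellow face, a designated pair of opposite faces; its orientation is $0$ if that sticker lies on the white or yellow face, $1$/$2$ if rotated one/two steps clockwise from that. For coupled edges, a coupled-edge facelet on face $X$ along the edge shared with face $Y$ is left-handed if, viewing $X$ from outside with that edge at the top, it lies left of the edge's midpoint; $y_{i,k}=0$ iff the sticker of the cubie at position $k$ of orbit $i$ that lay on a left-handed facelet in the solved state lies on a left-handed facelet. -}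

module Defs where

open import Data.Bool using (Bool; true; false; _∧_; _∨_; not; if_then_else_)
open import Data.Nat as ℕ using (ℕ; zero; suc; _∸_; _⊓_; _≡ᵇ_; _<ᵇ_; _%_; _/_)
open import Data.Integer as ℤ using (ℤ; +_; _≤ᵇ_; 0ℤ; 1ℤ; -1ℤ)
open import Data.Fin using (Fin; toℕ)
open import Data.List using (List; []; _∷_; map; concatMap; filterᵇ; allFin; foldl; length)
open import Data.Bool.ListAction using (and)
open import Data.Nat.ListAction using (sum)
open import Data.Product using (_×_; _,_; proj₁; proj₂; Σ; ∃)
open import Data.Sign using (Sign; opposite)
open import Relation.Binary.PropositionalEquality using (_≡_)

-- Integer vectors in ℝ³ (integer points), dot and cross product.
-- Coordinates: x points to R, y points to U, z points to F (right-handed).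
-- Cubie positions use doubled centred coordinates: the grid index
-- k ∈ {0..n-1} along an axis corresponds to the coordinate 2k-(n-1),
-- so the faces of the cube lie at coordinate ±(n-1).

record V3 : Set where
  constructor v3
  field
    x y z : ℤ
open V3 public

dot : V3 → V3 → ℤ
dot (v3 a b c) (v3 d e f) = a ℤ.* d ℤ.+ b ℤ.* e ℤ.+ c ℤ.* f

cross : V3 → V3 → V3
cross (v3 a b c) (v3 d e f) =
  v3 (b ℤ.* f ℤ.- c ℤ.* e) (c ℤ.* d ℤ.- a ℤ.* f) (a ℤ.* e ℤ.- b ℤ.* d)

scale : ℤ → V3 → V3
scale k (v3 a b c) = v3 (k ℤ.* a) (k ℤ.* b) (k ℤ.* c)

_⊕_ : V3 → V3 → V3
v3 a b c ⊕ v3 d e f = v3 (a ℤ.+ d) (b ℤ.+ e) (c ℤ.+ f)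

_⊖_ : V3 → V3 → V3
u ⊖ v = u ⊕ scale -1ℤ v

_=ᵇ_ : ℤ → ℤ → Bool
a =ᵇ b = (a ≤ᵇ b) ∧ (b ≤ᵇ a)

_<ℤᵇ_ : ℤ → ℤ → Bool
a <ℤᵇ b = not (b ≤ᵇ a)

-- strict lexicographic order on points (any total order works for signs)
lexLt : V3 → V3 → Bool
lexLt (v3 a b c) (v3 d e f) =
  (a <ℤᵇ d) ∨ ((a =ᵇ d) ∧ ((b <ℤᵇ e) ∨ ((b =ᵇ e) ∧ (c <ℤᵇ f))))

record M3 : Set where
  constructor m3
  field
    r₁ r₂ r₃ : V3
open M3 public

apply : M3 → V3 → V3
apply (m3 a b c) v = v3 (dot a v) (dot b v) (dot c v)

-- R is a rotation: orthogonal (R Rᵀ = I) with determinant 1.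
-- (For integer matrices these are exactly the 24 rotations of the cube.)
IsRotation : M3 → Set
IsRotation (m3 a b c) =
  (dot a a ≡ 1ℤ) × (dot b b ≡ 1ℤ) × (dot c c ≡ 1ℤ) ×
  (dot a b ≡ 0ℤ) × (dot a c ≡ 0ℤ) × (dot b c ≡ 0ℤ) ×
  (dot a (cross b c) ≡ 1ℤ)

data Face : Set where
  U D F B R L : Face

faces : List Face
faces = U ∷ D ∷ F ∷ B ∷ R ∷ L ∷ []

rank : Face → ℕ
rank U = 0
rank D = 1
rank F = 2
rank B = 3
rank R = 4
rank L = 5

ex ey ez : V3
ex = v3 1ℤ 0ℤ 0ℤ
ey = v3 0ℤ 1ℤ 0ℤ
ez = v3 0ℤ 0ℤ 1ℤ

normal : Face → V3
normal U = ey
normal D = scale -1ℤ ey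
normal F = ez
normal B = scale -1ℤ ez
normal R = ex
normal L = scale -1ℤ ex

-- Viewing a face from outside: the "up" direction (row index r grows
-- downwards) and "right" direction (column index c grows rightwards).
-- Every frame (right, up, normal) is right-handed, so the (r,c)
-- conventions of all six faces are related by rotations of the cube.
up : Face → V3
up U = scale -1ℤ ez
up D = ez
up F = ey
up B = ey
up R = ey
up L = ey

right : Face → V3
right U = ex
right D = ex
right F = ex
right B = scale -1ℤ ex
right R = scale -1ℤ ez
right L = ez

-- Facelets of the n×n×n cube: a face and 0-based (row, column).

Facelet : ℕ → Set
Facelet n = Face × Fin n × Fin n

allFacelets : (n : ℕ) → List (Facelet n)
allFacelets n =
  concatMap (λ X → concatMap (λ r → map (λ c → (X , r , c)) (allFin n)) (allFin n)) faces

face : ∀ {n} → Facelet n → Face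
face (X , _ , _) = X

half : ℕ → ℤ
half n = + (n ∸ 1)

off : ∀ {n} → Fin n → ℤ
off {n} k = + (2 ℕ.* toℕ k) ℤ.- half n

-- position (centre of the cubie carrying the facelet) and normal
pos : ∀ {n} → Facelet n → V3
pos {n} (X , r , c) =
  (scale (half n) (normal X) ⊕ scale (off c) (right X)) ⊖ scale (off r) (up X)

nrm : ∀ {n} → Facelet n → V3
nrm (X , _ , _) = normal X

emb : ∀ {n} → Facelet n → V3 × V3
emb f = pos f , nrm f

-- Moves.  (X , k) with k : Fin (n / 2) is X_{k+1}: the clockwise (seen
-- from X) quarter turn of the (k+1)-th slice counted from face X.
-- It acts on pairs (point, direction) ∈ ℤ³ × ℤ³.

Move : ℕ → Set
Move n = Face × Fin (n / 2)

-- rotation by -90° (clockwise seen from the tip of a) about the unit axis a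
rotCW : V3 → V3 → V3
rotCW a v = scale (dot a v) a ⊖ cross a v

moveAct : ∀ {n} → Move n → V3 × V3 → V3 × V3
moveAct {n} (X , k) (p , d) =
  if dot p (normal X) =ᵇ (half n ℤ.- + (2 ℕ.* toℕ k))
  then (rotCW (normal X) p , rotCW (normal X) d)
  else (p , d)

act : ∀ {n} → List (Move n) → V3 × V3 → V3 × V3
act {n} ms s = foldl (λ s m → moveAct {n} m s) s ms

-- An arrangement is described by g : Facelet n → Facelet n, sending the
-- facelet on which a sticker lies in the solved state to the facelet on
-- which it lies now.  The solved state is the identity.

Valid : (n : ℕ) → (Facelet n → Facelet n) → Set
Valid n g = ∃ λ (ms : List (Move n)) → ∀ f → emb (g f) ≡ act {n} ms (emb f)

-- Orbits, following the paper's (r,c) description (0-based here).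
-- layer k = distance of grid index k from the nearest border, so the
-- paper's 1-based index i corresponds to layer i-1.

layer : ∀ {n} → Fin n → ℕ
layer {n} k = toℕ k ⊓ (n ∸ 1 ∸ toℕ k)

data OrbitKey : Set where
  corner : OrbitKey
  edge   : ℕ → OrbitKey         -- coupled edge orbit (layer a = i-1)
  center : ℕ → ℕ → OrbitKey     -- center orbit (a,b): a=b center corner
                                  -- orbit i=a+1, a≠b center edge orbit (a+1,b+1)

orbitKey : ∀ {n} → Facelet n → OrbitKey
orbitKey {n} (X , r , c) with layer r ≡ᵇ 0 | layer c ≡ᵇ 0
... | true  | true  = corner
... | true  | false = edge (layer c)
... | false | true  = edge (layer r)
... | false | false =
  if (toℕ r <ᵇ n / 2) =B (toℕ c <ᵇ n / 2)
  then center (layer r) (layer c)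
  else center (layer c) (layer r)
  where
  _=B_ : Bool → Bool → Bool
  true  =B b = b
  false =B b = not b

isCorner : ∀ {n} → Facelet n → Bool
isCorner f with orbitKey f
... | corner = true
... | _      = false

isEdgeOrbit : ∀ {n} → ℕ → Facelet n → Bool
isEdgeOrbit a f with orbitKey f
... | edge b = a ≡ᵇ b
... | _      = false

isCenterOrbit : ∀ {n} → ℕ → ℕ → Facelet n → Bool
isCenterOrbit a b f with orbitKey f
... | center a' b' = (a ≡ᵇ a') ∧ (b ≡ᵇ b')
... | _           = false

-- The set S_conf: g is a bijection moving every cubie rigidly (by a
-- proper rotation) onto a cubie position of its own orbit.

Bijection : ∀ {A : Set} → (A → A) → Set
Bijection {A} g = (∀ a b → g a ≡ g b → a ≡ b) × (∀ b → ∃ λ a → g a ≡ b)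

InSconf : (n : ℕ) → (Facelet n → Facelet n) → Set
InSconf n g =
  Bijection g ×
  (∀ (q : V3) → Σ V3 λ p → Σ M3 λ Rm → IsRotation Rm ×
     (∀ (f : Facelet n) → pos f ≡ q →
        (pos (g f) ≡ p) × (nrm (g f) ≡ apply Rm (nrm f)) × (orbitKey (g f) ≡ orbitKey f)))

-- Signs of the induced permutations of cubies of an orbit.
-- Each cubie is represented by its canonical facelet (the one on the
-- first face, in the order U,D,F,B,R,L, among the faces it touches).
-- The sign is (-1)^(number of inversions w.r.t. the total order lexLt
-- on cubie positions).

onFace : ℕ → V3 → Face → Bool
onFace n p Y = dot p (normal Y) =ᵇ half n

canonical : ∀ {n} → Facelet n → Bool
canonical {n} (X , r , c) =
  and (map (λ Y → not ((rank Y <ᵇ rank X) ∧ onFace n (pos {n} (X , r , c)) Y)) faces)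

parity : ℕ → Sign
parity zero    = Sign.+
parity (suc k) = opposite (parity k)

inversions : (n : ℕ) → (Facelet n → Facelet n) → (Facelet n → Bool) → ℕ
inversions n g P =
  length (filterᵇ (λ (ff : Facelet n × Facelet n) →
                     lexLt (pos (proj₁ ff)) (pos (proj₂ ff)) ∧
                     lexLt (pos (g (proj₂ ff))) (pos (g (proj₁ ff))))
          (concatMap (λ f → map (λ f' → (f , f')) reps) reps))
  where
  reps : List (Facelet n)
  reps = filterᵇ (λ f → P f ∧ canonical f) (allFacelets n)

sgn : (n : ℕ) → (Facelet n → Facelet n) → (Facelet n → Bool) → Sign
sgn n g P = parity (inversions n g P)

-- Corner orientation.  White/yellow = U/D.  twist f ∈ {0,1,2} is the
-- number of clockwise steps (seen from outside the corner) from the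
-- U/D facelet of f's corner position to f.

twist : ∀ {n} → Facelet n → ℕ
twist (U , _ , _) = 0
twist (D , _ , _) = 0
twist f =
  let p = pos f
      u = v3 0ℤ (if 0ℤ <ℤᵇ y p then 1ℤ else -1ℤ) 0ℤ
  in if 0ℤ <ℤᵇ dot (cross (nrm f) u) p then 1 else 2

isCornerUD : ∀ {n} → Facelet n → Bool
isCornerUD (U , r , c) = isCorner (U , r , c)
isCornerUD (D , r , c) = isCorner (D , r , c)
isCornerUD _ = false

-- sum of the corner orientations x_1 + ... + x_8: the cubie whose U/D
-- sticker started at s has orientation twist (g s).
cornerTwistSum : (n : ℕ) → (Facelet n → Facelet n) → ℕ
cornerTwistSum n g = sum (map (λ s → twist (g s)) (filterᵇ isCornerUD (allFacelets n)))

-- Left-handed coupled-edge facelets.  For a facelet along the edge of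
-- its face (viewed from outside) that edge is turned to the top and the
-- facelet is left-handed if it lies left of the edge's midpoint.
-- (Only used on edge facelets, i.e. exactly one of r,c on the border.)

leftHanded : ∀ {n} → Facelet n → Bool
leftHanded {n} (X , r , c) =
  if toℕ r ≡ᵇ 0 then toℕ c <ᵇ n / 2
  else if toℕ r ≡ᵇ (n ∸ 1) then not (toℕ c <ᵇ n / 2)
  else if toℕ c ≡ᵇ (n ∸ 1) then toℕ r <ᵇ n / 2
  else if toℕ c ≡ᵇ 0 then not (toℕ r <ᵇ n / 2)
  else false

{-# OPTIONS --safe #-}
module Submission where

-- The facelets of the cube of size 2h form families of 24, one for every pair (a , b) of layers: (0 , 0)
-- are the corners, (0 , b) and (b , 0) the two stickers of the coupled edges b, and (a , b) with a, b ≠ 0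
-- the centers.  A place of a family is a right-handed frame of three faces, and the turn X_k rotates a place
-- of (a , b) exactly if X is its first axis and k = 0, or its second and k = a, or its third and k = b.
-- So whatever a word in the slices 0, a, b does is settled by finitely many cases, whatever the size.
--
-- First the corners are solved with conjugates of a swap of two corners; the twist sum excludes a last twist.
-- The commutator [U_b , F_a U_0 F_a⁻¹] is a three-cycle of the family (a , b), b ≠ 0, and fixes all others
-- (for a = 0 it also moves the other stickers of the same edges).  Its conjugates solve every even
-- permutation of a family.  An odd permutation of edges becomes even by one turn of its slice.  The relation
-- between the signs is kept by every turn, so the centers are even once corners and edges are solved.

-- The order corners, edges, centers is dictated by what the words disturb. Corner swaps are words
-- in outer turns and may scramble edges and centers. The quarter turn that repairs the parity of an
-- edge orbit moves neither corners nor other edge orbits, but it moves centers. The three-cycles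
-- move nothing outside their orbit, so for the centers no parity can be chosen any more.
--
-- The three-cycle rests on a general fact: two permutations that move exactly one common point have
-- a three-cycle as commutator. In the family `(a , b)` the two factors meet only in the place
-- `(L , q1)`, whether `a ≡ 0`, `a ≡ b` or neither; in the families that stay fixed they commute.
--
-- The condition `y_i = 0` removes orientation from the coupled edges: an edge cubie is the place of
-- its left-handed sticker, the other sticker is the `spin` of it, and turns respect this. For
-- corners the obstacle is chirality: cubies move by rotations, and the determinant rules out
-- reflected stickers.

open import Defs
open import Data.Nat using (ℕ; _≤_; _<_; _/_; _%_)
open import Data.Nat.Divisibility using (_∣_)
open import Data.Bool using (true)
open import Data.Sign using (_*_)
open import Relation.Binary.PropositionalEquality using (_≡_; _≢_)
open import Algebra.Bundles using (CommutativeMonoid)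
import Algebra.Properties.CommutativeSemigroup as CommutativeSemigroupProperties
open import Data.Bool using (Bool; false; not; _∧_; _∨_; if_then_else_; T?)
open import Data.Bool.ListAction using (all; and; any)
open import Data.Bool.Properties using (T-≡; ∧-identityʳ; ∧-zeroʳ; ∨-identityʳ; ∨-zeroʳ)
open import Data.Empty using (⊥; ⊥-elim)
open import Data.Fin as Fin using (Fin; zero; suc; toℕ)
import Data.Fin.Properties as Finₚ
open import Data.Integer as ℤ using (ℤ; +_; 0ℤ; 1ℤ; -1ℤ; _≤ᵇ_)
  renaming (_+_ to _+ᶻ_; _*_ to _*ᶻ_; _-_ to _-ᶻ_)
import Data.Integer.Properties as ℤₚ
open import Data.Integer.Tactic.RingSolver using (solve-∀)
open import Data.List using (List; []; _∷_; map; _++_; length; filterᵇ; concatMap; foldl; cartesianProduct; allFin)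
open import Data.List.Membership.Propositional using (_∈_)
open import Data.List.Membership.Propositional.Properties
  using (∈-map⁺; ∈-map⁻; ∈-∃++; ∈-++⁻; ∈-++⁺ˡ; ∈-++⁺ʳ; ∈-allFin; ∈-cartesianProduct⁺; ∈-filter⁺; ∈-filter⁻)
open import Data.List.Membership.Propositional.Properties.WithK using (unique∧set⇒bag)
open import Data.List.Properties
  using (length-map; length-++; map-cong; map-cong-local; map-++; map-∘; map-id; concatMap-cong; foldl-++)
open import Data.List.Relation.Binary.BagAndSetEquality using (∼bag⇒↭)
open import Data.List.Relation.Binary.Permutation.Propositional using (_↭_; refl; prep; swap; ↭-sym; ↭-trans)
open import Data.List.Relation.Binary.Permutation.Propositional.Properties
  using (∈-resp-↭; shift) renaming (map⁺ to ↭-map⁺)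
open import Data.List.Relation.Unary.All as All using ([]; _∷_)
open import Data.List.Relation.Unary.AllPairs using ([]; _∷_)
open import Data.List.Relation.Unary.Any using (here; there)
open import Data.List.Relation.Unary.Unique.Propositional using (Unique)
open import Data.List.Relation.Unary.Unique.Propositional.Properties using (cartesianProduct⁺; filter⁺; allFin⁺)
open import Data.Nat as ℕ using (zero; suc; _≡ᵇ_; _<ᵇ_; _∸_; _⊓_; s≤s; z≤n)
open import Data.Nat.DivMod using (%-distribˡ-+; m%n%n≡m%n; m*n/n≡m)
open import Data.Nat.Divisibility using (divides)
open import Data.Nat.ListAction using (sum)
open import Data.Nat.ListAction.Properties using (sum-↭)
import Data.Nat.Properties as ℕₚ
import Data.Nat.Tactic.RingSolver as ℕ-Solver
open import Data.Product using (_×_; _,_; proj₁; proj₂; Σ; ∃)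
open import Data.Sign using (Sign; opposite)
open import Data.Sign.Properties using (*-assoc; *-identityʳ; s*s≡+; *-commutativeMonoid)
open import Data.Sum using (_⊎_; inj₁; inj₂)
open import Function using (_∘_; Equivalence; mk⇔)
open import Relation.Binary.Definitions using (DecidableEquality)
open import Relation.Binary.PropositionalEquality
  using (refl; sym; trans; cong; cong₂; subst; ≢-sym; module ≡-Reasoning)
open import Relation.Nullary using (¬_; Dec; yes; no; contradiction; does)
open import Relation.Nullary.Decidable using (dec-true; dec-false)

open CommutativeSemigroupProperties (CommutativeMonoid.commutativeSemigroup *-commutativeMonoid)
  using (interchange; x∙yz≈y∙xz)
open CommutativeSemigroupProperties ℕₚ.+-commutativeSemigroup using () renaming (interchange to +-interchange)

-- Signs of permutations

∏ : ∀ {A : Set} → (A → Sign) → List A → Sign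
∏ f []       = Sign.+
∏ f (x ∷ xs) = f x * ∏ f xs

-- One factor for every two positions of the list. If `ψ` is symmetric on the entries, their order
-- does not matter (`∏₂-↭`), which is how products over pairs get reindexed by a permutation.
∏₂ : ∀ {A : Set} → (A → A → Sign) → List A → Sign
∏₂ ψ []       = Sign.+
∏₂ ψ (x ∷ xs) = ∏ (ψ x) xs * ∏₂ ψ xs

∏-cong : ∀ {A : Set} {f g : A → Sign} xs → (∀ {x} → x ∈ xs → f x ≡ g x) → ∏ f xs ≡ ∏ g xs
∏-cong []       eq = refl
∏-cong (x ∷ xs) eq = cong₂ _*_ (eq (here refl)) (∏-cong xs (eq ∘ there))

∏-* : ∀ {A : Set} (f g : A → Sign) xs → ∏ (λ x → f x * g x) xs ≡ ∏ f xs * ∏ g xs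
∏-* f g []       = refl
∏-* f g (x ∷ xs) = trans (cong (f x * g x *_) (∏-* f g xs)) (interchange (f x) (g x) (∏ f xs) (∏ g xs))

∏-+ : ∀ {A : Set} {f : A → Sign} xs → (∀ {x} → x ∈ xs → f x ≡ Sign.+) → ∏ f xs ≡ Sign.+
∏-+ []       eq = refl
∏-+ (x ∷ xs) eq = cong₂ _*_ (eq (here refl)) (∏-+ xs (eq ∘ there))

∏-map : ∀ {A B : Set} (f : B → Sign) (h : A → B) xs → ∏ f (map h xs) ≡ ∏ (f ∘ h) xs
∏-map f h []       = refl
∏-map f h (x ∷ xs) = cong (f (h x) *_) (∏-map f h xs)

∏-↭ : ∀ {A : Set} (f : A → Sign) {xs ys} → xs ↭ ys → ∏ f xs ≡ ∏ f ys
∏-↭ f refl         = refl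
∏-↭ f (prep x p)   = cong (f x *_) (∏-↭ f p)
∏-↭ f (swap x y p) = trans (x∙yz≈y∙xz (f x) (f y) _) (cong (λ s → f y * (f x * s)) (∏-↭ f p))
∏-↭ f (_↭_.trans p q)  = trans (∏-↭ f p) (∏-↭ f q)

∏₂-cong : ∀ {A : Set} {φ ψ : A → A → Sign} {xs} → Unique xs →
  (∀ {x y} → x ∈ xs → y ∈ xs → x ≢ y → φ x y ≡ ψ x y) → ∏₂ φ xs ≡ ∏₂ ψ xs
∏₂-cong []       eq = refl
∏₂-cong (x∉ ∷ u) eq = cong₂ _*_
  (∏-cong _ (λ y∈ → eq (here refl) (there y∈) (All.lookup x∉ y∈)))
  (∏₂-cong u (λ x∈ y∈ → eq (there x∈) (there y∈)))

∏₂-ext : ∀ {A : Set} {φ ψ : A → A → Sign} xs → (∀ x y → φ x y ≡ ψ x y) → ∏₂ φ xs ≡ ∏₂ ψ xs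
∏₂-ext []       eq = refl
∏₂-ext (x ∷ xs) eq = cong₂ _*_ (∏-cong xs (λ _ → eq x _)) (∏₂-ext xs eq)

∏₂-* : ∀ {A : Set} (φ ψ : A → A → Sign) xs → ∏₂ (λ x y → φ x y * ψ x y) xs ≡ ∏₂ φ xs * ∏₂ ψ xs
∏₂-* φ ψ []       = refl
∏₂-* φ ψ (x ∷ xs) = trans (cong₂ _*_ (∏-* (φ x) (ψ x) xs) (∏₂-* φ ψ xs))
                          (interchange (∏ (φ x) xs) (∏ (ψ x) xs) (∏₂ φ xs) (∏₂ ψ xs))

∏₂-map : ∀ {A B : Set} (ψ : B → B → Sign) (h : A → B) xs → ∏₂ ψ (map h xs) ≡ ∏₂ (λ x y → ψ (h x) (h y)) xs
∏₂-map ψ h []       = refl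
∏₂-map ψ h (x ∷ xs) = cong₂ _*_ (∏-map (ψ (h x)) h xs) (∏₂-map ψ h xs)

∏₂-↭ : ∀ {A : Set} (ψ : A → A → Sign) {xs ys} → xs ↭ ys →
  (∀ {x y} → x ∈ xs → y ∈ xs → ψ x y ≡ ψ y x) → ∏₂ ψ xs ≡ ∏₂ ψ ys
∏₂-↭ ψ refl                 s = refl
∏₂-↭ ψ (prep x p)           s = cong₂ _*_ (∏-↭ (ψ x) p) (∏₂-↭ ψ p (λ x∈ y∈ → s (there x∈) (there y∈)))
∏₂-↭ ψ (swap {xs} {ys} x y p) s = begin
  (ψ x y * ∏ (ψ x) xs) * (∏ (ψ y) xs * ∏₂ ψ xs) ≡⟨ interchange (ψ x y) (∏ (ψ x) xs) (∏ (ψ y) xs) (∏₂ ψ xs) ⟩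
  (ψ x y * ∏ (ψ y) xs) * (∏ (ψ x) xs * ∏₂ ψ xs) ≡⟨ cong₂ _*_
    (cong₂ _*_ (s (here refl) (there (here refl))) (∏-↭ (ψ y) p))
    (cong₂ _*_ (∏-↭ (ψ x) p) (∏₂-↭ ψ p (λ x∈ y∈ → s (there (there x∈)) (there (there y∈))))) ⟩
  (ψ y x * ∏ (ψ y) ys) * (∏ (ψ x) ys * ∏₂ ψ ys) ∎
  where open ≡-Reasoning
∏₂-↭ ψ (_↭_.trans p q)          s = trans (∏₂-↭ ψ p s)
  (∏₂-↭ ψ q (λ x∈ y∈ → s (∈-resp-↭ (↭-sym p) x∈) (∈-resp-↭ (↭-sym p) y∈)))

-- Off the diagonal each pair of the square occurs in both orders. This passes from the ordered
-- pairs that `inversions` counts to the unordered pairs of `signOn`.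
∏∏-split : ∀ {A : Set} (φ : A → A → Sign) xs →
  ∏ (λ x → ∏ (φ x) xs) xs ≡ ∏ (λ x → φ x x) xs * ∏₂ (λ x y → φ x y * φ y x) xs
∏∏-split φ []       = refl
∏∏-split φ (x ∷ xs) = begin
  (φ x x * ∏ (φ x) xs) * ∏ (λ y → φ y x * ∏ (φ y) xs) xs
    ≡⟨ cong (φ x x * ∏ (φ x) xs *_) (∏-* (λ y → φ y x) (λ y → ∏ (φ y) xs) xs) ⟩
  (φ x x * ∏ (φ x) xs) * (∏ (λ y → φ y x) xs * ∏ (λ y → ∏ (φ y) xs) xs)
    ≡⟨ *-assoc (φ x x) _ _ ⟩
  φ x x * (∏ (φ x) xs * (∏ (λ y → φ y x) xs * ∏ (λ y → ∏ (φ y) xs) xs))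
    ≡⟨ cong (φ x x *_) (*-assoc (∏ (φ x) xs) _ _) ⟨
  φ x x * ((∏ (φ x) xs * ∏ (λ y → φ y x) xs) * ∏ (λ y → ∏ (φ y) xs) xs)
    ≡⟨ cong (φ x x *_) (cong₂ _*_ (sym (∏-* (φ x) (λ y → φ y x) xs)) (∏∏-split φ xs)) ⟩
  φ x x * (∏ ψ xs * (∏ (λ y → φ y y) xs * ∏₂ (λ x y → φ x y * φ y x) xs))
    ≡⟨ cong (φ x x *_) (x∙yz≈y∙xz (∏ ψ xs) (∏ (λ y → φ y y) xs) (∏₂ (λ x y → φ x y * φ y x) xs)) ⟩
  φ x x * (∏ (λ y → φ y y) xs * (∏ ψ xs * ∏₂ (λ x y → φ x y * φ y x) xs))
    ≡⟨ *-assoc (φ x x) _ _ ⟨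
  (φ x x * ∏ (λ y → φ y y) xs) * (∏ ψ xs * ∏₂ (λ x y → φ x y * φ y x) xs) ∎
  where
  open ≡-Reasoning
  ψ = λ y → φ x y * φ y x

cmp : ∀ {A : Set} → (A → A → Bool) → A → A → Sign
cmp lt x y = if lt x y then Sign.+ else Sign.-

-- A pair contributes `-` exactly when `σ` reverses its order, so this is the parity of the
-- inversions. As a product of two comparisons it telescopes under composition, which a count does
-- not.
signOn : ∀ {A : Set} → (A → A → Bool) → (A → A) → List A → Sign
signOn lt σ = ∏₂ (λ x y → cmp lt x y * cmp lt (σ x) (σ y))

TotalOn : ∀ {A : Set} → (A → A → Bool) → List A → Set
TotalOn lt xs = ∀ {x y} → x ∈ xs → y ∈ xs → x ≢ y → lt y x ≡ not (lt x y)

cmp-anti : ∀ {A : Set} {lt : A → A → Bool} {xs} → TotalOn lt xs →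
  ∀ {x y} → x ∈ xs → y ∈ xs → x ≢ y → cmp lt y x ≡ opposite (cmp lt x y)
cmp-anti {lt = lt} tot {x} {y} x∈ y∈ x≢y with lt x y | lt y x | tot x∈ y∈ x≢y
... | true  | .false | refl = refl
... | false | .true  | refl = refl

opposite-*-opposite : ∀ s t → opposite s * opposite t ≡ s * t
opposite-*-opposite Sign.+ Sign.+ = refl
opposite-*-opposite Sign.+ Sign.- = refl
opposite-*-opposite Sign.- Sign.+ = refl
opposite-*-opposite Sign.- Sign.- = refl

*≡+⇒≡ : ∀ s t → s * t ≡ Sign.+ → s ≡ t
*≡+⇒≡ Sign.+ Sign.+ _ = refl
*≡+⇒≡ Sign.- Sign.- _ = refl

cancel-inner : ∀ s t u → (s * t) * (t * u) ≡ s * u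
cancel-inner s t u = trans (*-assoc s t (t * u))
  (cong (s *_) (trans (sym (*-assoc t t u)) (cong (_* u) (s*s≡+ t))))

module _ {A : Set} (_≟_ : DecidableEquality A) where

  symmetric : {ψ : A → A → Sign} {xs : List A} →
    (∀ {x y} → x ∈ xs → y ∈ xs → x ≢ y → ψ x y ≡ ψ y x) →
    ∀ {x y} → x ∈ xs → y ∈ xs → ψ x y ≡ ψ y x
  symmetric s {x} {y} x∈ y∈ with x ≟ y
  ... | yes refl = refl
  ... | no x≢y   = s x∈ y∈ x≢y

  -- The comparison of `σ x` with `σ y` is inserted twice. This splits the factor of `τ ∘ σ` into
  -- that of `σ` and that of `τ` at the images; the latter is symmetric in the pair and may be
  -- reindexed along `σ`.
  signOn-∘ : ∀ {lt : A → A → Bool} {pts} → TotalOn lt pts → (σ τ : A → A) →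
    map σ pts ↭ pts → (∀ {x} → x ∈ pts → τ x ∈ pts) →
    (∀ {x y} → x ∈ pts → y ∈ pts → τ x ≡ τ y → x ≡ y) →
    signOn lt (τ ∘ σ) pts ≡ signOn lt σ pts * signOn lt τ pts
  signOn-∘ {lt} {pts} tot σ τ perm τ∈ τ-inj = begin
    ∏₂ (λ x y → s x y * s (τ (σ x)) (τ (σ y))) pts
      ≡⟨ ∏₂-ext pts (λ x y → sym (cancel-inner (s x y) (s (σ x) (σ y)) _)) ⟩
    ∏₂ (λ x y → (s x y * s (σ x) (σ y)) * θ (σ x) (σ y)) pts ≡⟨ ∏₂-* _ _ pts ⟩
    signOn lt σ pts * ∏₂ (λ x y → θ (σ x) (σ y)) pts            ≡⟨ cong (signOn lt σ pts *_) (∏₂-map θ σ pts) ⟨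
    signOn lt σ pts * ∏₂ θ (map σ pts)                          ≡⟨ cong (signOn lt σ pts *_) (sym (∏₂-↭ θ (↭-sym perm) (symmetric θ-sym))) ⟩
    signOn lt σ pts * signOn lt τ pts                           ∎
    where
    open ≡-Reasoning
    s = cmp lt
    θ = λ x y → s x y * s (τ x) (τ y)
    θ-sym : ∀ {x y} → x ∈ pts → y ∈ pts → x ≢ y → θ x y ≡ θ y x
    θ-sym {x} {y} x∈ y∈ x≢y = sym (trans
      (cong₂ _*_ (cmp-anti tot x∈ y∈ x≢y) (cmp-anti tot (τ∈ x∈) (τ∈ y∈) (x≢y ∘ τ-inj x∈ y∈)))
      (opposite-*-opposite (s x y) (s (τ x) (τ y))))

  -- The ratio of two comparisons is symmetric, so its product over all pairs does not change under σ.
  signOn-order : ∀ {lt lt′ : A → A → Bool} {pts} → TotalOn lt pts → TotalOn lt′ pts → (σ : A → A) →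
    map σ pts ↭ pts → signOn lt σ pts ≡ signOn lt′ σ pts
  signOn-order {lt} {lt′} {pts} tot tot′ σ perm = *≡+⇒≡ _ _ (begin
    signOn lt σ pts * signOn lt′ σ pts                         ≡⟨ ∏₂-* _ _ pts ⟨
    ∏₂ (λ x y → (s x y * s (σ x) (σ y)) * (s′ x y * s′ (σ x) (σ y))) pts
      ≡⟨ ∏₂-ext pts (λ x y → interchange (s x y) (s (σ x) (σ y)) (s′ x y) (s′ (σ x) (σ y))) ⟩
    ∏₂ (λ x y → r x y * r (σ x) (σ y)) pts                   ≡⟨ ∏₂-* r _ pts ⟩
    ∏₂ r pts * ∏₂ (λ x y → r (σ x) (σ y)) pts                  ≡⟨ cong (∏₂ r pts *_) (∏₂-map r σ pts) ⟨
    ∏₂ r pts * ∏₂ r (map σ pts)                                ≡⟨ cong (∏₂ r pts *_) (∏₂-↭ r (↭-sym perm) (symmetric r-sym)) ⟨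
    ∏₂ r pts * ∏₂ r pts                                        ≡⟨ s*s≡+ (∏₂ r pts) ⟩
    Sign.+                                                 ∎)
    where
    open ≡-Reasoning
    s  = cmp lt
    s′ = cmp lt′
    r = λ x y → s x y * s′ x y
    r-sym : ∀ {x y} → x ∈ pts → y ∈ pts → x ≢ y → r x y ≡ r y x
    r-sym {x} {y} x∈ y∈ x≢y = sym (trans
      (cong₂ _*_ (cmp-anti tot x∈ y∈ x≢y) (cmp-anti tot′ x∈ y∈ x≢y)) (opposite-*-opposite (s x y) (s′ x y)))

signOn-cong : ∀ {A : Set} (lt : A → A → Bool) {σ τ : A → A} {pts} → Unique pts →
  (∀ {x} → x ∈ pts → σ x ≡ τ x) → signOn lt σ pts ≡ signOn lt τ pts
signOn-cong lt u eq = ∏₂-cong u (λ {x} {y} x∈ y∈ _ → cong₂ (λ a b → cmp lt x y * cmp lt a b) (eq x∈) (eq y∈))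

negIf : Bool → Sign
negIf b = if b then Sign.- else Sign.+

parity-filter : ∀ {A : Set} (q : A → Bool) xs → parity (length (filterᵇ q xs)) ≡ ∏ (negIf ∘ q) xs
parity-filter q []       = refl
parity-filter q (x ∷ xs) with q x
... | false = parity-filter q xs
... | true  = trans (cong opposite (parity-filter q xs)) (lemma (∏ (negIf ∘ q) xs))
  where
  lemma : ∀ s → opposite s ≡ Sign.- * s
  lemma Sign.+ = refl
  lemma Sign.- = refl

∏-++ : ∀ {A : Set} (f : A → Sign) xs ys → ∏ f (xs ++ ys) ≡ ∏ f xs * ∏ f ys
∏-++ f []       ys = refl
∏-++ f (x ∷ xs) ys = trans (cong (f x *_) (∏-++ f xs ys)) (sym (*-assoc (f x) _ _))

∏-pairs : ∀ {A : Set} (f : A × A → Sign) xs ys →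
  ∏ f (concatMap (λ x → map (λ y → (x , y)) ys) xs) ≡ ∏ (λ x → ∏ (λ y → f (x , y)) ys) xs
∏-pairs f []       ys = refl
∏-pairs f (x ∷ xs) ys = trans (∏-++ f (map (x ,_) ys) _)
  (cong₂ _*_ (∏-map f (x ,_) ys) (∏-pairs f xs ys))

-- `α` names the representatives by the points `pts`, and `P′` is the position after the
-- arrangement. Of the two orders of a pair only the increasing one can be counted, and it is
-- counted exactly if `σ` reverses the pair.
inversions-signOn : ∀ {A B : Set} (_<_ : B → B → Bool) → (∀ b → (b < b) ≡ false) →
  (reps : List A) (P P′ : A → B) {C : Set} {pts : List C} {α : C → A} (σ : C → C) →
  reps ↭ map α pts → Unique pts → (∀ {x} → x ∈ pts → σ x ∈ pts) →
  (∀ {x y} → x ∈ pts → y ∈ pts → σ x ≡ σ y → x ≡ y) →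
  (∀ {x} → x ∈ pts → P′ (α x) ≡ P (α (σ x))) →
  TotalOn (λ x y → P (α x) < P (α y)) pts →
  parity (length (filterᵇ (λ ff → (P (proj₁ ff) < P (proj₂ ff)) ∧ (P′ (proj₂ ff) < P′ (proj₁ ff)))
    (concatMap (λ f → map (λ f' → (f , f')) reps) reps)))
  ≡ signOn (λ x y → P (α x) < P (α y)) σ pts
inversions-signOn _<_ irr reps P P′ {pts = pts} {α} σ perm u σ∈ σ-inj eq tot = begin
  parity (length (filterᵇ q (concatMap (λ f → map (λ f' → (f , f')) reps) reps)))
    ≡⟨ trans (parity-filter q (concatMap (λ f → map (f ,_) reps) reps)) (∏-pairs (negIf ∘ q) reps reps) ⟩
  ∏ (λ x → ∏ (λ y → negIf (q (x , y))) reps) reps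
    ≡⟨ trans (∏-↭ _ perm) (∏-map _ α pts) ⟩
  ∏ (λ x → ∏ (λ y → negIf (q (α x , y))) reps) pts
    ≡⟨ ∏-cong pts (λ {x} _ → trans (∏-↭ _ perm) (∏-map _ α pts)) ⟩
  ∏ (λ x → ∏ (λ y → negIf (q (α x , α y))) pts) pts
    ≡⟨ ∏-cong pts (λ {x} x∈ → ∏-cong pts (λ {y} y∈ → cong negIf
         (cong₂ (λ a b → lt x y ∧ (a < b)) (eq y∈) (eq x∈)))) ⟩
  ∏ (λ x → ∏ (φ x) pts) pts
    ≡⟨ ∏∏-split φ pts ⟩
  ∏ (λ x → φ x x) pts * ∏₂ (λ x y → φ x y * φ y x) pts
    ≡⟨ cong₂ _*_ (∏-+ pts (λ {x} _ → diag x)) (∏₂-cong u off-diag) ⟩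
  signOn lt σ pts ∎
  where
  open ≡-Reasoning
  q = λ ff → (P (proj₁ ff) < P (proj₂ ff)) ∧ (P′ (proj₂ ff) < P′ (proj₁ ff))
  lt = λ x y → P (α x) < P (α y)
  φ = λ x y → negIf (lt x y ∧ lt (σ y) (σ x))
  diag : ∀ x → φ x x ≡ Sign.+
  diag x rewrite irr (P (α x)) = refl
  off-diag : ∀ {x y} → x ∈ pts → y ∈ pts → x ≢ y → φ x y * φ y x ≡ cmp lt x y * cmp lt (σ x) (σ y)
  off-diag {x} {y} x∈ y∈ x≢y
    with lt x y | lt y x | tot x∈ y∈ x≢y | lt (σ x) (σ y) | lt (σ y) (σ x) | tot (σ∈ x∈) (σ∈ y∈) (x≢y ∘ σ-inj x∈ y∈)
  ... | true  | .false | refl | true  | .false | refl = refl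
  ... | true  | .false | refl | false | .true  | refl = refl
  ... | false | .true  | refl | true  | .false | refl = refl
  ... | false | .true  | refl | false | .true  | refl = refl

-- Duplicate-free lists and their permutations

unique-map : ∀ {A B : Set} {f : A → B} {xs} → Unique xs →
  (∀ {x y} → x ∈ xs → y ∈ xs → f x ≡ f y → x ≡ y) → Unique (map f xs)
unique-map []       inj = []
unique-map {f = f} {x ∷ xs} (x∉ ∷ u) inj =
  All.tabulate fresh ∷ unique-map u (λ x∈ y∈ → inj (there x∈) (there y∈))
  where
  fresh : ∀ {z} → z ∈ map f xs → f x ≢ z
  fresh z∈ eq with ∈-map⁻ f z∈
  ... | w , w∈ , refl = All.lookup x∉ w∈ (inj (here refl) (there w∈) eq)

-- Pigeonhole: each head of `xs` is removed from `ys` where it occurs, uniqueness keeps the rest of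
-- `xs` inside what remains, and the length bound leaves no surplus in `ys` at the end.
unique-⊆⇒↭ : ∀ {A : Set} {xs ys : List A} → Unique xs → (∀ {x} → x ∈ xs → x ∈ ys) →
  length ys ≤ length xs → xs ↭ ys
unique-⊆⇒↭ {ys = []}    []       sub len = refl
unique-⊆⇒↭ {ys = _ ∷ _} []       sub ()
unique-⊆⇒↭ {xs = x ∷ xs} (x∉ ∷ u) sub len with ∈-∃++ (sub (here refl))
... | as , bs , refl = ↭-trans (prep x (unique-⊆⇒↭ u sub′ len′)) (↭-sym (shift x as bs))
  where
  sub′ : ∀ {y} → y ∈ xs → y ∈ as ++ bs
  sub′ y∈ with ∈-++⁻ as (sub (there y∈))
  ... | inj₁ y∈as             = ∈-++⁺ˡ y∈as
  ... | inj₂ (here refl)      = contradiction refl (All.lookup x∉ y∈)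
  ... | inj₂ (there y∈bs)     = ∈-++⁺ʳ as y∈bs
  len′ : length (as ++ bs) ≤ length xs
  len′ rewrite length-++ as {bs} | length-++ as {x ∷ bs} | ℕₚ.+-suc (length as) (length bs) = ℕₚ.≤-pred len

injective-map-↭ : ∀ {A : Set} {f : A → A} {xs} → Unique xs → (∀ {x} → x ∈ xs → f x ∈ xs) →
  (∀ {x y} → x ∈ xs → y ∈ xs → f x ≡ f y → x ≡ y) → map f xs ↭ xs
injective-map-↭ {f = f} {xs} u closed inj = unique-⊆⇒↭ (unique-map u inj) sub
  (ℕₚ.≤-reflexive (sym (length-map f xs)))
  where
  sub : ∀ {x} → x ∈ map f xs → x ∈ xs
  sub x∈ with ∈-map⁻ f x∈
  ... | w , w∈ , refl = closed w∈

-- The 24 places of an orbit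

data Quarter : Set where
  q0 q1 q2 q3 : Quarter

-- (X , q) is the q-th quadrant of face X, counted clockwise from the top left one; it also stands
-- for the right-handed frame of faces (X , side X q , side X (prev q)).
Place : Set
Place = Face × Quarter

next prev : Quarter → Quarter
next q0 = q1
next q1 = q2
next q2 = q3
next q3 = q0
prev q0 = q3
prev q1 = q0
prev q2 = q1
prev q3 = q2

_+q_ : Quarter → Quarter → Quarter
q0 +q r = r
q1 +q r = next r
q2 +q r = next (next r)
q3 +q r = prev r

side : Face → Quarter → Face
side U q0 = B
side U q1 = R
side U q2 = F
side U q3 = L
side D q0 = F
side D q1 = R
side D q2 = B
side D q3 = L
side F q0 = U
side F q1 = R
side F q2 = D
side F q3 = L
side B q0 = U
side B q1 = L
side B q2 = D
side B q3 = R
side R q0 = U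
side R q1 = B
side R q2 = D
side R q3 = F
side L q0 = U
side L q1 = F
side L q2 = D
side L q3 = B

axis₁ axis₂ axis₃ : Place → Face
axis₁ (X , q) = X
axis₂ (X , q) = side X q
axis₃ (X , q) = side X (prev q)

-- turn X Y: where the clockwise turn about X takes the first quadrant of face Y
turn : Face → Face → Face × Quarter
turn U U = U , q1
turn U D = D , q3
turn U F = L , q0
turn U B = R , q0
turn U R = F , q0
turn U L = B , q0
turn D U = U , q3
turn D D = D , q1
turn D F = R , q0
turn D B = L , q0
turn D R = B , q0
turn D L = F , q0
turn F U = R , q1
turn F D = L , q1
turn F F = F , q1
turn F B = B , q3
turn F R = D , q1
turn F L = U , q1
turn B U = L , q3
turn B D = R , q3
turn B F = F , q3
turn B B = B , q1
turn B R = U , q3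
turn B L = D , q3
turn R U = B , q2
turn R D = F , q0
turn R F = U , q0
turn R B = D , q2
turn R R = R , q1
turn R L = L , q3
turn L U = F , q0
turn L D = B , q2
turn L F = D , q0
turn L B = U , q2
turn L R = R , q3
turn L L = L , q1

rotate : Face → Place → Place
rotate X (Y , q) with turn X Y
... | Z , r = Z , r +q q

-- cyclically permutes the axes (axis₁ , axis₂ , axis₃) ↦ (axis₂ , axis₃ , axis₁)
spin : Place → Place
spin (U , q0) = B , q1
spin (U , q1) = R , q1
spin (U , q2) = F , q1
spin (U , q3) = L , q1
spin (D , q0) = F , q3
spin (D , q1) = R , q3
spin (D , q2) = B , q3
spin (D , q3) = L , q3
spin (F , q0) = U , q3
spin (F , q1) = R , q0
spin (F , q2) = D , q1
spin (F , q3) = L , q2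
spin (B , q0) = U , q1
spin (B , q1) = L , q0
spin (B , q2) = D , q3
spin (B , q3) = R , q2
spin (R , q0) = U , q2
spin (R , q1) = B , q0
spin (R , q2) = D , q2
spin (R , q3) = F , q2
spin (L , q0) = U , q0
spin (L , q1) = F , q0
spin (L , q2) = D , q0
spin (L , q3) = B , q2

infix 4 _=F_ _=Q_ _=P_

_=F_ : Face → Face → Bool
X =F Y = rank X ≡ᵇ rank Y

quarterIx : Quarter → ℕ
quarterIx q0 = 0
quarterIx q1 = 1
quarterIx q2 = 2
quarterIx q3 = 3

_=Q_ : Quarter → Quarter → Bool
q =Q r = quarterIx q ≡ᵇ quarterIx r

_=P_ : Place → Place → Bool
(X , q) =P (Y , r) = (X =F Y) ∧ (q =Q r)

-- The flags say whether the turned slice is the layer 0, `a` or `b` of the family. Only they enter,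
-- so one turn has 6 · 8 · 24 cases to examine for cubes of all sizes.
selects : Face → Bool → Bool → Bool → Place → Bool
selects X i j k t = (i ∧ (axis₁ t =F X)) ∨ ((j ∧ (axis₂ t =F X)) ∨ (k ∧ (axis₃ t =F X)))

step : Face → Bool → Bool → Bool → Place → Place
step X i j k t = if selects X i j k t then rotate X t else t

rank-injective : ∀ {X Y} → rank X ≡ rank Y → X ≡ Y
rank-injective {X} {Y} eq = trans (sym (unrank-rank X)) (trans (cong unrank eq) (unrank-rank Y))
  where
  unrank : ℕ → Face
  unrank 0 = U
  unrank 1 = D
  unrank 2 = F
  unrank 3 = B
  unrank 4 = R
  unrank _ = L
  unrank-rank : ∀ X → unrank (rank X) ≡ X
  unrank-rank U = refl
  unrank-rank D = refl
  unrank-rank F = refl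
  unrank-rank B = refl
  unrank-rank R = refl
  unrank-rank L = refl

quarterIx-injective : ∀ {q r} → quarterIx q ≡ quarterIx r → q ≡ r
quarterIx-injective {q} {r} eq = trans (sym (un-ix q)) (trans (cong un eq) (un-ix r))
  where
  un : ℕ → Quarter
  un 0 = q0
  un 1 = q1
  un 2 = q2
  un _ = q3
  un-ix : ∀ q → un (quarterIx q) ≡ q
  un-ix q0 = refl
  un-ix q1 = refl
  un-ix q2 = refl
  un-ix q3 = refl

∧⇒ˡ : ∀ {a b} → a ∧ b ≡ true → a ≡ true
∧⇒ˡ {true} _ = refl

∧⇒ʳ : ∀ {a b} → a ∧ b ≡ true → b ≡ true
∧⇒ʳ {true} eq = eq

≡ᵇ-sound : ∀ m n → (m ≡ᵇ n) ≡ true → m ≡ n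
≡ᵇ-sound m n eq = ℕₚ.≡ᵇ⇒≡ m n (Equivalence.from T-≡ eq)

≡ᵇ-refl : ∀ m → (m ≡ᵇ m) ≡ true
≡ᵇ-refl zero    = refl
≡ᵇ-refl (suc m) = ≡ᵇ-refl m

=F-sound : ∀ {X Y} → (X =F Y) ≡ true → X ≡ Y
=F-sound eq = rank-injective (≡ᵇ-sound _ _ eq)

=P-sound : ∀ {s t} → (s =P t) ≡ true → s ≡ t
=P-sound eq = cong₂ _,_ (=F-sound (∧⇒ˡ eq)) (quarterIx-injective (≡ᵇ-sound _ _ (∧⇒ʳ eq)))

=P-refl : ∀ t → (t =P t) ≡ true
=P-refl (X , q) rewrite ≡ᵇ-refl (rank X) = ≡ᵇ-refl (quarterIx q)

_≟P_ : DecidableEquality Place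
s ≟P t with s =P t in eq
... | true  = yes (=P-sound eq)
... | false = no λ where refl → contradiction (trans (sym (=P-refl t)) eq) λ ()

-- Proof by exhaustion over finite types

all-sound : ∀ {A : Set} (p : A → Bool) xs → all p xs ≡ true → ∀ {x} → x ∈ xs → p x ≡ true
all-sound p (x ∷ xs) eq (here refl) = ∧⇒ˡ eq
all-sound p (x ∷ xs) eq (there y∈)  = all-sound p xs (∧⇒ʳ eq) y∈

record Finite (A : Set) : Set where
  field
    elements : List A
    complete : ∀ a → a ∈ elements
    unique   : Unique elements
open Finite {{...}}

-- Nearly every use gives the second hypothesis by `refl`, so that the type checker evaluates the
-- test on the whole list.
exhaust : ∀ {A : Set} {{_ : Finite A}} (p : A → Bool) → all p elements ≡ true → ∀ a → p a ≡ true
exhaust p eq a = all-sound p elements eq (complete a)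

instance
  finite-Bool : Finite Bool
  finite-Bool = record
    { elements = true ∷ false ∷ []
    ; complete = λ { true → here refl ; false → there (here refl) }
    ; unique   = ((λ ()) ∷ []) ∷ [] ∷ [] }

  finite-Face : Finite Face
  finite-Face = record
    { elements = faces
    ; complete = λ where
        U → here refl
        D → there (here refl)
        F → there (there (here refl))
        B → there (there (there (here refl)))
        R → there (there (there (there (here refl))))
        L → there (there (there (there (there (here refl)))))
    ; unique   = ((λ ()) ∷ (λ ()) ∷ (λ ()) ∷ (λ ()) ∷ (λ ()) ∷ []) ∷ ((λ ()) ∷ (λ ()) ∷ (λ ()) ∷ (λ ()) ∷ [])
        ∷ ((λ ()) ∷ (λ ()) ∷ (λ ()) ∷ []) ∷ ((λ ()) ∷ (λ ()) ∷ []) ∷ ((λ ()) ∷ []) ∷ [] ∷ [] }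

  finite-Quarter : Finite Quarter
  finite-Quarter = record
    { elements = q0 ∷ q1 ∷ q2 ∷ q3 ∷ []
    ; complete = λ where
        q0 → here refl
        q1 → there (here refl)
        q2 → there (there (here refl))
        q3 → there (there (there (here refl)))
    ; unique   = ((λ ()) ∷ (λ ()) ∷ (λ ()) ∷ []) ∷ ((λ ()) ∷ (λ ()) ∷ []) ∷ ((λ ()) ∷ []) ∷ [] ∷ [] }

  finite-× : ∀ {A B : Set} {{_ : Finite A}} {{_ : Finite B}} → Finite (A × B)
  finite-× = record
    { elements = cartesianProduct elements elements
    ; complete = λ (a , b) → ∈-cartesianProduct⁺ (complete a) (complete b)
    ; unique   = cartesianProduct⁺ unique unique }

places : List Place
places = elements

_⇒ᵇ_ : Bool → Bool → Bool
a ⇒ᵇ b = not a ∨ b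

⇒ᵇ-sound : ∀ {a b} → (a ⇒ᵇ b) ≡ true → a ≡ true → b ≡ true
⇒ᵇ-sound {true} eq refl = eq

step⁴ : ∀ X i j k t → step X i j k (step X i j k (step X i j k (step X i j k t))) ≡ t
step⁴ X i j k t = =P-sound (exhaust (λ (X , i , j , k , t) →
  step X i j k (step X i j k (step X i j k (step X i j k t))) =P t) refl (X , i , j , k , t))

step-injective : ∀ X i j k {s t} → step X i j k s ≡ step X i j k t → s ≡ t
step-injective X i j k {s} {t} eq = trans (sym (step⁴ X i j k s))
  (trans (cong (λ u → step X i j k (step X i j k (step X i j k u))) eq) (step⁴ X i j k t))

spin³ : ∀ t → spin (spin (spin t)) ≡ t
spin³ t = =P-sound (exhaust (λ t → spin (spin (spin t)) =P t) refl t)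

spin-injective : ∀ {s t} → spin s ≡ spin t → s ≡ t
spin-injective {s} {t} eq = trans (sym (spin³ s)) (trans (cong (spin ∘ spin) eq) (spin³ t))

spin≢ : ∀ t → spin t ≢ t
spin≢ t eq = contradiction (trans (sym (cong not (=P-refl t)))
  (subst (λ u → not (u =P t) ≡ true) eq (exhaust (λ t → not (spin t =P t)) refl t))) λ ()

spin²≢ : ∀ t → spin (spin t) ≢ t
spin²≢ t eq = spin≢ t (trans (cong spin (sym eq)) (spin³ t))

-- The frame of `spin t` with depths 0, b, 0 lists the same axes with the same depths as that of `t`
-- with 0, 0, b, starting one later. So the two stickers of an edge cubie turn together, and for
-- `i ≡ j` the stickers of a corner.
step-spin : ∀ X i j t → step X i j i (spin t) ≡ spin (step X i i j t)
step-spin X i j t = =P-sound (exhaust (λ (X , i , j , t) →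
  step X i j i (spin t) =P spin (step X i i j t)) refl (X , i , j , t))

placeIx : Place → ℕ
placeIx (X , q) = 4 ℕ.* rank X ℕ.+ quarterIx q

-- A numbering on which signs can be evaluated, whereas the positions compared by `lexLt` depend on
-- the size of the cube. `signOn-order` allows the exchange.
_<P_ : Place → Place → Bool
s <P t = placeIx s <ᵇ placeIx t

placeIx-injective : ∀ {s t} → placeIx s ≡ placeIx t → s ≡ t
placeIx-injective {s} {t} eq = =P-sound (⇒ᵇ-sound
  (exhaust (λ (s , t) → (placeIx s ≡ᵇ placeIx t) ⇒ᵇ (s =P t)) refl (s , t))
  (subst (λ m → (placeIx s ≡ᵇ m) ≡ true) eq (≡ᵇ-refl (placeIx s))))

<ᵇ-total : ∀ m n → m ≢ n → (n <ᵇ m) ≡ not (m <ᵇ n)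
<ᵇ-total zero    zero    ≢ = contradiction refl ≢
<ᵇ-total zero    (suc n) ≢ = refl
<ᵇ-total (suc m) zero    ≢ = refl
<ᵇ-total (suc m) (suc n) ≢ = <ᵇ-total m n (≢ ∘ cong suc)

<P-total : ∀ {ts} → TotalOn _<P_ ts
<P-total _ _ s≢t = <ᵇ-total _ _ (s≢t ∘ placeIx-injective)

sign₂₄ : (Place → Place) → Sign
sign₂₄ σ = signOn _<P_ σ places

sign₂₄-cong : ∀ {σ τ} → (∀ t → σ t ≡ τ t) → sign₂₄ σ ≡ sign₂₄ τ
sign₂₄-cong eq = signOn-cong _<P_ unique (λ {t} _ → eq t)

InjectiveP : (Place → Place) → Set
InjectiveP σ = ∀ {s t} → σ s ≡ σ t → s ≡ t

sign₂₄-∘ : ∀ σ τ → InjectiveP σ → InjectiveP τ → sign₂₄ (τ ∘ σ) ≡ sign₂₄ σ * sign₂₄ τ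
sign₂₄-∘ σ τ σ-inj τ-inj = signOn-∘ _≟P_ <P-total σ τ
  (injective-map-↭ unique (λ _ → complete _) (λ _ _ → σ-inj)) (λ _ → complete _) (λ _ _ → τ-inj)

_=S_ : Sign → Sign → Bool
Sign.+ =S Sign.+ = true
Sign.- =S Sign.- = true
_      =S _      = false

=S-sound : ∀ {s t} → (s =S t) ≡ true → s ≡ t
=S-sound {Sign.+} {Sign.+} _ = refl
=S-sound {Sign.-} {Sign.-} _ = refl

-- The places that have `X` as first, second or third axis form three disjoint four-cycles of the
-- turn, one for each flag.
sign₂₄-step : ∀ X i j k → sign₂₄ (step X i j k) ≡ negIf i * (negIf j * negIf k)
sign₂₄-step X i j k = =S-sound (exhaust (λ (X , i , j , k) →
  sign₂₄ (step X i j k) =S (negIf i * (negIf j * negIf k))) refl (X , i , j , k))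

-- Corner cubies, represented by their U/D place

onUD : Place → Bool
onUD (X , _) = rank X <ᵇ 2

cubie : Place → Place
cubie t = if onUD t then t else (if onUD (spin t) then spin t else spin (spin t))

-- How many times `spin` must be applied to reach U or D. `turnOf-orient` identifies this with the
-- clockwise steps of `twist`.
orient : Place → ℕ
orient t = if onUD t then 0 else (if onUD (spin t) then 1 else 2)

cubies : List Place
cubies = filterᵇ onUD places

cubies-unique : Unique cubies
cubies-unique = filter⁺ (T? ∘ onUD) unique

onUD⇒∈-cubies : ∀ {t} → onUD t ≡ true → t ∈ cubies
onUD⇒∈-cubies {t} ud = ∈-filter⁺ (T? ∘ onUD) (complete t) (Equivalence.from T-≡ ud)

∈-cubies⇒onUD : ∀ {t} → t ∈ cubies → onUD t ≡ true
∈-cubies⇒onUD t∈ = Equivalence.to T-≡ (proj₂ (∈-filter⁻ (T? ∘ onUD) {xs = places} t∈))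

cubie-∈ : ∀ t → cubie t ∈ cubies
cubie-∈ t = onUD⇒∈-cubies (exhaust (λ t → onUD (cubie t)) refl t)

cubie-spin : ∀ t → cubie (spin t) ≡ cubie t
cubie-spin t = =P-sound (exhaust (λ t → cubie (spin t) =P cubie t) refl t)

cubie-onUD : ∀ {t} → t ∈ cubies → cubie t ≡ t
cubie-onUD {t} t∈ rewrite ∈-cubies⇒onUD t∈ = refl

∨⇒⊎ : ∀ {a b} → a ∨ b ≡ true → a ≡ true ⊎ b ≡ true
∨⇒⊎ {true}  _  = inj₁ refl
∨⇒⊎ {false} eq = inj₂ eq

cubie-fibre : ∀ {s t} → cubie s ≡ cubie t → s ≡ t ⊎ s ≡ spin t ⊎ s ≡ spin (spin t)
cubie-fibre {s} {t} eq with ∨⇒⊎ (⇒ᵇ-sound (exhaust (λ (s , t) →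
    (cubie s =P cubie t) ⇒ᵇ ((s =P t) ∨ ((s =P spin t) ∨ (s =P spin (spin t))))) refl (s , t))
    (subst (λ u → (cubie s =P u) ≡ true) eq (=P-refl (cubie s))))
... | inj₁ e = inj₁ (=P-sound e)
... | inj₂ e with ∨⇒⊎ e
...   | inj₁ e′ = inj₂ (inj₁ (=P-sound e′))
...   | inj₂ e′ = inj₂ (inj₂ (=P-sound e′))

cornerStep : Face → Bool → Place → Place
cornerStep X i = step X i i i

cubie-cornerStep : ∀ X i t → cubie (cornerStep X i (cubie t)) ≡ cubie (cornerStep X i t)
cubie-cornerStep X i t = =P-sound (exhaust (λ (X , i , t) →
  cubie (cornerStep X i (cubie t)) =P cubie (cornerStep X i t)) refl (X , i , t))

-- Twists add up: what a turn adds depends only on the corner where a sticker is, so it can be read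
-- off from the U/D place of that corner.
orient-cornerStep : ∀ X i t →
  orient (cornerStep X i t) % 3 ≡ (orient t ℕ.+ orient (cornerStep X i (cubie t))) % 3
orient-cornerStep X i t = ≡ᵇ-sound _ _ (exhaust (λ (X , i , t) →
  orient (cornerStep X i t) % 3 ≡ᵇ (orient t ℕ.+ orient (cornerStep X i (cubie t))) % 3) refl (X , i , t))

-- Turns of U and D twist nothing; any other turn twists two of its four corners by 1 and two by 2.
sum-orient-cornerStep : ∀ X i → sum (map (λ r → orient (cornerStep X i r)) cubies) % 3 ≡ 0
sum-orient-cornerStep X i = ≡ᵇ-sound _ _ (exhaust (λ (X , i) →
  sum (map (λ r → orient (cornerStep X i r)) cubies) % 3 ≡ᵇ 0) refl (X , i))

cubieStep-injective : ∀ X i {s t} → s ∈ cubies → t ∈ cubies →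
  cubie (cornerStep X i s) ≡ cubie (cornerStep X i t) → s ≡ t
cubieStep-injective X i {s} {t} s∈ t∈ eq = =P-sound (⇒ᵇ-sound (exhaust (λ (X , i , s , t) →
    (onUD s ∧ (onUD t ∧ (cubie (cornerStep X i s) =P cubie (cornerStep X i t)))) ⇒ᵇ (s =P t))
    refl (X , i , s , t)) hyp)
  where
  hyp : onUD s ∧ (onUD t ∧ (cubie (cornerStep X i s) =P cubie (cornerStep X i t))) ≡ true
  hyp rewrite ∈-cubies⇒onUD s∈ | ∈-cubies⇒onUD t∈ | eq = =P-refl (cubie (cornerStep X i t))

sign₈ : (Place → Place) → Sign
sign₈ π = signOn _<P_ (cubie ∘ π) cubies

sign₈-cornerStep : ∀ X i → sign₈ (cornerStep X i) ≡ negIf i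
sign₈-cornerStep X i = =S-sound (exhaust (λ (X , i) → sign₈ (cornerStep X i) =S negIf i) refl (X , i))

sign₈-cong : ∀ {π ρ} → (∀ t → π t ≡ ρ t) → sign₈ π ≡ sign₈ ρ
sign₈-cong eq = signOn-cong _<P_ cubies-unique (λ {t} _ → cong cubie (eq t))

twistSum : (Place → Place) → ℕ
twistSum π = sum (map (orient ∘ π) cubies)

SpinInvariant : (Place → Place) → Set
SpinInvariant π = ∀ t → π (spin t) ≡ spin (π t)

module _ {π : Place → Place} (inj : InjectiveP π) (spin-inv : SpinInvariant π) where

  cubie-π-injective : ∀ {s t} → s ∈ cubies → t ∈ cubies → cubie (π s) ≡ cubie (π t) → s ≡ t
  cubie-π-injective {s} {t} s∈ t∈ eq =
    trans (sym (cubie-onUD s∈)) (trans (lemma (cubie-fibre eq)) (cubie-onUD t∈))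
    where
    lemma : π s ≡ π t ⊎ π s ≡ spin (π t) ⊎ π s ≡ spin (spin (π t)) → cubie s ≡ cubie t
    lemma (inj₁ e)        = cong cubie (inj e)
    lemma (inj₂ (inj₁ e)) = trans (cong cubie (inj (trans e (sym (spin-inv t))))) (cubie-spin t)
    lemma (inj₂ (inj₂ e)) =
      trans (cong cubie (inj (trans e (trans (cong spin (sym (spin-inv t))) (sym (spin-inv (spin t)))))))
            (trans (cubie-spin (spin t)) (cubie-spin t))

  cubie-π-↭ : map (cubie ∘ π) cubies ↭ cubies
  cubie-π-↭ = injective-map-↭ cubies-unique (λ {t} _ → cubie-∈ (π t)) cubie-π-injective

  sign₈-∘ : ∀ X i → sign₈ (cornerStep X i ∘ π) ≡ sign₈ π * negIf i
  sign₈-∘ X i = begin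
    sign₈ (cornerStep X i ∘ π)
      ≡⟨ signOn-cong _<P_ cubies-unique (λ {t} _ → sym (cubie-cornerStep X i (π t))) ⟩
    signOn _<P_ ((cubie ∘ cornerStep X i) ∘ (cubie ∘ π)) cubies
      ≡⟨ signOn-∘ _≟P_ <P-total (cubie ∘ π) (cubie ∘ cornerStep X i) cubie-π-↭ (λ {t} _ → cubie-∈ (cornerStep X i t)) (cubieStep-injective X i) ⟩
    sign₈ π * sign₈ (cornerStep X i)
      ≡⟨ cong (sign₈ π *_) (sign₈-cornerStep X i) ⟩
    sign₈ π * negIf i ∎
    where open ≡-Reasoning

  -- The added twists are those at the places `cubie (π t)`, which run once through all eight
  -- corners whatever `π` is.
  twistSum-∘ : ∀ X i → twistSum (cornerStep X i ∘ π) % 3 ≡ twistSum π % 3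
  twistSum-∘ X i = begin
    twistSum (cornerStep X i ∘ π) % 3                               ≡⟨ split cubies ⟩
    (twistSum π ℕ.+ sum (map (δ ∘ (cubie ∘ π)) cubies)) % 3
      ≡⟨ cong (λ xs → (twistSum π ℕ.+ sum xs) % 3) (map-∘ {g = δ} {f = cubie ∘ π} cubies) ⟩
    (twistSum π ℕ.+ sum (map δ (map (cubie ∘ π) cubies))) % 3
      ≡⟨ cong (λ m → (twistSum π ℕ.+ m) % 3) (sum-↭ (↭-map⁺ δ cubie-π-↭)) ⟩
    (twistSum π ℕ.+ sum (map δ cubies)) % 3                         ≡⟨ %-distribˡ-+ (twistSum π) (sum (map δ cubies)) 3 ⟩
    (twistSum π % 3 ℕ.+ sum (map δ cubies) % 3) % 3
      ≡⟨ cong (λ m → (twistSum π % 3 ℕ.+ m) % 3) (sum-orient-cornerStep X i) ⟩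
    (twistSum π % 3 ℕ.+ 0) % 3                                      ≡⟨ cong (_% 3) (ℕₚ.+-identityʳ (twistSum π % 3)) ⟩
    twistSum π % 3 % 3                                              ≡⟨ m%n%n≡m%n (twistSum π) 3 ⟩
    twistSum π % 3                                                  ∎
    where
    open ≡-Reasoning
    δ = λ r → orient (cornerStep X i r)
    split : ∀ ts → sum (map (δ ∘ π) ts) % 3 ≡ (sum (map (orient ∘ π) ts) ℕ.+ sum (map (δ ∘ (cubie ∘ π)) ts)) % 3
    split []       = refl
    split (t ∷ ts) = begin
      (c ℕ.+ S) % 3                      ≡⟨ %-distribˡ-+ c S 3 ⟩
      (c % 3 ℕ.+ S % 3) % 3              ≡⟨ cong₂ (λ a b → (a ℕ.+ b) % 3) (orient-cornerStep X i (π t)) (split ts) ⟩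
      ((o ℕ.+ d) % 3 ℕ.+ (O ℕ.+ E) % 3) % 3 ≡⟨ %-distribˡ-+ (o ℕ.+ d) (O ℕ.+ E) 3 ⟨
      ((o ℕ.+ d) ℕ.+ (O ℕ.+ E)) % 3      ≡⟨ cong (_% 3) (+-interchange o d O E) ⟩
      ((o ℕ.+ O) ℕ.+ (d ℕ.+ E)) % 3      ∎
      where
      c = δ (π t)
      S = sum (map (δ ∘ π) ts)
      o = orient (π t)
      d = δ (cubie (π t))
      O = sum (map (orient ∘ π) ts)
      E = sum (map (δ ∘ (cubie ∘ π)) ts)

s*[s*t]≡t : ∀ s t → s * (s * t) ≡ t
s*[s*t]≡t s t = trans (sym (*-assoc s s t)) (cong (_* t) (s*s≡+ s))

-- The effect of one turn on both sides of the sign relation. An outer slice moves an edge orbit in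
-- two four-cycles, so its flag `i` enters once on the left and five times on the right, while `j`
-- and `k` enter once on each side.
sign-balance : ∀ i j k c e f → ((c * e) * f) * (negIf i * (negIf j * negIf k)) ≡
  ((c * negIf i) * (e * (negIf i * (negIf i * negIf j)))) * (f * (negIf i * (negIf i * negIf k)))
sign-balance i j k c e f
  rewrite s*[s*t]≡t (negIf i) (negIf j) | s*[s*t]≡t (negIf i) (negIf k)
  = trans (cong ((c * e) * f *_) (sym (*-assoc (negIf i) (negIf j) (negIf k))))
    (trans (interchange (c * e) f (negIf i * negIf j) (negIf k)) (cong (_* (f * negIf k)) (interchange c e (negIf i) (negIf j))))

-- States of the cube: one self-map of the 24 places for every pair of layers

inverse : ∀ {A : Set} → List A → List A
inverse []       = []
inverse (m ∷ ms) = inverse ms ++ (m ∷ m ∷ m ∷ [])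

module _ {h : ℕ} where

  Layer = Fin (suc h)

  infix 4 _=L_
  _=L_ : Layer → Layer → Bool
  a =L b = does (a Fin.≟ b)

  Turn : Set
  Turn = Face × Layer

  State : Set
  State = Layer → Layer → Place → Place

  turnAct : Turn → State
  turnAct (X , k) a b = step X (k =L zero) (k =L a) (k =L b)

  run : List Turn → State
  run []       a b t = t
  run (m ∷ ms) a b t = run ms a b (turnAct m a b t)

  _▷_ : List Turn → State → State
  (ms ▷ π) a b t = run ms a b (π a b t)

  run-++ : ∀ ms ns a b t → run (ms ++ ns) a b t ≡ run ns a b (run ms a b t)
  run-++ []       ns a b t = refl
  run-++ (m ∷ ms) ns a b t = run-++ ms ns a b _

  run-concatMap : ∀ {A : Set} (w : A → List Turn) a b {f : A → Place → Place} →
    (∀ x t → run (w x) a b t ≡ f x t) → ∀ xs t →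
    run (concatMap w xs) a b t ≡ foldl (λ u x → f x u) t xs
  run-concatMap w a b eq []       t = refl
  run-concatMap w a b {f} eq (x ∷ xs) t = trans (run-++ (w x) _ a b t)
    (trans (run-concatMap w a b eq xs _) (cong (λ u → foldl (λ u x → f x u) u xs) (eq x t)))

  run-inverse : ∀ ms a b t → run (inverse ms) a b (run ms a b t) ≡ t
  run-inverse []             a b t = refl
  run-inverse (m@(X , k) ∷ ms) a b t = begin
    run (inverse ms ++ (m ∷ m ∷ m ∷ [])) a b (run ms a b (turnAct m a b t))
      ≡⟨ run-++ (inverse ms) _ a b _ ⟩
    run (m ∷ m ∷ m ∷ []) a b (run (inverse ms) a b (run ms a b (turnAct m a b t)))
      ≡⟨ cong (run (m ∷ m ∷ m ∷ []) a b) (run-inverse ms a b _) ⟩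
    run (m ∷ m ∷ m ∷ []) a b (turnAct m a b t)
      ≡⟨ step⁴ X (k =L zero) (k =L a) (k =L b) t ⟩
    t ∎
    where open ≡-Reasoning

  -- (0 , 0) are the corners, (0 , b) and (b , 0) the left- and right-handed places of the coupled
  -- edges b, and (a , b) with a , b ≢ 0 a center orbit.
  record Admissible (π : State) : Set where
    field
      injective : ∀ a b → InjectiveP (π a b)
      coupled   : ∀ b t → π b zero (spin t) ≡ spin (π zero b t)
      signs     : ∀ a b → a ≢ zero → b ≢ zero →
                  sign₂₄ (π a b) ≡ sign₈ (π zero zero) * sign₂₄ (π zero a) * sign₂₄ (π zero b)
      untwisted : twistSum (π zero zero) % 3 ≡ 0
  open Admissible

  turn-admissible : ∀ m {π} → Admissible π → Admissible ((m ∷ []) ▷ π)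
  turn-admissible m@(X , k) {π} adm = record
    { injective = λ a b → injective adm a b ∘ turn-injective a b
    ; coupled   = λ b t → trans (cong (turnAct m b zero) (coupled adm b t)) (step-spin X (k =L zero) (k =L b) (π zero b t))
    ; signs     = λ a b a≢0 b≢0 → begin
        sign₂₄ (turnAct m a b ∘ π a b)
          ≡⟨ factor a b ⟩
        sign₂₄ (π a b) * (n zero * (n a * n b))
          ≡⟨ cong (_* (n zero * (n a * n b))) (signs adm a b a≢0 b≢0) ⟩
        ((c * e a) * e b) * (n zero * (n a * n b))
          ≡⟨ sign-balance (k =L zero) (k =L a) (k =L b) c (e a) (e b) ⟩
        ((c * n zero) * (e a * (n zero * (n zero * n a)))) * (e b * (n zero * (n zero * n b)))
          ≡⟨ cong₂ _*_ (cong₂ _*_ (sign₈-∘ (injective adm zero zero) (coupled adm zero) X (k =L zero))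
                                  (factor zero a)) (factor zero b) ⟨
        (sign₈ (turnAct m zero zero ∘ π zero zero) * sign₂₄ (turnAct m zero a ∘ π zero a))
          * sign₂₄ (turnAct m zero b ∘ π zero b) ∎
    ; untwisted = trans (twistSum-∘ (injective adm zero zero) (coupled adm zero) X (k =L zero)) (untwisted adm)
    }
    where
    open ≡-Reasoning
    n = λ a → negIf (k =L a)
    c = sign₈ (π zero zero)
    e = λ a → sign₂₄ (π zero a)
    turn-injective : ∀ a b → InjectiveP (turnAct m a b)
    turn-injective a b = step-injective X (k =L zero) (k =L a) (k =L b)
    factor : ∀ a b → sign₂₄ (turnAct m a b ∘ π a b) ≡ sign₂₄ (π a b) * (n zero * (n a * n b))
    factor a b = trans (sign₂₄-∘ (π a b) (turnAct m a b) (injective adm a b) (turn-injective a b))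
      (cong (sign₂₄ (π a b) *_) (sign₂₄-step X (k =L zero) (k =L a) (k =L b)))

  ▷-admissible : ∀ ms {π} → Admissible π → Admissible (ms ▷ π)
  ▷-admissible []       adm = adm
  ▷-admissible (m ∷ ms) adm = ▷-admissible ms (turn-admissible m adm)

-- Solving a permutation place by place

elem : Place → List Place → Bool
elem t = any (t =P_)

elem-sound : ∀ {t} xs → elem t xs ≡ true → t ∈ xs
elem-sound (x ∷ xs) eq with ∨⇒⊎ eq
... | inj₁ e = here (=P-sound e)
... | inj₂ e = there (elem-sound xs e)

sweep : (Place → Place → Place) → List Place → Place → Place
sweep act ls t = foldl (λ u l → act l u) t ls

sweep-++ : ∀ act ls ls′ t → sweep act (ls ++ ls′) t ≡ sweep act ls′ (sweep act ls t)
sweep-++ act ls ls′ t = foldl-++ _ t ls ls′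

-- `act l` are the available permutations, `recipe p t` is a list of them meant to bring `t` to `p`,
-- and `block p` are the places that `Inv` fixes along with `p`. That the recipes work in the chosen
-- order is not assumed but tested by `settles`.
module Sift
  (act : Place → Place → Place)
  (recipe : Place → Place → List Place)
  (block : Place → List Place)
  (Inv : (Place → Place) → Set)
  (inv⇒injective : ∀ {ρ} → Inv ρ → InjectiveP ρ)
  (inv-act : ∀ l {ρ} → Inv ρ → Inv (act l ∘ ρ))
  (inv-block : ∀ {ρ p} → Inv ρ → ρ p ≡ p → ∀ {s} → s ∈ block p → ρ s ≡ s)
  where

  settled : List Place → List Place → List Place
  settled fixed []       = fixed
  settled fixed (p ∷ ps) = settled (block p ++ fixed) ps

  -- No recipe is required for a settled `t`: if `ρ p` is settled, `ρ` fixes it, and injectivity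
  -- gives `ρ p ≡ p`.
  brings : List Place → Place → Place → Bool
  brings fixed p t = elem t fixed ∨ ((sweep act (recipe p t) t =P p)
    ∧ all (λ s → sweep act (recipe p t) s =P s) fixed)

  settles : List Place → List Place → Bool
  settles fixed []       = true
  settles fixed (p ∷ ps) = all (brings fixed p) places ∧ settles (block p ++ fixed) ps

  inv-sweep : ∀ ls {ρ} → Inv ρ → Inv (sweep act ls ∘ ρ)
  inv-sweep []       inv = inv
  inv-sweep (l ∷ ls) inv = inv-sweep ls (inv-act l inv)

  sift : ∀ fixed todo → settles fixed todo ≡ true → ∀ {ρ} → Inv ρ →
    (∀ {s} → s ∈ fixed → ρ s ≡ s) →
    ∃ λ ls → ∀ {s} → s ∈ settled fixed todo → sweep act ls (ρ s) ≡ s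
  sift fixed []       ok inv fx = [] , fx
  sift fixed (p ∷ ps) ok {ρ} inv fx = go (∨⇒⊎ (exhaust (brings fixed p) (∧⇒ˡ ok) (ρ p)))
    where
    extend : ∀ {σ} → Inv σ → σ p ≡ p → (∀ {s} → s ∈ fixed → σ s ≡ s) → ∀ {s} → s ∈ block p ++ fixed → σ s ≡ s
    extend inv′ σp fx′ s∈ with ∈-++⁻ (block p) s∈
    ... | inj₁ s∈b = inv-block inv′ σp s∈b
    ... | inj₂ s∈f = fx′ s∈f
    go : elem (ρ p) fixed ≡ true ⊎ _ → _
    go (inj₁ e) = sift (block p ++ fixed) ps (∧⇒ʳ ok) inv
      (extend inv (inv⇒injective inv (fx (elem-sound fixed e))) fx)
    go (inj₂ e) with sift (block p ++ fixed) ps (∧⇒ʳ ok) (inv-sweep w inv) (extend (inv-sweep w inv) (=P-sound (∧⇒ˡ e))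
         λ {s} s∈ → trans (cong (sweep act w) (fx s∈)) (=P-sound (all-sound _ fixed (∧⇒ʳ e) s∈)))
      where w = recipe p (ρ p)
    ... | ls , ok′ = recipe p (ρ p) ++ ls , λ {s} s∈ → trans (sweep-++ act (recipe p (ρ p)) ls (ρ s)) (ok′ s∈)

-- `core` moves three places of `(a , b)`: these two and `(U , q1)`, for which `conjugator` is
-- empty.
hub₀ hub₁ : Place
hub₀ = F , q1
hub₁ = L , q1

-- hub₀ ↦ hub₁ ↦ l ↦ hub₀, or the identity if l is a hub
cycle : Place → Place → Place
cycle l t =
  if (l =P hub₀) ∨ (l =P hub₁) then t
  else if t =P hub₀ then hub₁
  else if t =P hub₁ then l
  else if t =P l then hub₀
  else t

cycle-injective : ∀ l → InjectiveP (cycle l)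
cycle-injective l {s} {t} eq = trans (sym (cycle³ s)) (trans (cong (λ u → cycle l (cycle l u)) eq) (cycle³ t))
  where
  cycle³ : ∀ t → cycle l (cycle l (cycle l t)) ≡ t
  cycle³ t = =P-sound (exhaust (λ (l , t) → cycle l (cycle l (cycle l t)) =P t) refl (l , t))

sign₂₄-cycle : ∀ l → sign₂₄ (cycle l) ≡ Sign.+
sign₂₄-cycle l = =S-sound (exhaust (λ l → sign₂₄ (cycle l) =S Sign.+) refl l)

-- `cycle p` reaches `p` from `hub₁` in one application and from `hub₀` in two, and `cycle t` brings
-- any other `t` to `hub₀`. Besides `t` and `p` only the hubs move, which is why they are not among
-- the places to be settled.
cycleRecipe : Place → Place → List Place
cycleRecipe p t =
  if t =P p then []
  else if t =P hub₁ then p ∷ []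
  else if t =P hub₀ then p ∷ p ∷ []
  else t ∷ p ∷ p ∷ []

Even : (Place → Place) → Set
Even ρ = InjectiveP ρ × sign₂₄ ρ ≡ Sign.+

even-cycle : ∀ l {ρ} → Even ρ → Even (cycle l ∘ ρ)
even-cycle l {ρ} (inj , even) = inj ∘ cycle-injective l ,
  trans (sign₂₄-∘ ρ (cycle l) inj (cycle-injective l)) (cong₂ _*_ even (sign₂₄-cycle l))

even-block : ∀ {ρ p} → Even ρ → ρ p ≡ p → ∀ {s} → s ∈ p ∷ [] → ρ s ≡ s
even-block _ eq (here refl) = eq

module CycleSift = Sift cycle cycleRecipe (_∷ []) Even proj₁ even-cycle even-block

nonHubs : List Place
nonHubs = filterᵇ (λ t → not ((t =P hub₀) ∨ (t =P hub₁))) places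

hubSwap : Place → Place
hubSwap t = if t =P hub₀ then hub₁ else if t =P hub₁ then hub₀ else t

∈-settled⊎hub : ∀ t → t ∈ CycleSift.settled [] nonHubs ⊎ t ≡ hub₀ ⊎ t ≡ hub₁
∈-settled⊎hub t with ∨⇒⊎ (exhaust (λ t → elem t (CycleSift.settled [] nonHubs) ∨ ((t =P hub₀) ∨ (t =P hub₁))) refl t)
... | inj₁ e = inj₁ (elem-sound (CycleSift.settled [] nonHubs) e)
... | inj₂ e with ∨⇒⊎ e
...   | inj₁ e′ = inj₂ (inj₁ (=P-sound e′))
...   | inj₂ e′ = inj₂ (inj₂ (=P-sound e′))

-- Apart from the identity only the exchange of the hubs could be left over, and it is odd.
even-settled : ∀ {ρ} → Even ρ → (∀ {s} → s ∈ CycleSift.settled [] nonHubs → ρ s ≡ s) → ∀ t → ρ t ≡ t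
even-settled {ρ} (inj , even) fx = result (hub hub₀ (inj₁ refl)) (hub hub₁ (inj₂ refl))
  where
  hub : ∀ t → t ≡ hub₀ ⊎ t ≡ hub₁ → ρ t ≡ hub₀ ⊎ ρ t ≡ hub₁
  hub t t-hub with ∈-settled⊎hub (ρ t)
  ... | inj₂ e  = e
  ... | inj₁ s∈ = subst (λ u → u ≡ hub₀ ⊎ u ≡ hub₁) (sym (inj (fx s∈))) t-hub
  result : ρ hub₀ ≡ hub₀ ⊎ ρ hub₀ ≡ hub₁ → ρ hub₁ ≡ hub₀ ⊎ ρ hub₁ ≡ hub₁ → ∀ t → ρ t ≡ t
  result (inj₁ e₀) (inj₁ e₁) t = contradiction (inj (trans e₀ (sym e₁))) λ ()
  result (inj₂ e₀) (inj₂ e₁) t = contradiction (inj (trans e₀ (sym e₁))) λ ()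
  result (inj₁ e₀) (inj₂ e₁) t with ∈-settled⊎hub t
  ... | inj₁ s∈          = fx s∈
  ... | inj₂ (inj₁ refl) = e₀
  ... | inj₂ (inj₂ refl) = e₁
  result (inj₂ e₀) (inj₁ e₁) = contradiction (trans (sym even) (sign₂₄-cong swapped)) λ ()
    where
    unmoved : ∀ {t} → t ∈ CycleSift.settled [] nonHubs → hubSwap t ≡ t
    unmoved s∈ = =P-sound (all-sound (λ t → hubSwap t =P t) (CycleSift.settled [] nonHubs) refl s∈)
    swapped : ∀ t → ρ t ≡ hubSwap t
    swapped t with ∈-settled⊎hub t
    ... | inj₁ s∈          = trans (fx s∈) (sym (unmoved s∈))
    ... | inj₂ (inj₁ refl) = e₀
    ... | inj₂ (inj₂ refl) = e₁

-- Words for the three-cycles on the family (a , b)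

data Depth : Set where
  d0 dA dB : Depth

Template : Set
Template = List (Face × Depth)

conjugate commutator : Template → Template → Template
conjugate  u w = u ++ (w ++ inverse u)
commutator u w = u ++ (w ++ (inverse u ++ inverse w))

-- If 0, `a`, `b` are distinct, `U_b` moves the places `(X , q1)` of the four lateral faces, and the
-- second factor those of face U with `(U , q2)` replaced by `(L , q1)`: one common place.
core : Template
core = commutator ((U , dB) ∷ []) (conjugate ((F , dA) ∷ []) ((U , d0) ∷ []))

-- Found by breadth-first search for words that carry the cycle of core to cycle l for all three kinds at once.
conjugator : Place → Template
conjugator (U , q0) = (U , d0) ∷ []
conjugator (U , q2) = (U , d0) ∷ (U , d0) ∷ (U , d0) ∷ []
conjugator (U , q3) = (U , d0) ∷ (U , d0) ∷ []
conjugator (D , q0) = (L , dB) ∷ (L , dB) ∷ (U , d0) ∷ []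
conjugator (D , q1) = (D , d0) ∷ (B , dA) ∷ (B , dA) ∷ (U , d0) ∷ []
conjugator (D , q2) = (B , dA) ∷ (B , dA) ∷ (U , d0) ∷ []
conjugator (D , q3) = (B , dB) ∷ (B , dB) ∷ []
conjugator (F , q0) = (L , dB) ∷ (L , dB) ∷ (L , dB) ∷ (U , d0) ∷ []
conjugator (F , q2) = (D , dA) ∷ (B , dB) ∷ []
conjugator (F , q3) = (D , dB) ∷ (D , dB) ∷ (D , dB) ∷ (B , dA) ∷ (B , dA) ∷ (B , dA) ∷ (U , d0) ∷ []
conjugator (B , q0) = (B , d0) ∷ (R , dA) ∷ (U , dB) ∷ (U , dB) ∷ (U , dB) ∷ []
conjugator (B , q1) = (R , dA) ∷ (U , dB) ∷ (U , dB) ∷ (U , dB) ∷ []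
conjugator (B , q2) = (L , dB) ∷ (U , d0) ∷ []
conjugator (B , q3) = (D , dB) ∷ (B , dA) ∷ (B , dA) ∷ (B , dA) ∷ (U , d0) ∷ []
conjugator (R , q0) = (F , dB) ∷ (F , dB) ∷ (F , dB) ∷ (U , d0) ∷ (F , dB) ∷ (U , d0) ∷ []
conjugator (R , q1) = (B , dA) ∷ (U , d0) ∷ []
conjugator (R , q2) = (B , dB) ∷ []
conjugator (R , q3) = (D , dB) ∷ (D , dB) ∷ (B , dA) ∷ (B , dA) ∷ (B , dA) ∷ (U , d0) ∷ []
conjugator (L , q0) = (B , dB) ∷ (B , dB) ∷ (B , dB) ∷ []
conjugator (L , q2) = (D , dA) ∷ (D , dA) ∷ (D , dA) ∷ (L , dB) ∷ (U , d0) ∷ []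
conjugator (L , q3) = (B , dA) ∷ (B , dA) ∷ (B , dA) ∷ (U , d0) ∷ []
conjugator _ = []

threeCycle : Place → Template
threeCycle l = if (l =P hub₀) ∨ (l =P hub₁) then [] else conjugate (conjugator l) core

-- which of the layers 0, a, b a given layer equals
Class : Set
Class = Bool × Bool × Bool

at : Class → Depth → Bool
at (i , j , k) d0 = i
at (i , j , k) dA = j
at (i , j , k) dB = k

-- `z`, `c`, `d` are the classes of the layer 0 and of the two layers of some family. Flag `δ` of
-- each says whether that layer is the slice at depth `δ`, which is all that a turn depends on.
templateRun : Class → Class → Class → Template → Place → Place
templateRun z c d []            t = t
templateRun z c d ((X , δ) ∷ w) t = templateRun z c d w (step X (at z δ) (at c δ) (at d δ) t)

-- b ≢ 0 and: 0, a, b distinct; a ≡ b; a ≡ 0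
data Kind : Set where
  generic diagonal edge : Kind

class₀ classA classB other : Kind → Class
class₀ generic  = true , false , false
class₀ diagonal = true , false , false
class₀ edge     = true , true , false
classA generic  = false , true , false
classA diagonal = false , true , true
classA edge     = true , true , false
classB generic  = false , false , true
classB diagonal = false , true , true
classB edge     = false , false , true
other _ = false , false , false

classes : Kind → List Class
classes κ = class₀ κ ∷ classA κ ∷ classB κ ∷ other κ ∷ []

instance
  finite-Kind : Finite Kind
  finite-Kind = record
    { elements = generic ∷ diagonal ∷ edge ∷ []
    ; complete = λ where
        generic  → here refl
        diagonal → there (here refl)
        edge     → there (there (here refl))
    ; unique   = ((λ ()) ∷ (λ ()) ∷ []) ∷ ((λ ()) ∷ []) ∷ [] ∷ [] }

threeCycle-correct : ∀ κ l t →
  templateRun (class₀ κ) (classA κ) (classB κ) (threeCycle l) t ≡ cycle l t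
threeCycle-correct κ l t = =P-sound (exhaust (λ (κ , l , t) →
  templateRun (class₀ κ) (classA κ) (classB κ) (threeCycle l) t =P cycle l t) refl (κ , l , t))

-- the family (a , b) itself and, if a ≡ 0, the right-handed facelets of the same edges
touched : Kind → Class → Class → Bool
touched κ c d = (at c dA ∧ at d dB) ∨ (at (class₀ κ) dA ∧ (at c dB ∧ at d d0))

trivialᵇ : Class → Class → Class → Template → Bool
trivialᵇ z c d w = all (λ t → templateRun z c d w t =P t) places

trivialᵇ-sound : ∀ z c d w → trivialᵇ z c d w ≡ true → ∀ t → templateRun z c d w t ≡ t
trivialᵇ-sound z c d w eq t = =P-sound (all-sound (λ t → templateRun z c d w t =P t) places eq (complete t))

isolated : Template → Kind → Class × Class → Bool
isolated w κ (c , d) = touched κ c d ∨ trivialᵇ (class₀ κ) c d w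

isolated-sound : ∀ w κ c d → isolated w κ (c , d) ≡ true → touched κ c d ≡ false →
  ∀ t → templateRun (class₀ κ) c d w t ≡ t
isolated-sound w κ c d eq out rewrite out = trivialᵇ-sound (class₀ κ) c d w eq

classPairs : Kind → List (Class × Class)
classPairs κ = cartesianProduct (classes κ) (classes κ)

allIsolated-sound : ∀ w κ → all (isolated w κ) (classPairs κ) ≡ true → ∀ {c d} → c ∈ classes κ → d ∈ classes κ →
  touched κ c d ≡ false → ∀ t → templateRun (class₀ κ) c d w t ≡ t
allIsolated-sound w κ eq c∈ d∈ = isolated-sound w κ _ _ (all-sound (isolated w κ) (classPairs κ) eq (∈-cartesianProduct⁺ c∈ d∈))

Isolated : Template → Set
Isolated w = ∀ κ {c d} → c ∈ classes κ → d ∈ classes κ → touched κ c d ≡ false →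
  ∀ t → templateRun (class₀ κ) c d w t ≡ t

-- A layer has one of four classes, so sixteen pairs of classes stand for all families of a cube of
-- any size. For the conjugates `run-conjugate` takes the place of such a test.
core-isolated : Isolated core
core-isolated generic  = allIsolated-sound core generic refl
core-isolated diagonal = allIsolated-sound core diagonal refl
core-isolated edge     = allIsolated-sound core edge refl

-- Corner swaps

pivot : Place
pivot = U , q3

-- exchanges the cubie of l with that of pivot so that l goes to pivot; the identity if these cubies agree
swapPivot : Place → Place → Place
swapPivot l t =
  if cubie l =P pivot then t
  else if t =P l then pivot
  else if t =P spin l then spin pivot
  else if t =P spin (spin l) then spin (spin pivot)
  else if t =P pivot then l
  else if t =P spin pivot then spin l
  else if t =P spin (spin pivot) then spin (spin l)
  else t

swapPivot-injective : ∀ l → InjectiveP (swapPivot l)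
swapPivot-injective l {s} {t} eq = trans (sym (swap² s)) (trans (cong (swapPivot l) eq) (swap² t))
  where
  swap² : ∀ t → swapPivot l (swapPivot l t) ≡ t
  swap² t = =P-sound (exhaust (λ (l , t) → swapPivot l (swapPivot l t) =P t) refl (l , t))

swapPivot-spin : ∀ l → SpinInvariant (swapPivot l)
swapPivot-spin l t = =P-sound (exhaust (λ (l , t) → swapPivot l (spin t) =P spin (swapPivot l t)) refl (l , t))

-- `swapPivot l` exchanges the spins of `l` and of `pivot` in step. Hence a sticker at `spin pivot`
-- gets to `p` by the swap that takes `spin (spin p)` to `pivot`. If `t` is another sticker position
-- of the cubie of `p`, two swaps twist that cubie at the expense of `pivot`.
swapRecipe : Place → Place → List Place
swapRecipe p t =
  if t =P pivot then p ∷ []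
  else if t =P spin pivot then spin (spin p) ∷ []
  else if t =P spin (spin pivot) then spin p ∷ []
  else t ∷ p ∷ []

cubieBlock : Place → List Place
cubieBlock p = p ∷ spin p ∷ spin (spin p) ∷ []

Rigid : (Place → Place) → Set
Rigid ρ = InjectiveP ρ × SpinInvariant ρ

rigid-swap : ∀ l {ρ} → Rigid ρ → Rigid (swapPivot l ∘ ρ)
rigid-swap l (inj , spin-inv) = inj ∘ swapPivot-injective l ,
  λ t → trans (cong (swapPivot l) (spin-inv t)) (swapPivot-spin l _)

rigid-block : ∀ {ρ p} → Rigid ρ → ρ p ≡ p → ∀ {s} → s ∈ cubieBlock p → ρ s ≡ s
rigid-block rig eq (here refl)                 = eq
rigid-block (_ , spin-inv) eq (there (here refl)) = trans (spin-inv _) (cong spin eq)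
rigid-block (_ , spin-inv) eq (there (there (here refl))) =
  trans (spin-inv _) (cong spin (trans (spin-inv _) (cong spin eq)))

module SwapSift = Sift swapPivot swapRecipe cubieBlock Rigid proj₁ rigid-swap rigid-block

nonPivots : List Place
nonPivots = filterᵇ (λ t → not (t =P pivot)) cubies

-- R U⁻¹ R F² R⁻¹ U R F² R² U
swapCore : List Face
swapCore = R ∷ U ∷ U ∷ U ∷ R ∷ F ∷ F ∷ R ∷ R ∷ R ∷ U ∷ R ∷ F ∷ F ∷ R ∷ R ∷ U ∷ []

-- On balance it takes `l` to `(U , q2)`, the place that `swapCore` exchanges with `pivot`, and
-- leaves the cubie of `pivot` as it is. For `(U , q2)` itself it is empty.
setup : Place → List Face
setup (U , q0) = B ∷ D ∷ D ∷ D ∷ B ∷ R ∷ R ∷ R ∷ []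
setup (U , q1) = R ∷ B ∷ R ∷ R ∷ R ∷ []
setup (D , q0) = D ∷ R ∷ R ∷ R ∷ B ∷ R ∷ R ∷ R ∷ []
setup (D , q1) = R ∷ R ∷ R ∷ B ∷ R ∷ R ∷ R ∷ []
setup (D , q2) = R ∷ R ∷ []
setup (D , q3) = D ∷ D ∷ D ∷ R ∷ R ∷ []
setup (F , q1) = R ∷ R ∷ B ∷ R ∷ R ∷ R ∷ []
setup (F , q2) = R ∷ []
setup (F , q3) = D ∷ D ∷ B ∷ R ∷ R ∷ R ∷ []
setup (B , q0) = R ∷ R ∷ R ∷ []
setup (B , q1) = B ∷ B ∷ B ∷ R ∷ R ∷ R ∷ []
setup (B , q2) = B ∷ B ∷ R ∷ R ∷ R ∷ []
setup (B , q3) = B ∷ R ∷ R ∷ R ∷ []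
setup (R , q0) = R ∷ R ∷ R ∷ D ∷ B ∷ R ∷ R ∷ R ∷ []
setup (R , q1) = B ∷ B ∷ B ∷ R ∷ R ∷ []
setup (R , q2) = D ∷ D ∷ D ∷ R ∷ []
setup (R , q3) = D ∷ B ∷ R ∷ R ∷ R ∷ []
setup (L , q0) = F ∷ F ∷ F ∷ U ∷ F ∷ R ∷ R ∷ R ∷ []
setup (L , q2) = D ∷ R ∷ []
setup (L , q3) = D ∷ D ∷ D ∷ B ∷ R ∷ R ∷ R ∷ []
setup _ = []

swapWord : Place → List Face
swapWord l = if cubie l =P pivot then [] else setup l ++ (swapCore ++ inverse (setup l))

∈-settled⊎pivot : ∀ t → t ∈ SwapSift.settled [] nonPivots ⊎ t ∈ cubieBlock pivot
∈-settled⊎pivot t with ∨⇒⊎ (exhaust (λ t → elem t (SwapSift.settled [] nonPivots) ∨ elem t (cubieBlock pivot)) refl t)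
... | inj₁ e = inj₁ (elem-sound (SwapSift.settled [] nonPivots) e)
... | inj₂ e = inj₂ (elem-sound (cubieBlock pivot) e)

-- Only the pivot cubie could be twisted, which the twist sum excludes.
rigid-settled : ∀ {ρ} → Rigid ρ → twistSum ρ % 3 ≡ 0 →
  (∀ {s} → s ∈ SwapSift.settled [] nonPivots → ρ s ≡ s) → ∀ t → ρ t ≡ t
rigid-settled {ρ} rig@(inj , _) untw fx = result
  where
  override : Place → Place → Place
  override u t = if t =P pivot then u else t
  twist-eq : twistSum ρ ≡ twistSum (override (ρ pivot))
  twist-eq = cong sum (map-cong-local (All.tabulate (λ {t} t∈ → cong orient (agree t∈))))
    where
    agree : ∀ {t} → t ∈ cubies → ρ t ≡ override (ρ pivot) t
    agree {t} t∈ with t =P pivot in eq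
    ... | true  = cong ρ (=P-sound eq)
    ... | false = fx (elem-sound (SwapSift.settled [] nonPivots) (lemma (all-sound
                    (λ t → (t =P pivot) ∨ elem t (SwapSift.settled [] nonPivots)) cubies refl t∈)))
      where
      lemma : ∀ {b} → (t =P pivot) ∨ b ≡ true → b ≡ true
      lemma e rewrite eq = e
  untw′ : twistSum (override (ρ pivot)) % 3 ≡ 0
  untw′ = trans (cong (_% 3) (sym twist-eq)) untw
  pivot-fixed : ρ pivot ≡ pivot
  pivot-fixed with ∈-settled⊎pivot (ρ pivot)
  ... | inj₁ s∈ = inj (fx s∈)
  ... | inj₂ (here e) = e
  ... | inj₂ (there (here e)) = contradiction (subst (λ u → twistSum (override u) % 3 ≡ 0) e untw′) λ ()
  ... | inj₂ (there (there (here e))) = contradiction (subst (λ u → twistSum (override u) % 3 ≡ 0) e untw′) λ ()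
  result : ∀ t → ρ t ≡ t
  result t with ∈-settled⊎pivot t
  ... | inj₁ s∈ = fx s∈
  ... | inj₂ s∈ = rigid-block rig pivot-fixed s∈

Solved : (Place → Place) → Set
Solved ρ = ∀ t → ρ t ≡ t

sign₂₄-solved : ∀ {ρ} → Solved ρ → sign₂₄ ρ ≡ Sign.+
sign₂₄-solved eq = trans (sign₂₄-cong eq) refl

-- Solving an admissible state

templateRun-cong : ∀ w {z z′ c c′ d d′} → z ≡ z′ → c ≡ c′ → d ≡ d′ →
  ∀ t → templateRun z c d w t ≡ templateRun z′ c′ d′ w t
templateRun-cong w refl refl refl t = refl

class≡ : ∀ {i i′ j j′ k k′ : Bool} → i ≡ i′ → j ≡ j′ → k ≡ k′ → (i , j , k) ≡ (i′ , j′ , k′)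
class≡ refl refl refl = refl

module _ {h : ℕ} where

  open Admissible

  =L-true : (a : Layer {h}) → (a =L a) ≡ true
  =L-true a = dec-true (a Fin.≟ a) refl

  =L-false : {a b : Layer {h}} → a ≢ b → (a =L b) ≡ false
  =L-false {a} {b} = dec-false (a Fin.≟ b)

  swapTurns : Place → List (Turn {h})
  swapTurns l = map (_, zero) (swapWord l)

  swapTurns-correct : ∀ l t → run (swapTurns l) zero zero t ≡ swapPivot l t
  swapTurns-correct l t = =P-sound (exhaust (λ (l , t) → run (swapTurns l) zero zero t =P swapPivot l t) refl (l , t))

  solve-corners : ∀ {π : State {h}} → Admissible π → ∃ λ ms → ∀ t → (ms ▷ π) zero zero t ≡ t
  solve-corners {π} adm with SwapSift.sift [] nonPivots refl (injective adm zero zero , coupled adm zero) (λ ())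
  ... | ls , ok = ms , rigid-settled (injective adm′ zero zero , coupled adm′ zero) (untwisted adm′)
                         (λ {s} s∈ → trans (eq (π zero zero s)) (ok s∈))
    where
    ms = concatMap swapTurns ls
    adm′ = ▷-admissible ms adm
    eq : ∀ t → run ms zero zero t ≡ sweep swapPivot ls t
    eq = run-concatMap swapTurns zero zero swapTurns-correct ls

  module _ (a b : Layer {h}) (b≢0 : b ≢ zero) where

    depth : Depth → Layer {h}
    depth d0 = zero
    depth dA = a
    depth dB = b

    instantiate : Template → List (Turn {h})
    instantiate = map (λ (X , δ) → X , depth δ)

    classOf : Layer {h} → Class
    classOf c = (zero =L c) , (a =L c) , (b =L c)

    run-instantiate : ∀ w c d t →
      run (instantiate w) c d t ≡ templateRun (classOf zero) (classOf c) (classOf d) w t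
    run-instantiate []             c d t = refl
    run-instantiate ((X , d0) ∷ w) c d t = run-instantiate w c d _
    run-instantiate ((X , dA) ∷ w) c d t = run-instantiate w c d _
    run-instantiate ((X , dB) ∷ w) c d t = run-instantiate w c d _

    record Classified : Set where
      field
        kind   : Kind
        at-0   : classOf zero ≡ class₀ kind
        at-a   : classOf a ≡ classA kind
        at-b   : classOf b ≡ classB kind
        at-any : ∀ c → classOf c ∈ classes kind

    classified : Classified
    classified = go (a Fin.≟ zero) (a Fin.≟ b)
      where
      0≢b = ≢-sym b≢0
      classified-by : ∀ κ → classOf zero ≡ class₀ κ → classOf a ≡ classA κ → classOf b ≡ classB κ → Classified
      classified-by κ e₀ eₐ e_b = record
        { kind = κ ; at-0 = e₀ ; at-a = eₐ ; at-b = e_b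
        ; at-any = λ c → any-class c (zero Fin.≟ c) (a Fin.≟ c) (b Fin.≟ c) }
        where
        any-class : ∀ c → Dec (zero ≡ c) → Dec (a ≡ c) → Dec (b ≡ c) → classOf c ∈ classes κ
        any-class c (yes refl) _ _ = here e₀
        any-class c _ (yes refl) _ = there (here eₐ)
        any-class c _ _ (yes refl) = there (there (here e_b))
        any-class c (no ≢₀) (no ≢ₐ) (no ≢_b) =
          there (there (there (here (class≡ (=L-false ≢₀) (=L-false ≢ₐ) (=L-false ≢_b)))))
      go : Dec (a ≡ zero) → Dec (a ≡ b) → Classified
      go (yes refl) (yes refl) = contradiction refl b≢0
      go (yes refl) (no a≢b)   = classified-by edge
        (class≡ refl refl (=L-false b≢0)) (class≡ refl refl (=L-false b≢0))
        (class≡ (=L-false 0≢b) (=L-false 0≢b) (=L-true b))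
      go (no a≢0)   (yes refl) = classified-by diagonal
        (class≡ refl (=L-false a≢0) (=L-false a≢0))
        (class≡ (=L-false (≢-sym a≢0)) (=L-true a) (=L-true a)) (class≡ (=L-false (≢-sym a≢0)) (=L-true a) (=L-true a))
      go (no a≢0)   (no a≢b)   = classified-by generic
        (class≡ refl (=L-false a≢0) (=L-false b≢0))
        (class≡ (=L-false (≢-sym a≢0)) (=L-true a) (=L-false (≢-sym a≢b)))
        (class≡ (=L-false 0≢b) (=L-false a≢b) (=L-true b))

    open Classified classified

    cycleTurns : Place → List (Turn {h})
    cycleTurns l = instantiate (threeCycle l)

    cycleTurns-correct : ∀ l t → run (cycleTurns l) a b t ≡ cycle l t
    cycleTurns-correct l t = trans (run-instantiate (threeCycle l) a b t)
      (trans (templateRun-cong (threeCycle l) at-0 at-a at-b t) (threeCycle-correct kind l t))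

    Untouched : Layer {h} → Layer {h} → Set
    Untouched c d = ¬ (a ≡ c × b ≡ d) × ¬ (a ≡ zero × b ≡ c × zero ≡ d)

    untouched : ∀ {c d} → Untouched c d → touched kind (classOf c) (classOf d) ≡ false
    untouched {c} {d} (¬₁ , ¬₂) = trans
      (cong (λ z → ((a =L c) ∧ (b =L d)) ∨ (at z dA ∧ ((b =L c) ∧ (zero =L d)))) (sym at-0))
      (lemma (a Fin.≟ c) (b Fin.≟ d) (a Fin.≟ zero) (b Fin.≟ c) (zero Fin.≟ d))
      where
      lemma : (p : Dec (a ≡ c)) (q : Dec (b ≡ d)) (r : Dec (a ≡ zero)) (s : Dec (b ≡ c)) (t : Dec (zero ≡ d)) →
        (does p ∧ does q) ∨ (does r ∧ (does s ∧ does t)) ≡ false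
      lemma (yes p) (yes q) _ _ _ = contradiction (p , q) ¬₁
      lemma _ _ (yes r) (yes s) (yes t) = contradiction (r , s , t) ¬₂
      lemma (yes _) (no _) (no _) _ _ = refl
      lemma (yes _) (no _) (yes _) (no _) _ = refl
      lemma (yes _) (no _) (yes _) (yes _) (no _) = refl
      lemma (no _) _ (no _) _ _ = refl
      lemma (no _) _ (yes _) (no _) _ = refl
      lemma (no _) _ (yes _) (yes _) (no _) = refl

    instantiate-inverse : ∀ w → instantiate (inverse w) ≡ inverse (instantiate w)
    instantiate-inverse []      = refl
    instantiate-inverse (m ∷ w) = trans (map-++ _ (inverse w) _) (cong (_++ _) (instantiate-inverse w))

    run-conjugate : ∀ u w c d → (∀ t → run (instantiate w) c d t ≡ t) →
      ∀ t → run (instantiate (conjugate u w)) c d t ≡ t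
    run-conjugate u w c d w-id t = begin
      run (instantiate (u ++ (w ++ inverse u))) c d t
        ≡⟨ cong (λ ms → run ms c d t) (trans (map-++ _ u _)
             (cong (u′ ++_) (trans (map-++ _ w _) (cong (instantiate w ++_) (instantiate-inverse u))))) ⟩
      run (u′ ++ (instantiate w ++ inverse u′)) c d t
        ≡⟨ trans (run-++ u′ _ c d t) (run-++ (instantiate w) _ c d _) ⟩
      run (inverse u′) c d (run (instantiate w) c d (run u′ c d t))
        ≡⟨ cong (run (inverse u′) c d) (w-id _) ⟩
      run (inverse u′) c d (run u′ c d t)
        ≡⟨ run-inverse u′ c d t ⟩
      t ∎
      where
      open ≡-Reasoning
      u′ = instantiate u

    template-untouched : ∀ w → Isolated w → ∀ {c d} → Untouched c d → ∀ t → run (instantiate w) c d t ≡ t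
    template-untouched w iso {c} {d} un t = trans (run-instantiate w c d t)
      (trans (templateRun-cong w at-0 refl refl t) (iso kind (at-any c) (at-any d) (untouched un) t))

    choice-untouched : ∀ e u w → Isolated w → ∀ {c d} → Untouched c d →
      ∀ t → run (instantiate (if e then [] else conjugate u w)) c d t ≡ t
    choice-untouched true  u w iso un         t = refl
    choice-untouched false u w iso {c} {d} un t = run-conjugate u w c d (template-untouched w iso un) t

    cycleTurns-untouched : ∀ {c d} → Untouched c d → ∀ l t → run (cycleTurns l) c d t ≡ t
    cycleTurns-untouched un l = choice-untouched ((l =P hub₀) ∨ (l =P hub₁)) (conjugator l) core core-isolated un

    solve-orbit : ∀ {ρ} → Even ρ → ∃ λ ms →
      (∀ t → run ms a b (ρ t) ≡ t) × (∀ {c d} → Untouched c d → ∀ t → run ms c d t ≡ t)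
    solve-orbit {ρ} even with CycleSift.sift [] nonHubs refl even (λ ())
    ... | ls , ok = ms ,
      (λ t → trans (eq (ρ t)) (even-settled (CycleSift.inv-sweep ls even) ok t)) ,
      (λ {c} {d} un t → trans (run-concatMap cycleTurns c d (cycleTurns-untouched un) ls t) (const-foldl ls t))
      where
      ms = concatMap cycleTurns ls
      eq : ∀ t → run ms a b t ≡ sweep cycle ls t
      eq = run-concatMap cycleTurns a b cycleTurns-correct ls
      const-foldl : ∀ (ls : List Place) (t : Place) → foldl (λ u _ → u) t ls ≡ t
      const-foldl []       t = refl
      const-foldl (_ ∷ ls) t = const-foldl ls t

  -- The second part includes `d ≡ zero`, so that the corners stay solved.
  EdgeSolution : State {h} → Layer {h} → Set
  EdgeSolution π b = ∃ λ ms → Solved ((ms ▷ π) zero b) × (∀ d → d ≢ b → ∀ t → run ms zero d t ≡ t)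

  solve-even-edge : ∀ {π : State {h}} b → b ≢ zero → Even (π zero b) → EdgeSolution π b
  solve-even-edge b b≢0 even = finish (solve-orbit zero b b≢0 even)
    where
    finish : (∃ λ ms → _ × (∀ {c d} → Untouched zero b b≢0 c d → ∀ t → run ms c d t ≡ t)) → _
    finish (ms , solved , same) = ms , solved ,
      λ d d≢b → same ((λ (_ , e) → d≢b (sym e)) , (λ (_ , e , _) → b≢0 e))

  -- Since `b ≢ zero`, `U_b` meets `(0 , b)` only in the four places with third axis U, a single
  -- four-cycle.
  flip-edge : ∀ {ρ : Place → Place} b → b ≢ zero → InjectiveP ρ → sign₂₄ ρ ≡ Sign.- →
    Even (turnAct {h} (U , b) zero b ∘ ρ)
  flip-edge {ρ} b b≢0 inj odd = (λ e → inj (τ-inj e)) , (begin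
    sign₂₄ (τ ∘ ρ)                  ≡⟨ sign₂₄-∘ ρ τ inj τ-inj ⟩
    sign₂₄ ρ * sign₂₄ τ             ≡⟨ cong₂ _*_ odd (sign₂₄-step U (b =L zero) (b =L zero) (b =L b)) ⟩
    Sign.- * (negIf (b =L zero) * (negIf (b =L zero) * negIf (b =L b)))
      ≡⟨ cong₂ (λ i j → Sign.- * (negIf i * (negIf i * negIf j))) (=L-false b≢0) (=L-true b) ⟩
    Sign.+                          ∎)
    where
    open ≡-Reasoning
    τ = turnAct {h} (U , b) zero b
    τ-inj : InjectiveP τ
    τ-inj = step-injective U (b =L zero) (b =L zero) (b =L b)

  solve-edge : ∀ {π : State {h}} b → b ≢ zero → Admissible π → EdgeSolution π b
  solve-edge {π} b b≢0 adm = go (sign₂₄ (π zero b)) refl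
    where
    m : Turn {h}
    m = U , b
    idle : ∀ d → d ≢ b → ∀ t → turnAct m zero d t ≡ t
    idle d d≢b t = cong₂ (λ i j → step U i i j t) (=L-false b≢0) (=L-false (≢-sym d≢b))
    prepend : EdgeSolution ((m ∷ []) ▷ π) b → EdgeSolution π b
    prepend (ms , solved , same) = m ∷ ms , solved ,
      λ d d≢b t → trans (cong (run ms zero d) (idle d d≢b t)) (same d d≢b t)
    go : ∀ s → sign₂₄ (π zero b) ≡ s → EdgeSolution π b
    go Sign.+ eq = solve-even-edge {π} b b≢0 (injective adm zero b , eq)
    go Sign.- eq = prepend (solve-even-edge {(m ∷ []) ▷ π} b b≢0 (flip-edge b b≢0 (injective adm zero b) eq))

  -- The alternative `Solved (π zero d)` strengthens the induction: it carries along what is solved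
  -- already, the corners included.
  solve-edges : ∀ bs {π : State {h}} → Admissible π → Solved (π zero zero) →
    ∃ λ ms → ∀ d → d ∈ bs ⊎ Solved (π zero d) → Solved ((ms ▷ π) zero d)
  solve-edges [] adm corners = [] , λ where d (inj₂ s) → s
  solve-edges (b ∷ bs) {π} adm corners = go (b Fin.≟ zero)
    where
    Goal : Set
    Goal = ∃ λ ms → ∀ d → d ∈ b ∷ bs ⊎ Solved (π zero d) → Solved ((ms ▷ π) zero d)
    skip : Solved (π zero b) → (∃ λ ms → ∀ d → d ∈ bs ⊎ Solved (π zero d) → Solved ((ms ▷ π) zero d)) → Goal
    skip s (ms , ok) = ms , λ where
      d (inj₁ (here refl)) → ok d (inj₂ s)
      d (inj₁ (there d∈))  → ok d (inj₁ d∈)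
      d (inj₂ s′)          → ok d (inj₂ s′)
    finish : EdgeSolution π b → Goal
    finish (ms₁ , solved , same) = combine (solve-edges bs (▷-admissible ms₁ adm) (still zero corners))
      where
      still : ∀ d → Solved (π zero d) → Solved ((ms₁ ▷ π) zero d)
      still d s with d Fin.≟ b
      ... | yes refl = solved
      ... | no d≢b   = λ t → trans (same d d≢b (π zero d t)) (s t)
      combine : (∃ λ ms → ∀ d → d ∈ bs ⊎ Solved ((ms₁ ▷ π) zero d) → Solved ((ms ▷ (ms₁ ▷ π)) zero d)) → Goal
      combine (ms₂ , ok) = ms₁ ++ ms₂ , λ d cases t →
        trans (run-++ ms₁ ms₂ zero d (π zero d t)) (ok d (after d cases) t)
        where
        after : ∀ d → d ∈ b ∷ bs ⊎ Solved (π zero d) → d ∈ bs ⊎ Solved ((ms₁ ▷ π) zero d)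
        after d (inj₁ (here refl)) = inj₂ solved
        after d (inj₁ (there d∈))  = inj₁ d∈
        after d (inj₂ s)           = inj₂ (still d s)
    go : Dec (b ≡ zero) → Goal
    go (yes refl) = skip corners (solve-edges bs adm corners)
    go (no b≢0)   = finish (solve-edge b b≢0 adm)

  -- The right-handed stickers follow the left-handed ones by `coupled`.
  border-solved : ∀ {π : State {h}} → Admissible π → (∀ d → Solved (π zero d)) →
    ∀ a b → a ≡ zero ⊎ b ≡ zero → Solved (π a b)
  border-solved adm edges a b (inj₁ refl) = edges b
  border-solved {π} adm edges a b (inj₂ refl) t = begin
    π a zero t                      ≡⟨ cong (π a zero) (spin³ t) ⟨
    π a zero (spin (spin (spin t))) ≡⟨ coupled adm a (spin (spin t)) ⟩
    spin (π zero a (spin (spin t))) ≡⟨ cong spin (edges a (spin (spin t))) ⟩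
    spin (spin (spin t))            ≡⟨ spin³ t ⟩
    t                               ∎
    where open ≡-Reasoning

  solve-centers : ∀ abs {π : State {h}} → Admissible π → (∀ d → Solved (π zero d)) →
    ∃ λ ms → ∀ a b → (a , b) ∈ abs ⊎ Solved (π a b) → Solved ((ms ▷ π) a b)
  solve-centers [] adm edges = [] , λ where a b (inj₂ s) → s
  solve-centers ((a , b) ∷ abs) {π} adm edges = go (a Fin.≟ zero) (b Fin.≟ zero)
    where
    Goal : Set
    Goal = ∃ λ ms → ∀ c d → (c , d) ∈ (a , b) ∷ abs ⊎ Solved (π c d) → Solved ((ms ▷ π) c d)
    skip : Solved (π a b) → (∃ λ ms → ∀ c d → (c , d) ∈ abs ⊎ Solved (π c d) → Solved ((ms ▷ π) c d)) → Goal
    skip s (ms , ok) = ms , λ where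
          c d (inj₁ (here refl)) → ok c d (inj₂ s)
          c d (inj₁ (there cd∈)) → ok c d (inj₁ cd∈)
          c d (inj₂ s′)          → ok c d (inj₂ s′)
    go : Dec (a ≡ zero) → Dec (b ≡ zero) → Goal
    go (yes a≡0) _         = skip (border-solved adm edges a b (inj₁ a≡0)) (solve-centers abs adm edges)
    go (no _)    (yes b≡0) = skip (border-solved adm edges a b (inj₂ b≡0)) (solve-centers abs adm edges)
    go (no a≢0)  (no b≢0)  = finish (solve-orbit a b b≢0 (injective adm a b , even))
      where
      even : sign₂₄ (π a b) ≡ Sign.+
      even = trans (signs adm a b a≢0 b≢0) (cong₂ _*_ (cong₂ _*_
        (trans (sign₈-cong (edges zero)) refl) (sign₂₄-solved (edges a))) (sign₂₄-solved (edges b)))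
      finish : (∃ λ ms → (∀ t → run ms a b (π a b t) ≡ t) × (∀ {c d} → Untouched a b b≢0 c d → ∀ t → run ms c d t ≡ t)) → Goal
      finish (ms₁ , solved , same) = combine (solve-centers abs (▷-admissible ms₁ adm) (λ d → still zero d (edges d)))
        where
        still : ∀ c d → Solved (π c d) → Solved ((ms₁ ▷ π) c d)
        still c d s with c Fin.≟ a | d Fin.≟ b
        ... | yes refl | yes refl = solved
        -- The second family of `touched` exists only for `a ≡ zero`, so only `(a , b)` itself can
        -- move.
        ... | no c≢a   | _        = λ t → trans (same ((λ (e , _) → c≢a (sym e)) , (λ (e , _) → a≢0 e)) (π c d t)) (s t)
        ... | _        | no d≢b   = λ t → trans (same ((λ (_ , e) → d≢b (sym e)) , (λ (e , _) → a≢0 e)) (π c d t)) (s t)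
        combine : (∃ λ ms → ∀ c d → (c , d) ∈ abs ⊎ Solved ((ms₁ ▷ π) c d) → Solved ((ms ▷ (ms₁ ▷ π)) c d)) → Goal
        combine (ms₂ , ok) = ms₁ ++ ms₂ , λ c d cases t →
          trans (run-++ ms₁ ms₂ c d (π c d t)) (ok c d (after c d cases) t)
          where
          after : ∀ c d → (c , d) ∈ (a , b) ∷ abs ⊎ Solved (π c d) → (c , d) ∈ abs ⊎ Solved ((ms₁ ▷ π) c d)
          after c d (inj₁ (here refl)) = inj₂ solved
          after c d (inj₁ (there cd∈)) = inj₁ cd∈
          after c d (inj₂ s)           = inj₂ (still c d s)

  solve : ∀ {π : State {h}} → Admissible π → ∃ λ ms → ∀ a b → Solved ((ms ▷ π) a b)
  solve {π} adm = ms₁ ++ (ms₂ ++ ms₃) , λ a b t →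
      trans (run-++ ms₁ _ a b (π a b t)) (trans (run-++ ms₂ ms₃ a b _)
        (proj₂ centers a b (inj₁ (∈-cartesianProduct⁺ (∈-allFin a) (∈-allFin b))) t))
    where
    corners = solve-corners adm
    ms₁ = proj₁ corners
    adm₁ = ▷-admissible ms₁ adm
    edges = solve-edges (allFin (suc h)) adm₁ (proj₂ corners)
    ms₂ = proj₁ edges
    centers = solve-centers (cartesianProduct (allFin (suc h)) (allFin (suc h))) (▷-admissible ms₂ adm₁)
      (λ d → proj₂ edges d (inj₁ (∈-allFin d)))
    ms₃ = proj₁ centers

-- Linearity of the quarter turns of space

v3-cong : ∀ {a a′ b b′ c c′} → a ≡ a′ → b ≡ b′ → c ≡ c′ → v3 a b c ≡ v3 a′ b′ c′
v3-cong refl refl refl = refl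

dot-⊕ : ∀ p q w → dot (p ⊕ q) w ≡ dot p w +ᶻ dot q w
dot-⊕ (v3 a b c) (v3 d e f) (v3 k l m) = lemma a b c d e f k l m
  where
  lemma : ∀ a b c d e f k l m → (a +ᶻ d) *ᶻ k +ᶻ (b +ᶻ e) *ᶻ l +ᶻ (c +ᶻ f) *ᶻ m ≡
    (a *ᶻ k +ᶻ b *ᶻ l +ᶻ c *ᶻ m) +ᶻ (d *ᶻ k +ᶻ e *ᶻ l +ᶻ f *ᶻ m)
  lemma = solve-∀

dot-scale : ∀ s p w → dot (scale s p) w ≡ s *ᶻ dot p w
dot-scale s (v3 a b c) (v3 k l m) = lemma s a b c k l m
  where
  lemma : ∀ s a b c k l m → s *ᶻ a *ᶻ k +ᶻ s *ᶻ b *ᶻ l +ᶻ s *ᶻ c *ᶻ m ≡ s *ᶻ (a *ᶻ k +ᶻ b *ᶻ l +ᶻ c *ᶻ m)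
  lemma = solve-∀

-- The three coordinates are instances of one ring identity: `u` is a coordinate of the axis, and
-- the pairs hold the entries of the matching coordinate of the cross product.
rotCW-⊕ : ∀ w p q → rotCW w (p ⊕ q) ≡ rotCW w p ⊕ rotCW w q
rotCW-⊕ (v3 a b c) (v3 d e f) (v3 k l m) = v3-cong
  (lemma a b c d e f k l m a (b , c) (f , e) (m , l))
  (lemma a b c d e f k l m b (c , a) (d , f) (k , m))
  (lemma a b c d e f k l m c (a , b) (e , d) (l , k))
  where
  identity : ∀ a b c d e f k l m u v w x₁ y₁ x₂ y₂ →
    (a *ᶻ (d +ᶻ k) +ᶻ b *ᶻ (e +ᶻ l) +ᶻ c *ᶻ (f +ᶻ m)) *ᶻ u +ᶻ -1ℤ *ᶻ (v *ᶻ (x₁ +ᶻ x₂) -ᶻ w *ᶻ (y₁ +ᶻ y₂)) ≡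
    ((a *ᶻ d +ᶻ b *ᶻ e +ᶻ c *ᶻ f) *ᶻ u +ᶻ -1ℤ *ᶻ (v *ᶻ x₁ -ᶻ w *ᶻ y₁)) +ᶻ ((a *ᶻ k +ᶻ b *ᶻ l +ᶻ c *ᶻ m) *ᶻ u +ᶻ -1ℤ *ᶻ (v *ᶻ x₂ -ᶻ w *ᶻ y₂))
  identity = solve-∀
  lemma : ∀ a b c d e f k l m u (vw xy₁ xy₂ : ℤ × ℤ) → _
  lemma a b c d e f k l m u (v , w) (x₁ , y₁) (x₂ , y₂) = identity a b c d e f k l m u v w x₁ y₁ x₂ y₂

rotCW-scale : ∀ w s p → rotCW w (scale s p) ≡ scale s (rotCW w p)
rotCW-scale (v3 a b c) s (v3 d e f) = v3-cong
  (identity s a b c d e f a b c f e) (identity s a b c d e f b c a d f) (identity s a b c d e f c a b e d)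
  where
  identity : ∀ s a b c d e f u v w p q →
    (a *ᶻ (s *ᶻ d) +ᶻ b *ᶻ (s *ᶻ e) +ᶻ c *ᶻ (s *ᶻ f)) *ᶻ u +ᶻ -1ℤ *ᶻ (v *ᶻ (s *ᶻ p) -ᶻ w *ᶻ (s *ᶻ q)) ≡
    s *ᶻ ((a *ᶻ d +ᶻ b *ᶻ e +ᶻ c *ᶻ f) *ᶻ u +ᶻ -1ℤ *ᶻ (v *ᶻ p -ᶻ w *ᶻ q))
  identity = solve-∀

combine : (i j k : ℤ) (n u v : V3) → V3
combine i j k n u v = (scale i n ⊕ scale j u) ⊕ scale k v

dot-combine : ∀ i j k n u v w → dot (combine i j k n u v) w ≡ (i *ᶻ dot n w +ᶻ j *ᶻ dot u w) +ᶻ k *ᶻ dot v w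
dot-combine i j k n u v w = trans (dot-⊕ (scale i n ⊕ scale j u) (scale k v) w)
  (cong₂ _+ᶻ_ (trans (dot-⊕ (scale i n) (scale j u) w) (cong₂ _+ᶻ_ (dot-scale i n w) (dot-scale j u w)))
             (dot-scale k v w))

rotCW-combine : ∀ w i j k n u v →
  rotCW w (combine i j k n u v) ≡ combine i j k (rotCW w n) (rotCW w u) (rotCW w v)
rotCW-combine w i j k n u v = trans (rotCW-⊕ w (scale i n ⊕ scale j u) (scale k v))
  (cong₂ _⊕_ (trans (rotCW-⊕ w (scale i n) (scale j u)) (cong₂ _⊕_ (rotCW-scale w i n) (rotCW-scale w j u)))
             (rotCW-scale w k v))

combine-cycle : ∀ i j k n u v → combine i j k n u v ≡ combine j k i u v n
combine-cycle i j k (v3 a b c) (v3 d e f) (v3 o p q) = v3-cong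
  (identity (i *ᶻ a) (j *ᶻ d) (k *ᶻ o)) (identity (i *ᶻ b) (j *ᶻ e) (k *ᶻ p)) (identity (i *ᶻ c) (j *ᶻ f) (k *ᶻ q))
  where
  identity : ∀ r s t → (r +ᶻ s) +ᶻ t ≡ (s +ᶻ t) +ᶻ r
  identity = solve-∀

scale-neg : ∀ k v → scale k (scale -1ℤ v) ≡ scale (ℤ.- k) v
scale-neg k (v3 a b c) = v3-cong (identity k a) (identity k b) (identity k c)
  where
  identity : ∀ k a → k *ᶻ (-1ℤ *ᶻ a) ≡ ℤ.- k *ᶻ a
  identity = solve-∀

place-combine : ∀ i s t n r u → (scale i n ⊕ scale s r) ⊖ scale t u ≡ combine i s (ℤ.- t) n r u
place-combine i s t n r (v3 a b c) = cong ((scale i n ⊕ scale s r) ⊕_) (v3-cong (identity t a) (identity t b) (identity t c))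
  where
  identity : ∀ t a → -1ℤ *ᶻ (t *ᶻ a) ≡ ℤ.- t *ᶻ a
  identity = solve-∀

combine-swap : ∀ i j k n u v → combine i j k n u v ≡ combine i k j n v u
combine-swap i j k (v3 a b c) (v3 d e f) (v3 o p q) = v3-cong
  (identity (i *ᶻ a) (j *ᶻ d) (k *ᶻ o)) (identity (i *ᶻ b) (j *ᶻ e) (k *ᶻ p)) (identity (i *ᶻ c) (j *ᶻ f) (k *ᶻ q))
  where
  identity : ∀ r s t → (r +ᶻ s) +ᶻ t ≡ (r +ᶻ t) +ᶻ s
  identity = solve-∀

=ᵇ-sound : ∀ {a b} → (a =ᵇ b) ≡ true → a ≡ b
=ᵇ-sound eq = ℤₚ.≤-antisym (ℤₚ.≤ᵇ⇒≤ (Equivalence.from T-≡ (∧⇒ˡ eq))) (ℤₚ.≤ᵇ⇒≤ (Equivalence.from T-≡ (∧⇒ʳ eq)))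

=ᵇ-refl : ∀ a → (a =ᵇ a) ≡ true
=ᵇ-refl a rewrite Equivalence.to T-≡ (ℤₚ.≤⇒≤ᵇ (ℤₚ.≤-refl {a})) = refl

=ᵇ-false : ∀ {a b} → a ≢ b → (a =ᵇ b) ≡ false
=ᵇ-false {a} {b} a≢b with a =ᵇ b in eq
... | true  = contradiction (=ᵇ-sound eq) a≢b
... | false = refl

<ᵇ-true : ∀ {m n} → m < n → (m <ᵇ n) ≡ true
<ᵇ-true m<n = Equivalence.to T-≡ (ℕₚ.<⇒<ᵇ m<n)

<ᵇ-false : ∀ {m n} → n ≤ m → (m <ᵇ n) ≡ false
<ᵇ-false {m} {n} n≤m with m <ᵇ n in eq
... | true  = contradiction (ℕₚ.<ᵇ⇒< m n (Equivalence.from T-≡ eq)) (ℕₚ.≤⇒≯ n≤m)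
... | false = refl

≡ᵇ-false : ∀ {m n} → m ≢ n → (m ≡ᵇ n) ≡ false
≡ᵇ-false {m} {n} m≢n with m ≡ᵇ n in eq
... | true  = contradiction (≡ᵇ-sound m n eq) m≢n
... | false = refl

_=V_ : V3 → V3 → Bool
v3 a b c =V v3 d e f = (a =ᵇ d) ∧ ((b =ᵇ e) ∧ (c =ᵇ f))

=V-sound : ∀ {p q} → (p =V q) ≡ true → p ≡ q
=V-sound {v3 a b c} {v3 d e f} eq =
  v3-cong (=ᵇ-sound (∧⇒ˡ eq)) (=ᵇ-sound (∧⇒ˡ (∧⇒ʳ {a =ᵇ d} eq))) (=ᵇ-sound (∧⇒ʳ {b =ᵇ e} (∧⇒ʳ {a =ᵇ d} eq)))

-- Frames of face normals and their angles with the faces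

n₁ n₂ n₃ : Place → V3
n₁ t = normal (axis₁ t)
n₂ t = normal (axis₂ t)
n₃ t = normal (axis₃ t)

rotCW-n₁ : ∀ X t → rotCW (normal X) (n₁ t) ≡ n₁ (rotate X t)
rotCW-n₁ X t = =V-sound (exhaust (λ (X , t) → rotCW (normal X) (n₁ t) =V n₁ (rotate X t)) refl (X , t))

rotCW-n₂ : ∀ X t → rotCW (normal X) (n₂ t) ≡ n₂ (rotate X t)
rotCW-n₂ X t = =V-sound (exhaust (λ (X , t) → rotCW (normal X) (n₂ t) =V n₂ (rotate X t)) refl (X , t))

rotCW-n₃ : ∀ X t → rotCW (normal X) (n₃ t) ≡ n₃ (rotate X t)
rotCW-n₃ X t = =V-sound (exhaust (λ (X , t) → rotCW (normal X) (n₃ t) =V n₃ (rotate X t)) refl (X , t))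

spin-axis₁ : ∀ t → axis₁ (spin t) ≡ axis₂ t
spin-axis₁ t = =F-sound (exhaust (λ t → axis₁ (spin t) =F axis₂ t) refl t)

spin-axis₂ : ∀ t → axis₂ (spin t) ≡ axis₃ t
spin-axis₂ t = =F-sound (exhaust (λ t → axis₂ (spin t) =F axis₃ t) refl t)

spin-axis₃ : ∀ t → axis₃ (spin t) ≡ axis₁ t
spin-axis₃ t = =F-sound (exhaust (λ t → axis₃ (spin t) =F axis₁ t) refl t)

side-q0 : ∀ X → normal (side X q0) ≡ up X
side-q0 X = =V-sound (exhaust (λ X → normal (side X q0) =V up X) refl X)

side-q1 : ∀ X → normal (side X q1) ≡ right X
side-q1 X = =V-sound (exhaust (λ X → normal (side X q1) =V right X) refl X)

side-q2 : ∀ X → normal (side X q2) ≡ scale -1ℤ (up X)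
side-q2 X = =V-sound (exhaust (λ X → normal (side X q2) =V scale -1ℤ (up X)) refl X)

side-q3 : ∀ X → normal (side X q3) ≡ scale -1ℤ (right X)
side-q3 X = =V-sound (exhaust (λ X → normal (side X q3) =V scale -1ℤ (right X)) refl X)

data Angle : Set where
  same anti perp : Angle

angle : Face → Face → Angle
angle X Y = if X =F Y then same else (if dot (normal X) (normal Y) =ᵇ -1ℤ then anti else perp)

cosine : Angle → ℤ
cosine same = 1ℤ
cosine anti = -1ℤ
cosine perp = 0ℤ

isSame : Angle → Bool
isSame same = true
isSame _    = false

dot-cosine : ∀ X Y → dot (normal X) (normal Y) ≡ cosine (angle X Y)
dot-cosine X Y = =ᵇ-sound (exhaust (λ (X , Y) → dot (normal X) (normal Y) =ᵇ cosine (angle X Y)) refl (X , Y))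

isSame-angle : ∀ X Y → isSame (angle X Y) ≡ (X =F Y)
isSame-angle X Y with X =F Y
... | true  = refl
... | false with dot (normal X) (normal Y) =ᵇ -1ℤ
...   | true  = refl
...   | false = refl

-- A frame has one axis in each coordinate direction, so every face is equal or opposite to one of
-- its axes and perpendicular to the other two.
oneAxis : Angle → Angle → Angle → Bool
oneAxis same perp perp = true
oneAxis anti perp perp = true
oneAxis perp same perp = true
oneAxis perp anti perp = true
oneAxis perp perp same = true
oneAxis perp perp anti = true
oneAxis _    _    _    = false

x∙1+y∙0+z∙0 : ∀ p q r → (p *ᶻ 1ℤ +ᶻ q *ᶻ 0ℤ) +ᶻ r *ᶻ 0ℤ ≡ p
x∙1+y∙0+z∙0 = solve-∀

x∙0+y∙1+z∙0 : ∀ p q r → (p *ᶻ 0ℤ +ᶻ q *ᶻ 1ℤ) +ᶻ r *ᶻ 0ℤ ≡ q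
x∙0+y∙1+z∙0 = solve-∀

x∙0+y∙0+z∙1 : ∀ p q r → (p *ᶻ 0ℤ +ᶻ q *ᶻ 0ℤ) +ᶻ r *ᶻ 1ℤ ≡ r
x∙0+y∙0+z∙1 = solve-∀

x∙-1+y∙0+z∙0 : ∀ p q r → (p *ᶻ -1ℤ +ᶻ q *ᶻ 0ℤ) +ᶻ r *ᶻ 0ℤ ≡ ℤ.- p
x∙-1+y∙0+z∙0 = solve-∀

x∙0+y∙-1+z∙0 : ∀ p q r → (p *ᶻ 0ℤ +ᶻ q *ᶻ -1ℤ) +ᶻ r *ᶻ 0ℤ ≡ ℤ.- q
x∙0+y∙-1+z∙0 = solve-∀

x∙0+y∙0+z∙-1 : ∀ p q r → (p *ᶻ 0ℤ +ᶻ q *ᶻ 0ℤ) +ᶻ r *ᶻ -1ℤ ≡ ℤ.- r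
x∙0+y∙0+z∙-1 = solve-∀

select₁ : ∀ p q r → (p ∧ true) ∨ ((q ∧ false) ∨ (r ∧ false)) ≡ p
select₁ p q r rewrite ∧-identityʳ p | ∧-zeroʳ q | ∧-zeroʳ r = ∨-identityʳ p

select₂ : ∀ p q r → (p ∧ false) ∨ ((q ∧ true) ∨ (r ∧ false)) ≡ q
select₂ p q r rewrite ∧-zeroʳ p | ∧-identityʳ q | ∧-zeroʳ r = ∨-identityʳ q

select₃ : ∀ p q r → (p ∧ false) ∨ ((q ∧ false) ∨ (r ∧ true)) ≡ r
select₃ p q r rewrite ∧-zeroʳ p | ∧-zeroʳ q = ∧-identityʳ r

select₀ : ∀ p q r → (p ∧ false) ∨ ((q ∧ false) ∨ (r ∧ false)) ≡ false
select₀ p q r rewrite ∧-zeroʳ p | ∧-zeroʳ q = ∧-zeroʳ r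

+[m+n]-m : ∀ m n → + (m ℕ.+ n) ℤ.- + m ≡ + n
+[m+n]-m m n = trans (cong (ℤ._- + m) (ℤₚ.pos-+ m n)) (lemma (+ m) (+ n))
  where
  lemma : ∀ x y → (x +ᶻ y) -ᶻ x ≡ y
  lemma = solve-∀

-- Facelets as triples of a place and two layers

module _ {h : ℕ} where

  -- The form in which the witness of `2 ∣ n` presents `n`; there are `suc h` layers from the
  -- surface to the middle.
  size : ℕ
  size = suc h ℕ.* 2

  gap : Layer {h} → ℕ
  gap a = suc (2 ℕ.* (h ∸ toℕ a))

  layer≤h : (a : Layer {h}) → toℕ a ≤ h
  layer≤h a = Finₚ.toℕ≤pred[n] a

  -- gap a is the coordinate of layer a, so that the coordinate size - 1 of a face exceeds it by 2 a.
  span : ∀ a → suc (h ℕ.* 2) ≡ toℕ a ℕ.+ (toℕ a ℕ.+ gap a)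
  span a = trans (cong (λ m → suc (m ℕ.* 2)) (sym (ℕₚ.m+[n∸m]≡n (layer≤h a)))) (lemma (toℕ a) (h ∸ toℕ a))
    where
    lemma : ∀ m e → suc ((m ℕ.+ e) ℕ.* 2) ≡ m ℕ.+ (m ℕ.+ suc (2 ℕ.* e))
    lemma = ℕ-Solver.solve-∀

  span₂ : ∀ a → suc (h ℕ.* 2) ≡ 2 ℕ.* toℕ a ℕ.+ gap a
  span₂ a = trans (span a) (lemma (toℕ a) (gap a))
    where
    lemma : ∀ m e → m ℕ.+ (m ℕ.+ e) ≡ 2 ℕ.* m ℕ.+ e
    lemma = ℕ-Solver.solve-∀

  half-gap : half size ≡ + gap zero
  half-gap = cong +_ (span zero)

  threshold : ∀ a → half size ℤ.- + (2 ℕ.* toℕ a) ≡ + gap a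
  threshold a = trans (cong (λ m → + m ℤ.- + (2 ℕ.* toℕ a)) (span₂ a)) (+[m+n]-m (2 ℕ.* toℕ a) (gap a))

  gap-injective : ∀ {a b} → gap a ≡ gap b → a ≡ b
  gap-injective {a} {b} eq = Finₚ.toℕ-injective (ℕₚ.∸-cancelˡ-≡ (layer≤h a) (layer≤h b)
    (ℕₚ.*-cancelˡ-≡ _ _ 2 (ℕₚ.suc-injective eq)))

  lo hi : Layer {h} → Fin size
  lo a = Fin.inject≤ a (ℕₚ.m≤m*n (suc h) 2)
  hi a = Fin.opposite (lo a)

  toℕ-lo : ∀ a → toℕ (lo a) ≡ toℕ a
  toℕ-lo a = Finₚ.toℕ-inject≤ a _

  toℕ-hi : ∀ a → toℕ (hi a) ≡ toℕ a ℕ.+ gap a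
  toℕ-hi a = trans (Finₚ.opposite-prop (lo a)) (trans (cong (suc (h ℕ.* 2) ∸_) (toℕ-lo a))
    (trans (cong (_∸ toℕ a) (span a)) (ℕₚ.m+n∸m≡n (toℕ a) _)))

  h<toℕ-hi : ∀ a → suc h ≤ toℕ a ℕ.+ gap a
  h<toℕ-hi a = subst (suc h ≤_) (sym (trans (lemma (toℕ a) (h ∸ toℕ a))
    (cong (λ m → suc (m ℕ.+ (h ∸ toℕ a))) (ℕₚ.m+[n∸m]≡n (layer≤h a))))) (s≤s (ℕₚ.m≤m+n h _))
    where
    lemma : ∀ m e → m ℕ.+ suc (2 ℕ.* e) ≡ suc (m ℕ.+ e ℕ.+ e)
    lemma = ℕ-Solver.solve-∀

  off-lo : ∀ a → off (lo a) ≡ ℤ.- + gap a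
  off-lo a = trans (cong₂ (λ m k → + (2 ℕ.* m) ℤ.- + k) (toℕ-lo a) (span₂ a))
    (trans (cong (λ m → + (2 ℕ.* toℕ a) ℤ.- m) (ℤₚ.pos-+ (2 ℕ.* toℕ a) (gap a))) (lemma (+ (2 ℕ.* toℕ a)) (+ gap a)))
    where
    lemma : ∀ x y → x -ᶻ (x +ᶻ y) ≡ ℤ.- y
    lemma = solve-∀

  off-hi : ∀ a → off (hi a) ≡ + gap a
  off-hi a = trans (cong₂ (λ m k → + (2 ℕ.* m) ℤ.- + k) (toℕ-hi a) (span₂ a))
    (trans (cong (λ m → + m ℤ.- + (2 ℕ.* toℕ a ℕ.+ gap a)) (lemma (toℕ a) (gap a)))
           (+[m+n]-m (2 ℕ.* toℕ a ℕ.+ gap a) (gap a)))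
    where
    lemma : ∀ m e → 2 ℕ.* (m ℕ.+ e) ≡ (2 ℕ.* m ℕ.+ e) ℕ.+ e
    lemma = ℕ-Solver.solve-∀

  layer-lo : ∀ a → layer (lo a) ≡ toℕ a
  layer-lo a = trans (cong (λ m → m ⊓ (suc (h ℕ.* 2) ∸ m)) (toℕ-lo a))
    (ℕₚ.m≤n⇒m⊓n≡m (subst (toℕ a ≤_) (sym (trans (cong (_∸ toℕ a) (span a)) (ℕₚ.m+n∸m≡n (toℕ a) _))) (ℕₚ.m≤m+n (toℕ a) (gap a))))

  layer-hi : ∀ a → layer (hi a) ≡ toℕ a
  layer-hi a = trans (cong (λ m → m ⊓ (suc (h ℕ.* 2) ∸ m)) (toℕ-hi a))
    (trans (cong ((toℕ a ℕ.+ gap a) ⊓_) (trans (cong (_∸ (toℕ a ℕ.+ gap a)) (span a)) (ℕₚ.m+n∸n≡m (toℕ a) (toℕ a ℕ.+ gap a))))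
           (ℕₚ.m≥n⇒m⊓n≡n (ℕₚ.m≤m+n (toℕ a) (gap a))))

  half-size : size / 2 ≡ suc h
  half-size = m*n/n≡m (suc h) 2

  lo-low : ∀ a → (toℕ (lo a) <ᵇ size / 2) ≡ true
  lo-low a = <ᵇ-true (subst (_< size / 2) (sym (toℕ-lo a)) (subst (toℕ a <_) (sym half-size) (Finₚ.toℕ<n a)))

  hi-high : ∀ a → (toℕ (hi a) <ᵇ size / 2) ≡ false
  hi-high a = <ᵇ-false (subst (_≤ toℕ (hi a)) (sym half-size) (subst (suc h ≤_) (sym (toℕ-hi a)) (h<toℕ-hi a)))

  view : ∀ r → ∃ λ a → r ≡ lo a ⊎ r ≡ hi a
  view r with toℕ r ℕ.<? suc h
  ... | yes r<  = Fin.fromℕ< r< , inj₁ (Finₚ.toℕ-injective (trans (sym (Finₚ.toℕ-fromℕ< r<)) (sym (toℕ-lo _))))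
  ... | no r≮ = Fin.fromℕ< o< , inj₂ (trans (sym (Finₚ.opposite-involutive r))
      (cong Fin.opposite (Finₚ.toℕ-injective (trans (sym (Finₚ.toℕ-fromℕ< o<)) (sym (toℕ-lo _))))))
    where
    o< : toℕ (Fin.opposite r) < suc h
    o< = subst (_< suc h) (sym (Finₚ.opposite-prop r)) (s≤s (ℕₚ.≤-trans (ℕₚ.∸-monoʳ-≤ (suc (h ℕ.* 2)) (ℕₚ.≮⇒≥ r≮))
      (ℕₚ.≤-reflexive (trans (cong (_∸ h) (ℕₚ.*-comm h 2)) (trans (ℕₚ.m+n∸m≡n h (h ℕ.+ 0)) (ℕₚ.+-identityʳ h))))))

  -- `a` is the depth counted from the side `axis₂`, `b` that from `axis₃`. With `i = a + 1` and
  -- `j = b + 1` the quarters `q0` to `q3` give the positions (i,j), (j,n+1-i), (n+1-i,n+1-j),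
  -- (n+1-j,i) of a center edge orbit.
  facelet : Place → Layer {h} → Layer {h} → Facelet size
  facelet (X , q0) a b = X , lo a , lo b
  facelet (X , q1) a b = X , lo b , hi a
  facelet (X , q2) a b = X , hi a , hi b
  facelet (X , q3) a b = X , hi b , lo a

  facelet-view : ∀ f → ∃ λ t → ∃ λ a → ∃ λ b → f ≡ facelet t a b
  facelet-view (X , r , c) with view r | view c
  ... | a , inj₁ refl | b , inj₁ refl = (X , q0) , a , b , refl
  ... | b , inj₁ refl | a , inj₂ refl = (X , q1) , a , b , refl
  ... | a , inj₂ refl | b , inj₂ refl = (X , q2) , a , b , refl
  ... | b , inj₂ refl | a , inj₁ refl = (X , q3) , a , b , refl

  lo≢hi : ∀ a b → lo a ≢ hi b
  lo≢hi a b eq with trans (sym (lo-low a)) (trans (cong (λ r → toℕ r <ᵇ size / 2) eq) (hi-high b))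
  ... | ()

  lo-injective : ∀ a b → lo a ≡ lo b → a ≡ b
  lo-injective a b eq = Finₚ.toℕ-injective (trans (sym (toℕ-lo a)) (trans (cong toℕ eq) (toℕ-lo b)))

  hi-injective : ∀ a b → hi a ≡ hi b → a ≡ b
  hi-injective a b eq = Finₚ.toℕ-injective (trans (sym (layer-hi a)) (trans (cong layer eq) (layer-hi b)))

  facelet-injective : ∀ {s a b t c d} → facelet s a b ≡ facelet t c d → s ≡ t × a ≡ c × b ≡ d
  facelet-injective {X , q} {a} {b} {Y , r} {c} {d} eq = go q r eq
    where
    rows : ∀ {f f′ : Facelet size} → f ≡ f′ → proj₁ (proj₂ f) ≡ proj₁ (proj₂ f′)
    rows = cong (proj₁ ∘ proj₂)
    cols : ∀ {f f′ : Facelet size} → f ≡ f′ → proj₂ (proj₂ f) ≡ proj₂ (proj₂ f′)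
    cols = cong (proj₂ ∘ proj₂)
    go : ∀ q r → facelet (X , q) a b ≡ facelet (Y , r) c d → (X , q) ≡ (Y , r) × a ≡ c × b ≡ d
    go q0 q0 e = cong (_, q0) (cong proj₁ e) , lo-injective a c (rows e) , lo-injective b d (cols e)
    go q1 q1 e = cong (_, q1) (cong proj₁ e) , hi-injective a c (cols e) , lo-injective b d (rows e)
    go q2 q2 e = cong (_, q2) (cong proj₁ e) , hi-injective a c (rows e) , hi-injective b d (cols e)
    go q3 q3 e = cong (_, q3) (cong proj₁ e) , lo-injective a c (cols e) , hi-injective b d (rows e)
    go q0 q1 e = contradiction (cols e) (lo≢hi b c)
    go q0 q2 e = contradiction (rows e) (lo≢hi a c)
    go q0 q3 e = contradiction (rows e) (lo≢hi a d)
    go q1 q0 e = contradiction (sym (cols e)) (lo≢hi d a)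
    go q1 q2 e = contradiction (rows e) (lo≢hi b c)
    go q1 q3 e = contradiction (rows e) (lo≢hi b d)
    go q2 q0 e = contradiction (sym (rows e)) (lo≢hi c a)
    go q2 q1 e = contradiction (sym (rows e)) (lo≢hi d a)
    go q2 q3 e = contradiction (sym (cols e)) (lo≢hi c b)
    go q3 q0 e = contradiction (sym (rows e)) (lo≢hi c b)
    go q3 q1 e = contradiction (sym (rows e)) (lo≢hi d b)
    go q3 q2 e = contradiction (cols e) (lo≢hi a d)

  point : Place → Layer {h} → Layer {h} → V3
  point t a b = combine (+ gap zero) (+ gap a) (+ gap b) (n₁ t) (n₂ t) (n₃ t)

  nrm-facelet : ∀ t a b → nrm (facelet t a b) ≡ n₁ t
  nrm-facelet (X , q0) a b = refl
  nrm-facelet (X , q1) a b = refl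
  nrm-facelet (X , q2) a b = refl
  nrm-facelet (X , q3) a b = refl

  pos-facelet : ∀ t a b → pos (facelet t a b) ≡ point t a b
  pos-facelet t@(X , q) a b = go q
    where
    base : ∀ f → pos f ≡ combine (half size) (off (proj₂ (proj₂ f))) (ℤ.- off (proj₁ (proj₂ f))) (nrm f) (right (face f)) (up (face f))
    base (Y , r , c) = place-combine (half size) (off c) (off r) (normal Y) (right Y) (up Y)
    parts : ∀ {P P′ Q Q′} → P ≡ P′ → Q ≡ Q′ →
      (scale (half size) (normal X) ⊕ P) ⊕ Q ≡ (scale (+ gap zero) (normal X) ⊕ P′) ⊕ Q′
    parts eP eQ = cong₂ _⊕_ (cong₂ _⊕_ (cong (λ m → scale m (normal X)) half-gap) eP) eQ
    plus : ∀ {i v w} a → i ≡ + gap a → w ≡ v → scale i v ≡ scale (+ gap a) w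
    plus a refl refl = refl
    minus : ∀ {i v w} a → i ≡ ℤ.- + gap a → w ≡ scale -1ℤ v → scale i v ≡ scale (+ gap a) w
    minus {v = v} a refl refl = sym (scale-neg (+ gap a) v)
    neg-lo : ∀ a → ℤ.- off (lo a) ≡ + gap a
    neg-lo a = trans (cong ℤ.-_ (off-lo a)) (ℤₚ.neg-involutive (+ gap a))
    neg-hi : ∀ a → ℤ.- off (hi a) ≡ ℤ.- + gap a
    neg-hi a = cong ℤ.-_ (off-hi a)
    go : ∀ q → pos (facelet (X , q) a b) ≡ point (X , q) a b
    go q0 = trans (base (X , lo a , lo b)) (trans (combine-swap (half size) (off (lo b)) (ℤ.- off (lo a)) (normal X) (right X) (up X))
      (parts (plus a (neg-lo a) (side-q0 X)) (minus b (off-lo b) (side-q3 X))))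
    go q1 = trans (base (X , lo b , hi a)) (parts (plus a (off-hi a) (side-q1 X)) (plus b (neg-lo b) (side-q0 X)))
    go q2 = trans (base (X , hi a , hi b)) (trans (combine-swap (half size) (off (hi b)) (ℤ.- off (hi a)) (normal X) (right X) (up X))
      (parts (minus a (neg-hi a) (side-q2 X)) (plus b (off-hi b) (side-q1 X))))
    go q3 = trans (base (X , hi b , lo a)) (parts (minus a (off-lo a) (side-q3 X)) (minus b (neg-hi b) (side-q2 X)))

  -- The same three coordinates along the same three axes, read from the next one: two stickers of
  -- one edge cubie, or of one corner if `b ≡ zero`.
  pos-spin : ∀ t b → pos (facelet (spin t) b zero) ≡ pos (facelet t zero b)
  pos-spin t b = trans (pos-facelet (spin t) b zero) (trans
    (cong₃ (combine (+ gap zero) (+ gap b) (+ gap zero)) (cong normal (spin-axis₁ t)) (cong normal (spin-axis₂ t)) (cong normal (spin-axis₃ t)))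
    (trans (sym (combine-cycle (+ gap zero) (+ gap zero) (+ gap b) (n₁ t) (n₂ t) (n₃ t))) (sym (pos-facelet t zero b))))
    where
    cong₃ : ∀ (f : V3 → V3 → V3 → V3) {p p′ q q′ r r′} → p ≡ p′ → q ≡ q′ → r ≡ r′ → f p q r ≡ f p′ q′ r′
    cong₃ f refl refl refl = refl

  gap-=ᵇ : ∀ a k → ((+ gap a) =ᵇ (+ gap k)) ≡ (k =L a)
  gap-=ᵇ a k with k Fin.≟ a
  ... | yes refl = =ᵇ-refl (+ gap a)
  ... | no k≢a   = =ᵇ-false (λ eq → k≢a (sym (gap-injective (ℤₚ.+-injective eq))))

  depth-test : ∀ c₁ c₂ c₃ → oneAxis c₁ c₂ c₃ ≡ true → ∀ a b k →
    ((((+ gap zero) *ᶻ cosine c₁ +ᶻ (+ gap a) *ᶻ cosine c₂) +ᶻ (+ gap b) *ᶻ cosine c₃) =ᵇ (+ gap k))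
    ≡ ((k =L zero) ∧ isSame c₁) ∨ (((k =L a) ∧ isSame c₂) ∨ ((k =L b) ∧ isSame c₃))
  depth-test same perp perp _ a b k rewrite x∙1+y∙0+z∙0 (+ gap zero) (+ gap a) (+ gap b) | select₁ (k =L zero) (k =L a) (k =L b) = gap-=ᵇ zero k
  depth-test perp same perp _ a b k rewrite x∙0+y∙1+z∙0 (+ gap zero) (+ gap a) (+ gap b) | select₂ (k =L zero) (k =L a) (k =L b) = gap-=ᵇ a k
  depth-test perp perp same _ a b k rewrite x∙0+y∙0+z∙1 (+ gap zero) (+ gap a) (+ gap b) | select₃ (k =L zero) (k =L a) (k =L b) = gap-=ᵇ b k
  -- From here on `X` is opposite to an axis: the coordinate is negative, whereas `gap k` is
  -- positive because slices are counted only up to the middle.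
  depth-test anti perp perp _ a b k rewrite x∙-1+y∙0+z∙0 (+ gap zero) (+ gap a) (+ gap b) | select₀ (k =L zero) (k =L a) (k =L b) = refl
  depth-test perp anti perp _ a b k rewrite x∙0+y∙-1+z∙0 (+ gap zero) (+ gap a) (+ gap b) | select₀ (k =L zero) (k =L a) (k =L b) = refl
  depth-test perp perp anti _ a b k rewrite x∙0+y∙0+z∙-1 (+ gap zero) (+ gap a) (+ gap b) | select₀ (k =L zero) (k =L a) (k =L b) = refl

  slice-test : ∀ X k t a b →
    (dot (pos (facelet t a b)) (normal X) =ᵇ (+ gap k)) ≡ selects X (k =L zero) (k =L a) (k =L b) t
  slice-test X k t a b = begin
    (dot (pos (facelet t a b)) (normal X) =ᵇ (+ gap k))
      ≡⟨ cong (λ p → dot p (normal X) =ᵇ (+ gap k)) (pos-facelet t a b) ⟩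
    (dot (point t a b) (normal X) =ᵇ (+ gap k))
      ≡⟨ cong (_=ᵇ (+ gap k)) (dot-combine (+ gap zero) (+ gap a) (+ gap b) (n₁ t) (n₂ t) (n₃ t) (normal X)) ⟩
    ((((+ gap zero) *ᶻ dot (n₁ t) (normal X) +ᶻ (+ gap a) *ᶻ dot (n₂ t) (normal X)) +ᶻ (+ gap b) *ᶻ dot (n₃ t) (normal X)) =ᵇ (+ gap k))
      ≡⟨ cong₃ (λ d₁ d₂ d₃ → (((+ gap zero) *ᶻ d₁ +ᶻ (+ gap a) *ᶻ d₂) +ᶻ (+ gap b) *ᶻ d₃) =ᵇ (+ gap k))
           (dot-cosine (axis₁ t) X) (dot-cosine (axis₂ t) X) (dot-cosine (axis₃ t) X) ⟩
    ((((+ gap zero) *ᶻ cosine c₁ +ᶻ (+ gap a) *ᶻ cosine c₂) +ᶻ (+ gap b) *ᶻ cosine c₃) =ᵇ (+ gap k))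
      ≡⟨ depth-test c₁ c₂ c₃ (exhaust (λ (X , t) → oneAxis (angle (axis₁ t) X) (angle (axis₂ t) X) (angle (axis₃ t) X)) refl (X , t)) a b k ⟩
    ((k =L zero) ∧ isSame c₁) ∨ (((k =L a) ∧ isSame c₂) ∨ ((k =L b) ∧ isSame c₃))
      ≡⟨ cong₃ (λ i j l → ((k =L zero) ∧ i) ∨ (((k =L a) ∧ j) ∨ ((k =L b) ∧ l)))
           (isSame-angle (axis₁ t) X) (isSame-angle (axis₂ t) X) (isSame-angle (axis₃ t) X) ⟩
    selects X (k =L zero) (k =L a) (k =L b) t ∎
    where
    open ≡-Reasoning
    c₁ = angle (axis₁ t) X
    c₂ = angle (axis₂ t) X
    c₃ = angle (axis₃ t) X
    cong₃ : ∀ {A : Set} (f : A → A → A → Bool) {p p′ q q′ r r′} → p ≡ p′ → q ≡ q′ → r ≡ r′ → f p q r ≡ f p′ q′ r′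
    cong₃ f refl refl refl = refl

  toMove : Turn {h} → Move size
  toMove (X , k) = X , Fin.cast (sym half-size) k

  toMove-threshold : ∀ k → half size ℤ.- + (2 ℕ.* toℕ (Fin.cast (sym half-size) k)) ≡ + gap k
  toMove-threshold k = trans (cong (λ m → half size ℤ.- + (2 ℕ.* m)) (Finₚ.toℕ-cast (sym half-size) k)) (threshold k)

  rotate-point : ∀ X t a b → rotCW (normal X) (pos (facelet t a b)) ≡ pos (facelet (rotate X t) a b)
  rotate-point X t a b = begin
    rotCW (normal X) (pos (facelet t a b))   ≡⟨ cong (rotCW (normal X)) (pos-facelet t a b) ⟩
    rotCW (normal X) (point t a b)           ≡⟨ rotCW-combine (normal X) g₀ gₐ g_b (n₁ t) (n₂ t) (n₃ t) ⟩
    combine g₀ gₐ g_b (rotCW (normal X) (n₁ t)) (rotCW (normal X) (n₂ t)) (rotCW (normal X) (n₃ t))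
      ≡⟨ cong₂ _⊕_ (cong₂ _⊕_ (cong (scale g₀) (rotCW-n₁ X t)) (cong (scale gₐ) (rotCW-n₂ X t))) (cong (scale g_b) (rotCW-n₃ X t)) ⟩
    point (rotate X t) a b                   ≡⟨ pos-facelet (rotate X t) a b ⟨
    pos (facelet (rotate X t) a b)           ∎
    where
    open ≡-Reasoning
    g₀ = + gap zero
    gₐ = + gap a
    g_b = + gap b

  moveAct-facelet : ∀ m t a b → moveAct {size} (toMove m) (emb (facelet t a b)) ≡ emb (facelet (turnAct m a b t) a b)
  moveAct-facelet (X , k) t a b = trans
    (cong (λ c → if c then (rotCW (normal X) p , rotCW (normal X) d) else (p , d))
      (trans (cong (dot p (normal X) =ᵇ_) (toMove-threshold k)) (slice-test X k t a b)))
    (choose (selects X (k =L zero) (k =L a) (k =L b) t))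
    where
    p = pos (facelet t a b)
    d = nrm (facelet t a b)
    choose : ∀ c → (if c then (rotCW (normal X) p , rotCW (normal X) d) else (p , d)) ≡
      emb (facelet (if c then rotate X t else t) a b)
    choose false = refl
    choose true  = cong₂ _,_ (rotate-point X t a b)
      (trans (cong (rotCW (normal X)) (nrm-facelet t a b)) (trans (rotCW-n₁ X t) (sym (nrm-facelet (rotate X t) a b))))

  act-facelet : ∀ ms t a b → act {size} (map toMove ms) (emb (facelet t a b)) ≡ emb (facelet (run ms a b t) a b)
  act-facelet []       t a b = refl
  act-facelet (m ∷ ms) t a b = trans (cong (act {size} (map toMove ms)) (moveAct-facelet m t a b)) (act-facelet ms (turnAct m a b t) a b)

-- Orbits, handedness, orientation and canonical facelets of places

_=B_ : Bool → Bool → Bool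
true  =B b = b
false =B b = not b

=B-sound : ∀ {a b} → (a =B b) ≡ true → a ≡ b
=B-sound {true}  {true}  _ = refl
=B-sound {false} {false} _ = refl

-- `orbitKey` as a function of two layers and two halves, so that their values at `lo` and `hi` can
-- be substituted.
key : ℕ → ℕ → Bool → Bool → OrbitKey
key i j l m =
  if i ≡ᵇ 0 then (if j ≡ᵇ 0 then corner else edge j)
  else if j ≡ᵇ 0 then edge i
  else if l =B m then center i j
  else center j i

orbitKey-unfold : ∀ {n} (f@(X , r , c) : Facelet n) →
  orbitKey f ≡ key (layer r) (layer c) (toℕ r <ᵇ n / 2) (toℕ c <ᵇ n / 2)
orbitKey-unfold {n} (X , r , c) with layer r ≡ᵇ 0 | layer c ≡ᵇ 0
... | true  | true  = refl
... | true  | false = refl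
... | false | true  = refl
... | false | false with toℕ r <ᵇ n / 2 | toℕ c <ᵇ n / 2
...   | true  | true  = refl
...   | true  | false = refl
...   | false | true  = refl
...   | false | false = refl

cornerKey : OrbitKey → Bool
cornerKey corner = true
cornerKey _      = false

edgeKey : ℕ → OrbitKey → Bool
edgeKey a (edge b) = a ≡ᵇ b
edgeKey a _        = false

centerKey : ℕ → ℕ → OrbitKey → Bool
centerKey a b (center c d) = (a ≡ᵇ c) ∧ (b ≡ᵇ d)
centerKey a b _            = false

isCorner-key : ∀ {n} (f : Facelet n) → isCorner f ≡ cornerKey (orbitKey f)
isCorner-key f with orbitKey f
... | corner     = refl
... | edge _     = refl
... | center _ _ = refl

isEdgeOrbit-key : ∀ {n} a (f : Facelet n) → isEdgeOrbit a f ≡ edgeKey a (orbitKey f)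
isEdgeOrbit-key a f with orbitKey f
... | corner     = refl
... | edge _     = refl
... | center _ _ = refl

isCenterOrbit-key : ∀ {n} a b (f : Facelet n) → isCenterOrbit a b f ≡ centerKey a b (orbitKey f)
isCenterOrbit-key a b f with orbitKey f
... | corner     = refl
... | edge _     = refl
... | center _ _ = refl

isCornerUD-key : ∀ {n} (f : Facelet n) → isCornerUD f ≡ (rank (face f) <ᵇ 2) ∧ isCorner f
isCornerUD-key (U , _ , _) = refl
isCornerUD-key (D , _ , _) = refl
isCornerUD-key (F , _ , _) = refl
isCornerUD-key (B , _ , _) = refl
isCornerUD-key (R , _ , _) = refl
isCornerUD-key (L , _ , _) = refl

handed : Bool → Bool → Bool → Bool → Bool → Bool → Bool
handed r₀ rₙ c₀ cₙ l m =
  if r₀ then m else if rₙ then not m else if cₙ then l else if c₀ then not l else false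

handed-cong : ∀ {p p′ q q′ r r′ s s′ t t′ u u′} → p ≡ p′ → q ≡ q′ → r ≡ r′ → s ≡ s′ → t ≡ t′ → u ≡ u′ →
  handed p q r s t u ≡ handed p′ q′ r′ s′ t′ u′
handed-cong refl refl refl refl refl refl = refl

turnOf : Face → V3 → ℕ
turnOf U p = 0
turnOf D p = 0
turnOf X p = if 0ℤ <ℤᵇ dot (cross (normal X) (v3 0ℤ (if 0ℤ <ℤᵇ y p then 1ℤ else -1ℤ) 0ℤ)) p then 1 else 2

twist-turnOf : ∀ {n} (f : Facelet n) → twist f ≡ turnOf (face f) (pos f)
twist-turnOf (U , _ , _) = refl
twist-turnOf (D , _ , _) = refl
twist-turnOf (F , _ , _) = refl
twist-turnOf (B , _ , _) = refl
twist-turnOf (R , _ , _) = refl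
twist-turnOf (L , _ , _) = refl

combine-scale : ∀ g n u v → combine g g g n u v ≡ scale g ((n ⊕ u) ⊕ v)
combine-scale g (v3 a b c) (v3 d e f) (v3 i j k) = v3-cong (identity g a d i) (identity g b e j) (identity g c f k)
  where
  identity : ∀ g a d i → (g *ᶻ a +ᶻ g *ᶻ d) +ᶻ g *ᶻ i ≡ g *ᶻ ((a +ᶻ d) +ᶻ i)
  identity = solve-∀

-- The corner is `suc k` times a vector with entries 1 and -1, and only signs are compared. So the
-- test evaluates with `k` left a variable and holds for cubes of all sizes.
turnOf-orient : ∀ k t → turnOf (axis₁ t) (scale (+ suc k) ((n₁ t ⊕ n₂ t) ⊕ n₃ t)) ≡ orient t
turnOf-orient k t = ≡ᵇ-sound _ _ (exhaust (λ t →
  turnOf (axis₁ t) (scale (+ suc k) ((n₁ t ⊕ n₂ t) ⊕ n₃ t)) ≡ᵇ orient t) refl t)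

-- A cubie touches `Y` exactly if it lies in the outermost slice of `Y`; hence `selects` for layer
-- 0, with `i` and `j` telling whether `a` and `b` are 0.
canonicalAt : Bool → Bool → Place → Bool
canonicalAt i j t = and (map (λ Y → not ((rank Y <ᵇ rank (axis₁ t)) ∧ selects Y true i j t)) faces)

canonicalAt-center : ∀ t → canonicalAt false false t ≡ true
canonicalAt-center t = exhaust (canonicalAt false false) refl t

-- U and D come first in the order of faces, and every corner touches exactly one of them.
canonicalAt-corner : ∀ t → canonicalAt true true t ≡ onUD t
canonicalAt-corner t = =B-sound (exhaust (λ t → canonicalAt true true t =B onUD t) refl t)

-- `spin t` is the other sticker of the edge cubie of `t`, and of the two the one on the earlier
-- face is canonical.
canonicalAt-edge : ∀ t → canonicalAt false true (spin t) ≡ not (canonicalAt true false t)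
canonicalAt-edge t = =B-sound (exhaust (λ t → canonicalAt false true (spin t) =B not (canonicalAt true false t)) refl t)

-- Facelets with equal positions lie in the same slices. The checks that follow recover the place,
-- or the corner cubie, from these slices, which avoids comparing coordinates.
agree : Bool → Bool → Bool → Place → Place → Bool
agree i j k s t = all (λ X → selects X i j k s =B selects X i j k t) faces

corner-determined : ∀ {s t} → agree true true true s t ≡ true → cubie s ≡ cubie t
corner-determined {s} {t} eq = =P-sound (⇒ᵇ-sound (exhaust (λ (s , t) →
  agree true true true s t ⇒ᵇ (cubie s =P cubie t)) refl (s , t)) eq)

edge-determined : ∀ {s t} → agree true true false s t ∧ agree false false true s t ≡ true → s ≡ t
edge-determined {s} {t} eq = =P-sound (⇒ᵇ-sound (exhaust (λ (s , t) →
  (agree true true false s t ∧ agree false false true s t) ⇒ᵇ (s =P t)) refl (s , t)) eq)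

-- The slices at depths 0 and `a` suffice: they give the first two axes, or for `a ≡ b` the first
-- and the set of the other two, and the frame is right-handed.
center-determined : ∀ e {s t} → agree true false false s t ∧ agree false true e s t ≡ true → s ≡ t
center-determined e {s} {t} eq = =P-sound (⇒ᵇ-sound (exhaust (λ (e , s , t) →
  (agree true false false s t ∧ agree false true e s t) ⇒ᵇ (s =P t)) refl (e , s , t)) eq)

module _ {h : ℕ} where

  outer : Layer {h} → Bool
  outer a = toℕ a ≡ᵇ 0

  keyOf : Layer {h} → Layer {h} → OrbitKey
  keyOf zero    zero    = corner
  keyOf zero    (suc b) = edge (suc (toℕ b))
  keyOf (suc a) zero    = edge (suc (toℕ a))
  keyOf (suc a) (suc b) = center (suc (toℕ a)) (suc (toℕ b))

  orbitKey-facelet : ∀ t a b → orbitKey (facelet t a b) ≡ keyOf a b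
  orbitKey-facelet (X , q) a b = trans (orbitKey-unfold (facelet (X , q) a b)) (go q)
    where
    key-cong : ∀ {i i′ j j′ l l′ m m′} → i ≡ i′ → j ≡ j′ → l ≡ l′ → m ≡ m′ → key i j l m ≡ key i′ j′ l′ m′
    key-cong refl refl refl refl = refl
    straight : ∀ l (a b : Layer {h}) → key (toℕ a) (toℕ b) l l ≡ keyOf a b
    straight _     zero    zero    = refl
    straight _     zero    (suc b) = refl
    straight _     (suc a) zero    = refl
    straight true  (suc a) (suc b) = refl
    straight false (suc a) (suc b) = refl
    crossed : ∀ l (a b : Layer {h}) → key (toℕ b) (toℕ a) l (not l) ≡ keyOf a b
    crossed _     zero    zero    = refl
    crossed _     zero    (suc b) = refl
    crossed _     (suc a) zero    = refl
    crossed true  (suc a) (suc b) = refl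
    crossed false (suc a) (suc b) = refl
    go : ∀ q → key (layer (proj₁ (proj₂ (facelet (X , q) a b)))) (layer (proj₂ (proj₂ (facelet (X , q) a b))))
      (toℕ (proj₁ (proj₂ (facelet (X , q) a b))) <ᵇ size {h} / 2) (toℕ (proj₂ (proj₂ (facelet (X , q) a b))) <ᵇ size {h} / 2)
      ≡ keyOf a b
    go q0 = trans (key-cong (layer-lo a) (layer-lo b) (lo-low a) (lo-low b)) (straight true a b)
    go q1 = trans (key-cong (layer-lo b) (layer-hi a) (lo-low b) (hi-high a)) (crossed true a b)
    go q2 = trans (key-cong (layer-hi a) (layer-hi b) (hi-high a) (hi-high b)) (straight false a b)
    go q3 = trans (key-cong (layer-hi b) (layer-lo a) (hi-high b) (lo-low a)) (crossed false a b)

  -- With the side `axis₂` at the top, `axis₃` is on the left, and `b` is counted from there up to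
  -- the middle. So a facelet along `axis₂` is left-handed and one along `axis₃` is not.
  leftHanded-facelet : ∀ t a b → outer b ≡ not (outer a) → leftHanded (facelet t a b) ≡ outer a
  leftHanded-facelet (X , q) a b ob = go q
    where
    lo-first : ∀ a → (toℕ (lo a) ≡ᵇ 0) ≡ outer a
    lo-first a = cong (_≡ᵇ 0) (toℕ-lo a)
    lo-last : ∀ a → (toℕ (lo a) ≡ᵇ suc (h ℕ.* 2)) ≡ false
    lo-last a = ≡ᵇ-false (λ eq → ℕₚ.<⇒≢ (s≤s (ℕₚ.≤-trans (layer≤h a) (ℕₚ.m≤m*n h 2))) (trans (sym (toℕ-lo a)) eq))
    hi-first : ∀ a → (toℕ (hi a) ≡ᵇ 0) ≡ false
    hi-first a = ≡ᵇ-false (λ eq → ℕₚ.<⇒≢ (ℕₚ.≤-trans (s≤s z≤n) (h<toℕ-hi a)) (sym (trans (sym (toℕ-hi a)) eq)))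
    hi-last : ∀ a → (toℕ (hi a) ≡ᵇ suc (h ℕ.* 2)) ≡ outer a
    hi-last zero      = trans (cong₂ _≡ᵇ_ (toℕ-hi {h} zero) (span {h} zero)) (≡ᵇ-refl (gap {h} zero))
    hi-last a@(suc _) = ≡ᵇ-false (λ eq → ℕₚ.<⇒≢ (ℕₚ.m<n+m (toℕ a ℕ.+ gap a) {toℕ a} (s≤s z≤n)) (trans (sym (toℕ-hi a)) (trans eq (span a))))
    at-q0 : ∀ p → handed p false (not p) false true true ≡ p
    at-q0 true  = refl
    at-q0 false = refl
    at-q1 : ∀ p → handed (not p) false false p true false ≡ p
    at-q1 true  = refl
    at-q1 false = refl
    at-q2 : ∀ p → handed false p false (not p) false false ≡ p
    at-q2 true  = refl
    at-q2 false = refl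
    at-q3 : ∀ p → handed false (not p) p false false true ≡ p
    at-q3 true  = refl
    at-q3 false = refl
    go : ∀ q → leftHanded (facelet (X , q) a b) ≡ outer a
    go q0 = trans (handed-cong (lo-first a) (lo-last a) (trans (lo-first b) ob) (lo-last b) (lo-low a) (lo-low b)) (at-q0 (outer a))
    go q1 = trans (handed-cong (trans (lo-first b) ob) (lo-last b) (hi-first a) (hi-last a) (lo-low b) (hi-high a)) (at-q1 (outer a))
    go q2 = trans (handed-cong (hi-first a) (hi-last a) (hi-first b) (trans (hi-last b) ob) (hi-high a) (hi-high b)) (at-q2 (outer a))
    go q3 = trans (handed-cong (hi-first b) (trans (hi-last b) ob) (lo-first a) (lo-last a) (hi-high b) (lo-low a)) (at-q3 (outer a))

  face-facelet : ∀ t a b → face (facelet {h} t a b) ≡ axis₁ t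
  face-facelet (X , q0) a b = refl
  face-facelet (X , q1) a b = refl
  face-facelet (X , q2) a b = refl
  face-facelet (X , q3) a b = refl

  twist-facelet : ∀ t → twist (facelet {h} t zero zero) ≡ orient t
  twist-facelet t = begin
    twist (facelet {h} t zero zero)                                ≡⟨ twist-turnOf (facelet {h} t zero zero) ⟩
    turnOf (face f) (pos f)                                        ≡⟨ cong₂ turnOf (face-facelet t zero zero) (pos-facelet t zero zero) ⟩
    turnOf (axis₁ t) (point {h} t zero zero)
      ≡⟨ cong (turnOf (axis₁ t)) (combine-scale (+ gap {h} zero) (n₁ t) (n₂ t) (n₃ t)) ⟩
    turnOf (axis₁ t) (scale (+ gap {h} zero) ((n₁ t ⊕ n₂ t) ⊕ n₃ t)) ≡⟨ turnOf-orient (2 ℕ.* (h ∸ 0)) t ⟩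
    orient t                                                       ∎
    where
    open ≡-Reasoning
    f = facelet {h} t zero zero

  canonical-facelet : ∀ t a b → canonical (facelet {h} t a b) ≡ canonicalAt (zero =L a) (zero =L b) t
  canonical-facelet t a b = cong and (map-cong (λ Y → cong not (cong₂ _∧_
    (cong (λ Z → rank Y <ᵇ rank Z) (face-facelet t a b))
    (trans (cong (dot (pos (facelet t a b)) (normal Y) =ᵇ_) (half-gap {h})) (slice-test Y zero t a b)))) faces)

  agree-if-same-pos : ∀ s t a b → pos (facelet {h} s a b) ≡ pos (facelet t a b) → ∀ k →
    agree (k =L zero) (k =L a) (k =L b) s t ≡ true
  agree-if-same-pos s t a b eq k = all-true faces
    where
    =B-refl : ∀ {p q} → p ≡ q → (p =B q) ≡ true
    =B-refl {true}  refl = refl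
    =B-refl {false} refl = refl
    all-true : ∀ Xs → all (λ X → selects X (k =L zero) (k =L a) (k =L b) s =B selects X (k =L zero) (k =L a) (k =L b) t) Xs ≡ true
    all-true []       = refl
    all-true (X ∷ Xs) = cong₂ _∧_ (=B-refl (trans (sym (slice-test X k s a b))
      (trans (cong (λ p → dot p (normal X) =ᵇ (+ gap k)) eq) (slice-test X k t a b)))) (all-true Xs)

  corner-pos : ∀ {s t} → pos (facelet {h} s zero zero) ≡ pos (facelet {h} t zero zero) → cubie s ≡ cubie t
  corner-pos {s} {t} eq = corner-determined {s} {t} (agree-if-same-pos s t zero zero eq zero)

  edge-pos : ∀ {s t b} → pos (facelet {h} s zero (suc b)) ≡ pos (facelet t zero (suc b)) → s ≡ t
  edge-pos {s} {t} {b} eq = edge-determined {s} {t} (cong₂ _∧_ (agree-if-same-pos s t zero (suc b) eq zero)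
    (subst (λ e → agree false false e s t ≡ true) (dec-true (suc b Fin.≟ suc b) refl) (agree-if-same-pos s t zero (suc b) eq (suc b))))

  center-pos : ∀ {s t a b} → pos (facelet {h} s (suc a) (suc b)) ≡ pos (facelet t (suc a) (suc b)) → s ≡ t
  center-pos {s} {t} {a} {b} eq = center-determined (suc a =L suc b) {s} {t} (cong₂ _∧_ (agree-if-same-pos s t (suc a) (suc b) eq zero)
    (subst (λ e → agree false e (suc a =L suc b) s t ≡ true) (dec-true (suc a Fin.≟ suc a) refl) (agree-if-same-pos s t (suc a) (suc b) eq (suc a))))

  -- A key determines the two layers except on edges, where the facelets of `(0 , b)` and `(b , 0)`
  -- share one orbit of cubies.
  data SameOrbit : (a b c d : Layer {h}) → Set where
    straight : ∀ {a b} → SameOrbit a b a b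
    rightward : ∀ {b} → SameOrbit zero (suc b) (suc b) zero
    leftward : ∀ {b} → SameOrbit (suc b) zero zero (suc b)

  edge-injective : ∀ {b d : Fin h} → edge (suc (toℕ b)) ≡ edge (suc (toℕ d)) → b ≡ d
  edge-injective eq = Finₚ.toℕ-injective (ℕₚ.suc-injective (lemma eq))
    where
    lemma : ∀ {i j} → edge i ≡ edge j → i ≡ j
    lemma refl = refl

  center-injective : ∀ {a b c d : Fin h} →
    center (suc (toℕ a)) (suc (toℕ b)) ≡ center (suc (toℕ c)) (suc (toℕ d)) → a ≡ c × b ≡ d
  center-injective eq = Finₚ.toℕ-injective (ℕₚ.suc-injective (proj₁ (lemma eq))) ,
                        Finₚ.toℕ-injective (ℕₚ.suc-injective (proj₂ (lemma eq)))
    where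
    lemma : ∀ {i j k l} → center i j ≡ center k l → i ≡ k × j ≡ l
    lemma refl = refl , refl

  sameOrbit : ∀ a b c d → keyOf a b ≡ keyOf c d → SameOrbit a b c d
  sameOrbit zero    zero    zero    zero    eq = straight
  sameOrbit zero    zero    zero    (suc _) ()
  sameOrbit zero    zero    (suc _) (suc _) ()
  sameOrbit (suc _) (suc _) zero    zero    ()
  sameOrbit (suc _) (suc _) (suc _) zero    ()
  sameOrbit zero    (suc b) zero    (suc d) eq with refl ← edge-injective eq = straight
  sameOrbit zero    (suc b) (suc c) zero    eq with refl ← edge-injective eq = rightward
  sameOrbit (suc a) zero    zero    (suc d) eq with refl ← edge-injective eq = leftward
  sameOrbit (suc a) zero    (suc c) zero    eq with refl ← edge-injective eq = straight
  sameOrbit (suc a) (suc b) (suc c) (suc d) eq with refl , refl ← center-injective eq = straight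

-- Rotations against reflections of a frame

gram : (V3 → ℤ) → Place → V3
gram v t = v3 (entry x) (entry y) (entry z)
  where
  entry : (V3 → ℤ) → ℤ
  entry u = (u (n₁ t) *ᶻ v (n₁ t) +ᶻ u (n₂ t) *ᶻ v (n₂ t)) +ᶻ u (n₃ t) *ᶻ v (n₃ t)

gram-x : ∀ t → gram x t ≡ ex
gram-x t = =V-sound (exhaust (λ t → gram x t =V ex) refl t)

gram-y : ∀ t → gram y t ≡ ey
gram-y t = =V-sound (exhaust (λ t → gram y t =V ey) refl t)

gram-z : ∀ t → gram z t ≡ ez
gram-z t = =V-sound (exhaust (λ t → gram z t =V ez) refl t)

-- Expansion in an orthonormal basis: if the frame forms the columns of a matrix, `gram v t` is a
-- row of its product with the transpose, hence a unit vector.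
frame-expansion : ∀ t w → combine (dot w (n₁ t)) (dot w (n₂ t)) (dot w (n₃ t)) (n₁ t) (n₂ t) (n₃ t) ≡ w
frame-expansion t (v3 p q r) = v3-cong
  (component x (gram-x t) (x∙1+y∙0+z∙0 p q r))
  (component y (gram-y t) (x∙0+y∙1+z∙0 p q r))
  (component z (gram-z t) (x∙0+y∙0+z∙1 p q r))
  where
  identity : ∀ p q r a b c d e f i j k u v w →
    ((p *ᶻ a +ᶻ q *ᶻ b +ᶻ r *ᶻ c) *ᶻ u +ᶻ (p *ᶻ d +ᶻ q *ᶻ e +ᶻ r *ᶻ f) *ᶻ v) +ᶻ (p *ᶻ i +ᶻ q *ᶻ j +ᶻ r *ᶻ k) *ᶻ w ≡
    (p *ᶻ ((a *ᶻ u +ᶻ d *ᶻ v) +ᶻ i *ᶻ w) +ᶻ q *ᶻ ((b *ᶻ u +ᶻ e *ᶻ v) +ᶻ j *ᶻ w)) +ᶻ r *ᶻ ((c *ᶻ u +ᶻ f *ᶻ v) +ᶻ k *ᶻ w)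
  identity = solve-∀
  component : ∀ v {e m} → gram v t ≡ e → (p *ᶻ x e +ᶻ q *ᶻ y e) +ᶻ r *ᶻ z e ≡ m →
    (dot (v3 p q r) (n₁ t) *ᶻ v (n₁ t) +ᶻ dot (v3 p q r) (n₂ t) *ᶻ v (n₂ t)) +ᶻ dot (v3 p q r) (n₃ t) *ᶻ v (n₃ t) ≡ m
  component v refl eq = trans (identity p q r (x (n₁ t)) (y (n₁ t)) (z (n₁ t)) (x (n₂ t)) (y (n₂ t)) (z (n₂ t))
    (x (n₃ t)) (y (n₃ t)) (z (n₃ t)) (v (n₁ t)) (v (n₂ t)) (v (n₃ t))) eq

det : V3 → V3 → V3 → ℤ
det a b c = dot a (cross b c)

-- the component v of the rows of the matrix taking the frame t to the frame s with its last two axes exchanged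
mirrorRow : (V3 → ℤ) → Place → Place → V3
mirrorRow v s t = combine (v (n₁ s)) (v (n₃ s)) (v (n₂ s)) (n₁ t) (n₂ t) (n₃ t)

det-mirror : ∀ s t → det (mirrorRow x s t) (mirrorRow y s t) (mirrorRow z s t) ≡ -1ℤ
det-mirror s t = =ᵇ-sound (exhaust (λ (s , t) →
  det (mirrorRow x s t) (mirrorRow y s t) (mirrorRow z s t) =ᵇ -1ℤ) refl (s , t))

-- Expanding the rows of `M` in the frame `t` shows that `M` is the matrix of `mirrorRow`, of
-- determinant -1. This excludes reflected arrangements of the stickers of a corner.
rotation-not-mirror : ∀ M s t → IsRotation M → apply M (n₁ t) ≡ n₁ s → apply M (n₂ t) ≡ n₃ s → apply M (n₃ t) ≡ n₂ s → ⊥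
rotation-not-mirror (m3 a b c) s t (_ , _ , _ , _ , _ , _ , det≡1) e₁ e₂ e₃ = 1≢-1 (begin
  1ℤ                                                          ≡⟨ det≡1 ⟨
  det a b c                                                   ≡⟨ cong₃ det (row x a (λ _ → refl)) (row y b (λ _ → refl)) (row z c (λ _ → refl)) ⟩
  det (mirrorRow x s t) (mirrorRow y s t) (mirrorRow z s t)   ≡⟨ det-mirror s t ⟩
  -1ℤ                                                         ∎)
  where
  open ≡-Reasoning
  1≢-1 : 1ℤ ≢ -1ℤ
  1≢-1 ()
  cong₃ : ∀ (f : V3 → V3 → V3 → ℤ) {p p′ q q′ r r′} → p ≡ p′ → q ≡ q′ → r ≡ r′ → f p q r ≡ f p′ q′ r′
  cong₃ f refl refl refl = refl
  cong₃′ : ∀ (f : ℤ → ℤ → ℤ → V3) {p p′ q q′ r r′} → p ≡ p′ → q ≡ q′ → r ≡ r′ → f p q r ≡ f p′ q′ r′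
  cong₃′ f refl refl refl = refl
  row : ∀ (v : V3 → ℤ) w → (∀ u → v (apply (m3 a b c) u) ≡ dot w u) → w ≡ mirrorRow v s t
  row v w comp = trans (sym (frame-expansion t w)) (cong₃′ (λ i j k → combine i j k (n₁ t) (n₂ t) (n₃ t))
    (trans (sym (comp (n₁ t))) (cong v e₁)) (trans (sym (comp (n₂ t))) (cong v e₂)) (trans (sym (comp (n₃ t))) (cong v e₃)))

-- The lexicographic order on positions

lexᵇ : (a d b e c f : Bool) → Bool
lexᵇ p p′ q q′ r r′ = not p′ ∨ ((p ∧ p′) ∧ (not q′ ∨ ((q ∧ q′) ∧ not r′)))

-- `lexᵇ` is `lexLt` with `p` and `p′` standing for the two comparisons of the first coordinates,
-- and so on. Totality of the integers leaves a few Boolean cases.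
lexᵇ-total : ∀ p p′ q q′ r r′ → p ∨ p′ ≡ true → q ∨ q′ ≡ true → r ∨ r′ ≡ true →
  ((p ∧ p′) ∧ ((q ∧ q′) ∧ (r ∧ r′)) ≡ true → ⊥) → lexᵇ p′ p q′ q r′ r ≡ not (lexᵇ p p′ q q′ r r′)
lexᵇ-total true  false q     q′    r     r′    _ _ _ _ = refl
lexᵇ-total false true  q     q′    r     r′    _ _ _ _ = refl
lexᵇ-total true  true  true  false r     r′    _ _ _ _ = refl
lexᵇ-total true  true  false true  r     r′    _ _ _ _ = refl
lexᵇ-total true  true  true  true  true  false _ _ _ _ = refl
lexᵇ-total true  true  true  true  false true  _ _ _ _ = refl
lexᵇ-total true  true  true  true  true  true  _ _ _ k = ⊥-elim (k refl)

≤ᵇ-total : ∀ i j → (i ≤ᵇ j) ∨ (j ≤ᵇ i) ≡ true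
≤ᵇ-total i j with ℤₚ.≤-total i j
... | inj₁ i≤j rewrite Equivalence.to T-≡ (ℤₚ.≤⇒≤ᵇ i≤j) = refl
... | inj₂ j≤i rewrite Equivalence.to T-≡ (ℤₚ.≤⇒≤ᵇ j≤i) = ∨-zeroʳ (i ≤ᵇ j)

≤ᵇ-refl : ∀ i → (i ≤ᵇ i) ≡ true
≤ᵇ-refl i = Equivalence.to T-≡ (ℤₚ.≤⇒≤ᵇ (ℤₚ.≤-refl {i}))

lexLt-irrefl : ∀ p → lexLt p p ≡ false
lexLt-irrefl (v3 a b c) rewrite ≤ᵇ-refl a | ≤ᵇ-refl b | ≤ᵇ-refl c = refl

lexLt-total : ∀ p q → p ≢ q → lexLt q p ≡ not (lexLt p q)
lexLt-total (v3 a b c) (v3 d e f) p≢q = lexᵇ-total (a ≤ᵇ d) (d ≤ᵇ a) (b ≤ᵇ e) (e ≤ᵇ b) (c ≤ᵇ f) (f ≤ᵇ c)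
  (≤ᵇ-total a d) (≤ᵇ-total b e) (≤ᵇ-total c f) (λ eq → p≢q (=V-sound eq))

-- Enumerating the facelets of an orbit

concatMap-map : ∀ {A B C : Set} (f : A → B → C) xs ys →
  concatMap (λ a → map (f a) ys) xs ≡ map (λ (a , b) → f a b) (cartesianProduct xs ys)
concatMap-map f []       ys = refl
concatMap-map f (a ∷ xs) ys = trans (cong₂ _++_ (map-∘ ys) (concatMap-map f xs ys))
  (sym (map-++ _ (map (a ,_) ys) (cartesianProduct xs ys)))

allFacelets-product : ∀ n → allFacelets n ≡ cartesianProduct faces (cartesianProduct (allFin n) (allFin n))
allFacelets-product n = trans
  (concatMap-cong (λ X → concatMap-map (λ r c → X , r , c) (allFin n) (allFin n)) faces)
  (trans (concatMap-map _,_ faces (cartesianProduct (allFin n) (allFin n))) (map-id _))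

allFacelets-unique : ∀ n → Unique (allFacelets n)
allFacelets-unique n = subst Unique (sym (allFacelets-product n))
  (cartesianProduct⁺ (unique {{finite-Face}}) (cartesianProduct⁺ (allFin⁺ n) (allFin⁺ n)))

∈-allFacelets : ∀ {n} (f : Facelet n) → f ∈ allFacelets n
∈-allFacelets {n} (X , r , c) = subst ((X , r , c) ∈_) (sym (allFacelets-product n))
  (∈-cartesianProduct⁺ (complete X) (∈-cartesianProduct⁺ (∈-allFin r) (∈-allFin c)))

filter-↭ : ∀ {n} (Q : Facelet n → Bool) {A : Set} (α : A → Facelet n) (ts : List A) → Unique ts →
  (∀ {s t} → s ∈ ts → t ∈ ts → α s ≡ α t → s ≡ t) →
  (∀ {t} → t ∈ ts → Q (α t) ≡ true) → (∀ f → Q f ≡ true → ∃ λ t → t ∈ ts × f ≡ α t) →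
  filterᵇ Q (allFacelets n) ↭ map α ts
filter-↭ {n} Q α ts u α-inj sound comp =
  ∼bag⇒↭ (unique∧set⇒bag (filter⁺ (T? ∘ Q) (allFacelets-unique n)) (unique-map u α-inj) (mk⇔ to from))
  where
  to : ∀ {f} → f ∈ filterᵇ Q (allFacelets n) → f ∈ map α ts
  to f∈ with comp _ (Equivalence.to T-≡ (proj₂ (∈-filter⁻ (T? ∘ Q) {xs = allFacelets n} f∈)))
  ... | t , t∈ , refl = ∈-map⁺ α t∈
  from : ∀ {f} → f ∈ map α ts → f ∈ filterᵇ Q (allFacelets n)
  from f∈ with ∈-map⁻ α f∈
  ... | t , t∈ , refl = ∈-filter⁺ (T? ∘ Q) (∈-allFacelets (α t)) (Equivalence.from T-≡ (sound t∈))

module _ {h : ℕ} where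

  pos-cubie : ∀ t → pos (facelet {h} (cubie t) zero zero) ≡ pos (facelet {h} t zero zero)
  pos-cubie t with onUD t
  ... | true  = refl
  ... | false with onUD (spin t)
  ...   | true  = pos-spin t zero
  ...   | false = trans (pos-spin (spin t) zero) (pos-spin t zero)

  cornerKey-zero : ∀ (a b : Layer {h}) → cornerKey (keyOf a b) ≡ true → a ≡ zero × b ≡ zero
  cornerKey-zero zero zero _ = refl , refl
  cornerKey-zero zero    (suc _) ()
  cornerKey-zero (suc _) zero    ()
  cornerKey-zero (suc _) (suc _) ()

  isCorner-facelet : ∀ t (a b : Layer {h}) → isCorner (facelet t a b) ≡ cornerKey (keyOf a b)
  isCorner-facelet t a b = trans (isCorner-key (facelet t a b)) (cong cornerKey (orbitKey-facelet t a b))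

-- From arrangements to states

sign₈-unfold : ∀ ρ → sign₈ ρ ≡ signOn _<P_ (cubie ∘ ρ) cubies
sign₈-unfold ρ = refl

sign₂₄-unfold : ∀ ρ → sign₂₄ ρ ≡ signOn _<P_ ρ places
sign₂₄-unfold ρ = refl

module _ {h : ℕ} (g : Facelet (size {h}) → Facelet (size {h})) (conf : InSconf (size {h}) g) where

  g-injective : ∀ {f f′} → g f ≡ g f′ → f ≡ f′
  g-injective = proj₁ (proj₁ conf) _ _

  g-key : ∀ f → orbitKey (g f) ≡ orbitKey f
  g-key f = proj₂ (proj₂ (proj₂ (proj₂ (proj₂ (proj₂ conf (pos f)))) f refl))

  g-pos : ∀ {f f′} → pos f ≡ pos f′ → pos (g f) ≡ pos (g f′)
  g-pos {f} {f′} eq = trans (proj₁ (rigid f eq)) (sym (proj₁ (rigid f′ refl)))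
    where rigid = proj₂ (proj₂ (proj₂ (proj₂ conf (pos f′))))

  image : ∀ t (a b : Layer {h}) → ∃ λ s → ∃ λ (c : Layer {h}) → ∃ λ (d : Layer {h}) → g (facelet t a b) ≡ facelet s c d × SameOrbit a b c d
  image t a b with facelet-view {h} (g (facelet t a b))
  ... | s , c , d , eq = s , c , d , eq , sameOrbit a b c d
    (trans (sym (orbitKey-facelet t a b)) (trans (sym (g-key (facelet t a b))) (trans (cong orbitKey eq) (orbitKey-facelet s c d))))

  ImageIn : Place → Layer {h} → Layer {h} → Set
  ImageIn t a b = ∃ λ s → g (facelet t a b) ≡ facelet s a b

  module _ (left-handed : ∀ t (b : Fin h) → leftHanded (g (facelet t zero (suc b))) ≡ true) where

    image-left : ∀ t b → ImageIn t zero (suc b)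
    image-left t b with image t zero (suc b)
    ... | s , _ , _ , eq , straight  = s , eq
    ... | s , _ , _ , eq , rightward = contradiction
      (trans (sym (left-handed t b)) (trans (cong leftHanded eq) (leftHanded-facelet s (suc b) zero refl))) λ ()

    -- If this sticker came to a left-handed place, it would share its position with the image of
    -- the left-handed sticker of the same cubie. A position has only one left-handed place, so `g`
    -- would not be injective.
    image-right : ∀ t b → ImageIn (spin t) (suc b) zero
    image-right t b with image (spin t) (suc b) zero
    ... | s , _ , _ , eq , straight = s , eq
    ... | s , _ , _ , eq , leftward = contradiction (proj₁ (proj₂ (facelet-injective (g-injective same-image)))) λ ()
      where
      left = image-left t b
      same-image : g (facelet (spin t) (suc b) zero) ≡ g (facelet t zero (suc b))
      same-image = trans eq (trans (cong (λ u → facelet u zero (suc b)) (edge-pos (trans (cong pos (sym eq))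
        (trans (g-pos (pos-spin t (suc b))) (cong pos (proj₂ left)))))) (sym (proj₂ left)))

    image-in : ∀ (a b : Layer {h}) t → ImageIn t a b
    image-in zero    zero    t with image t zero zero
    ... | s , _ , _ , eq , straight = s , eq
    image-in zero    (suc b) t = image-left t b
    image-in (suc b) zero    t = subst (λ u → ImageIn u (suc b) zero) (spin³ t) (image-right (spin (spin t)) b)
    image-in (suc a) (suc b) t with image t (suc a) (suc b)
    ... | s , _ , _ , eq , straight = s , eq

    stateOf : State {h}
    stateOf a b t = proj₁ (image-in a b t)

    g-stateOf : ∀ (a b : Layer {h}) t → g (facelet t a b) ≡ facelet (stateOf a b t) a b
    g-stateOf a b t = proj₂ (image-in a b t)

  module _ (π : State {h}) (g-facelet : ∀ (a b : Layer {h}) t → g (facelet t a b) ≡ facelet (π a b t) a b) where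

    pos-g : ∀ (a b : Layer {h}) t → pos (g (facelet t a b)) ≡ pos (facelet (π a b t) a b)
    pos-g a b t = cong pos (g-facelet a b t)

    π-injective : ∀ (a b : Layer {h}) → InjectiveP (π a b)
    π-injective a b {s} {t} eq = proj₁ (facelet-injective (g-injective
      (trans (g-facelet a b s) (trans (cong (λ u → facelet u a b) eq) (sym (g-facelet a b t))))))

    spin-pos : ∀ (b : Layer {h}) t → pos (facelet (π b zero (spin t)) b zero) ≡ pos (facelet (π zero b t) zero b)
    spin-pos b t = trans (sym (pos-g b zero (spin t))) (trans (g-pos (pos-spin t b)) (pos-g zero b t))

    corner-normal : ∀ t → Σ M3 λ M → IsRotation M ×
      (∀ f → pos f ≡ pos (facelet {h} t zero zero) → nrm (g f) ≡ apply M (nrm f))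
    corner-normal t with proj₂ conf (pos (facelet {h} t zero zero))
    ... | _ , M , rot , rigid = M , rot , λ f eq → proj₁ (proj₂ (rigid f eq))

    -- The stickers of a corner all arrive at one cubie. Injectivity leaves only the two cyclic
    -- orders of the images, and the reversed one would be a reflection.
    coupled-corner : ∀ t → π zero zero (spin t) ≡ spin (π zero zero t)
    coupled-corner t = go (cubie-fibre (cubie-eq t)) (cubie-fibre (trans (cubie-eq (spin t)) (cubie-eq t)))
      where
      ρ = π zero zero
      cubie-eq : ∀ t → cubie (ρ (spin t)) ≡ cubie (ρ t)
      cubie-eq t = corner-pos {h} {ρ (spin t)} {ρ t} (spin-pos zero t)
      M = proj₁ (corner-normal t)
      M-normal : ∀ u → pos (facelet {h} u zero zero) ≡ pos (facelet {h} t zero zero) → apply M (n₁ u) ≡ n₁ (ρ u)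
      M-normal u eq = trans (cong (apply M) (sym (nrm-facelet u zero zero)))
        (trans (sym (proj₂ (proj₂ (corner-normal t)) (facelet {h} u zero zero) eq))
               (trans (cong nrm (g-facelet zero zero u)) (nrm-facelet (ρ u) zero zero)))
      go : ρ (spin t) ≡ ρ t ⊎ ρ (spin t) ≡ spin (ρ t) ⊎ ρ (spin t) ≡ spin (spin (ρ t)) →
           ρ (spin (spin t)) ≡ ρ t ⊎ ρ (spin (spin t)) ≡ spin (ρ t) ⊎ ρ (spin (spin t)) ≡ spin (spin (ρ t)) →
           ρ (spin t) ≡ spin (ρ t)
      go (inj₁ e) _ = contradiction (π-injective zero zero e) (spin≢ t)
      go (inj₂ (inj₁ e)) _ = e
      go (inj₂ (inj₂ e)) (inj₁ e′) = contradiction (π-injective zero zero e′) (spin²≢ t)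
      go (inj₂ (inj₂ e)) (inj₂ (inj₂ e′)) = contradiction (π-injective zero zero (trans e′ (sym e))) (spin≢ t ∘ spin-injective)
      go (inj₂ (inj₂ e)) (inj₂ (inj₁ e′)) = ⊥-elim (rotation-not-mirror M (ρ t) t (proj₁ (proj₂ (corner-normal t)))
        (M-normal t refl)
        (trans (cong (apply M ∘ normal) (sym (spin-axis₁ t))) (trans (M-normal (spin t) (pos-spin t zero))
          (trans (cong n₁ e) (cong normal (trans (spin-axis₁ (spin (ρ t))) (spin-axis₂ (ρ t)))))))
        (trans (cong (apply M ∘ normal) (sym (trans (spin-axis₁ (spin t)) (spin-axis₂ t))))
          (trans (M-normal (spin (spin t)) (trans (pos-spin (spin t) zero) (pos-spin t zero)))
            (trans (cong n₁ e′) (cong normal (spin-axis₁ (ρ t)))))))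

    π-coupled : ∀ (b : Layer {h}) t → π b zero (spin t) ≡ spin (π zero b t)
    π-coupled zero    t = coupled-corner t
    -- `u` is the spin of `spin (spin u)`, which is therefore the left-handed place of its cubie,
    -- and a left-handed place is determined by its position.
    π-coupled (suc b) t = trans (sym (spin³ u)) (cong spin (edge-pos {h} {spin (spin u)} (trans
        (sym (pos-spin (spin (spin u)) (suc b))) (trans (cong (λ v → pos (facelet v (suc b) zero)) (spin³ u)) (spin-pos (suc b) t)))))
      where u = π (suc b) zero (spin t)

    -- `α` lists the canonical facelets of the orbit by the places `ts`. The inversions are taken in
    -- the order of positions, which is then replaced by the fixed order of places.
    sgn-signOn : ∀ (P : Facelet (size {h}) → Bool) (α : Place → Facelet (size {h})) (ts : List Place) (σ : Place → Place) →
      Unique ts → (∀ {t} → t ∈ ts → σ t ∈ ts) → (∀ {s t} → s ∈ ts → t ∈ ts → σ s ≡ σ t → s ≡ t) →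
      (∀ {s t} → s ∈ ts → t ∈ ts → pos (α s) ≡ pos (α t) → s ≡ t) →
      (∀ {t} → t ∈ ts → P (α t) ∧ canonical (α t) ≡ true) →
      (∀ f → P f ∧ canonical f ≡ true → ∃ λ t → t ∈ ts × f ≡ α t) →
      (∀ {t} → t ∈ ts → pos (g (α t)) ≡ pos (α (σ t))) →
      sgn (size {h}) g P ≡ signOn _<P_ σ ts
    sgn-signOn P α ts σ u σ∈ σ-inj pos-inj sound comp eq = trans
      (inversions-signOn lexLt lexLt-irrefl (filterᵇ (λ f → P f ∧ canonical f) (allFacelets (size {h}))) pos (pos ∘ g) σ
        (filter-↭ (λ f → P f ∧ canonical f) α ts u (λ s∈ t∈ e → pos-inj s∈ t∈ (cong pos e)) sound comp) u σ∈ σ-inj eq total)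
      (signOn-order _≟P_ total <P-total σ (injective-map-↭ u σ∈ σ-inj))
      where
      total : TotalOn (λ s t → lexLt (pos (α s)) (pos (α t))) ts
      total {s} {t} s∈ t∈ s≢t = lexLt-total (pos (α s)) (pos (α t)) (s≢t ∘ pos-inj s∈ t∈)

    sgn-corner : sgn (size {h}) g isCorner ≡ sign₈ (π zero zero)
    sgn-corner = trans (sgn-signOn isCorner α cubies (cubie ∘ ρ) cubies-unique (λ {t} _ → cubie-∈ (ρ t))
      (cubie-π-injective (π-injective zero zero) (π-coupled zero))
      (λ {s} {t} s∈ t∈ e → trans (sym (cubie-onUD s∈)) (trans (corner-pos {h} {s} {t} e) (cubie-onUD t∈)))
      (λ {t} t∈ → cong₂ _∧_ (isCorner-facelet t zero zero) (trans (canonical-corner t) (∈-cubies⇒onUD t∈)))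
      comp
      (λ {t} _ → trans (pos-g zero zero t) (sym (pos-cubie (ρ t))))) (sym (sign₈-unfold ρ))
      where
      ρ = π zero zero
      α : Place → Facelet (size {h})
      α t = facelet {h} t zero zero
      canonical-corner : ∀ t → canonical (α t) ≡ onUD t
      canonical-corner t = trans (canonical-facelet t zero zero) (canonicalAt-corner t)
      comp : ∀ f → isCorner f ∧ canonical f ≡ true → ∃ λ t → t ∈ cubies × f ≡ α t
      comp f eq with facelet-view {h} f
      ... | t , a , b , refl with cornerKey-zero a b (trans (sym (isCorner-facelet t a b)) (∧⇒ˡ eq))
      ...   | refl , refl = t , onUD⇒∈-cubies (trans (sym (canonical-corner t)) (∧⇒ʳ {isCorner (α t)} eq)) , refl

    sgn-center : ∀ a b → sgn (size {h}) g (isCenterOrbit (suc (toℕ a)) (suc (toℕ b))) ≡ sign₂₄ (π (suc a) (suc b))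
    sgn-center a b = trans (sgn-signOn P α places ρ unique (λ _ → complete _) (λ _ _ → π-injective (suc a) (suc b))
      (λ _ _ → center-pos) sound comp (λ {t} _ → pos-g (suc a) (suc b) t)) (sym (sign₂₄-unfold ρ))
      where
      ρ = π (suc a) (suc b)
      P : Facelet (size {h}) → Bool
      P = isCenterOrbit (suc (toℕ a)) (suc (toℕ b))
      α : Place → Facelet (size {h})
      α t = facelet t (suc a) (suc b)
      P-facelet : ∀ t (c d : Layer {h}) → P (facelet t c d) ≡ centerKey (suc (toℕ a)) (suc (toℕ b)) (keyOf c d)
      P-facelet t c d = trans (isCenterOrbit-key _ _ (facelet t c d)) (cong (centerKey _ _) (orbitKey-facelet t c d))
      sound : ∀ {t} → t ∈ places → P (α t) ∧ canonical (α t) ≡ true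
      sound {t} _ = cong₂ _∧_ (trans (P-facelet t (suc a) (suc b)) (cong₂ _∧_ (≡ᵇ-refl (toℕ a)) (≡ᵇ-refl (toℕ b))))
        (trans (canonical-facelet t (suc a) (suc b)) (canonicalAt-center t))
      layers : ∀ (c d : Layer {h}) → centerKey (suc (toℕ a)) (suc (toℕ b)) (keyOf c d) ≡ true → suc a ≡ c × suc b ≡ d
      layers (suc c) (suc d) eq = cong suc (Finₚ.toℕ-injective (≡ᵇ-sound _ _ (∧⇒ˡ eq))) ,
                                  cong suc (Finₚ.toℕ-injective (≡ᵇ-sound _ _ (∧⇒ʳ {toℕ a ≡ᵇ toℕ c} eq)))
      layers zero    zero    ()
      layers zero    (suc _) ()
      layers (suc _) zero    ()
      comp : ∀ f → P f ∧ canonical f ≡ true → ∃ λ t → t ∈ places × f ≡ α t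
      comp f eq with facelet-view {h} f
      ... | t , c , d , refl with layers c d (trans (sym (P-facelet t c d)) (∧⇒ˡ eq))
      ...   | refl , refl = t , complete t , refl

    -- The canonical sticker of an edge may be the right-handed one, so `α` picks for each
    -- left-handed place the canonical sticker of its cubie. Both have the same position, and the
    -- sign sees only positions.
    sgn-edge : ∀ b → sgn (size {h}) g (isEdgeOrbit (suc (toℕ b))) ≡ sign₂₄ (π zero (suc b))
    sgn-edge b = trans (sgn-signOn P α places ρ unique (λ _ → complete _) (λ _ _ → π-injective zero (suc b))
      (λ {s} {t} _ _ e → edge-pos (trans (sym (pos-α s)) (trans e (pos-α t)))) (λ {t} _ → sound t) comp
      (λ {t} _ → trans (g-pos (pos-α t)) (trans (pos-g zero (suc b) t) (sym (pos-α (ρ t)))))) (sym (sign₂₄-unfold ρ))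
      where
      ρ = π zero (suc b)
      P : Facelet (size {h}) → Bool
      P = isEdgeOrbit (suc (toℕ b))
      β : Bool → Place → Facelet (size {h})
      β c t = if c then facelet t zero (suc b) else facelet (spin t) (suc b) zero
      α : Place → Facelet (size {h})
      α t = β (canonicalAt true false t) t
      pos-α : ∀ t → pos (α t) ≡ pos (facelet {h} t zero (suc b))
      pos-α t = go (canonicalAt true false t)
        where
        go : ∀ c → pos (β c t) ≡ pos (facelet {h} t zero (suc b))
        go true  = refl
        go false = pos-spin t (suc b)
      P-facelet : ∀ t (c d : Layer {h}) → P (facelet t c d) ≡ edgeKey (suc (toℕ b)) (keyOf c d)
      P-facelet t c d = trans (isEdgeOrbit-key _ (facelet t c d)) (cong (edgeKey _) (orbitKey-facelet t c d))
      canonical-right : ∀ t → canonical (facelet {h} (spin t) (suc b) zero) ≡ not (canonicalAt true false t)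
      canonical-right t = trans (canonical-facelet (spin t) (suc b) zero) (canonicalAt-edge t)
      sound : ∀ t → P (α t) ∧ canonical (α t) ≡ true
      sound t = go (canonicalAt true false t) refl
        where
        go : ∀ c → canonicalAt true false t ≡ c → P (β c t) ∧ canonical (β c t) ≡ true
        go true  eq = cong₂ _∧_ (trans (P-facelet t zero (suc b)) (≡ᵇ-refl (toℕ b))) (trans (canonical-facelet t zero (suc b)) eq)
        go false eq = cong₂ _∧_ (trans (P-facelet (spin t) (suc b) zero) (≡ᵇ-refl (toℕ b))) (trans (canonical-right t) (cong not eq))
      layers : ∀ (c d : Layer {h}) → edgeKey (suc (toℕ b)) (keyOf c d) ≡ true → (zero ≡ c × suc b ≡ d) ⊎ (suc b ≡ c × zero ≡ d)
      layers zero    (suc d) eq = inj₁ (refl , cong suc (Finₚ.toℕ-injective (≡ᵇ-sound _ _ eq)))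
      layers (suc c) zero    eq = inj₂ (cong suc (Finₚ.toℕ-injective (≡ᵇ-sound _ _ eq)) , refl)
      layers zero    zero    ()
      layers (suc _) (suc _) ()
      not-true : ∀ {c} → not c ≡ true → c ≡ false
      not-true {false} _ = refl
      right-α : ∀ t → canonicalAt true false t ≡ false → facelet {h} (spin t) (suc b) zero ≡ α t
      right-α t eq = cong (λ c → β c t) (sym eq)
      comp : ∀ f → P f ∧ canonical f ≡ true → ∃ λ t → t ∈ places × f ≡ α t
      comp f eq with facelet-view {h} f
      ... | t , c , d , refl with layers c d (trans (sym (P-facelet t c d)) (∧⇒ˡ eq))
      ...   | inj₁ (refl , refl) = t , complete t ,
              cong (λ c → β c t) (sym (trans (sym (canonical-facelet t zero (suc b))) (∧⇒ʳ {P (facelet t zero (suc b))} eq)))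
      ...   | inj₂ (refl , refl) = spin (spin t) , complete (spin (spin t)) ,
              trans (cong (λ u → facelet u (suc b) zero) (sym (spin³ t)))
                (right-α (spin (spin t)) (not-true (trans (sym (canonical-right (spin (spin t))))
                  (trans (cong (λ u → canonical (facelet {h} u (suc b) zero)) (spin³ t)) (∧⇒ʳ {P (facelet t (suc b) zero)} eq)))))

    cornerTwistSum-state : cornerTwistSum (size {h}) g ≡ twistSum (π zero zero)
    cornerTwistSum-state = trans (sum-↭ (↭-map⁺ (λ s → twist (g s)) (filter-↭ isCornerUD α cubies cubies-unique
        (λ _ _ e → proj₁ (facelet-injective e)) sound comp)))
      (cong sum (trans (sym (map-∘ {g = λ s → twist (g s)} {f = α} cubies)) (map-cong (λ t →
        trans (cong twist (g-facelet zero zero t)) (twist-facelet (π zero zero t))) cubies)))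
      where
      α : Place → Facelet (size {h})
      α t = facelet {h} t zero zero
      UD-facelet : ∀ t (a b : Layer {h}) → isCornerUD (facelet t a b) ≡ onUD t ∧ cornerKey (keyOf a b)
      UD-facelet t a b = trans (isCornerUD-key (facelet t a b))
        (cong₂ _∧_ (cong (λ X → rank X <ᵇ 2) (face-facelet t a b)) (isCorner-facelet t a b))
      sound : ∀ {t} → t ∈ cubies → isCornerUD (α t) ≡ true
      sound {t} t∈ = trans (UD-facelet t zero zero) (cong (_∧ true) (∈-cubies⇒onUD t∈))
      comp : ∀ f → isCornerUD f ≡ true → ∃ λ t → t ∈ cubies × f ≡ α t
      comp f eq with facelet-view {h} f
      ... | t , a , b , refl with cornerKey-zero a b (∧⇒ʳ {onUD t} (trans (sym (UD-facelet t a b)) eq))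
      ...   | refl , refl = t , onUD⇒∈-cubies (∧⇒ˡ {onUD t} (trans (sym (UD-facelet t zero zero)) eq)) , refl

    -- A word that undoes the arrangement is reversed: its inverse produces the arrangement from the
    -- solved state.
    solution⇒valid : ∀ ms → (∀ a b t → (ms ▷ π) a b t ≡ t) → Valid (size {h}) g
    solution⇒valid ms solved = map toMove (inverse ms) , valid
      where
      valid : ∀ f → emb (g f) ≡ act {size {h}} (map toMove (inverse ms)) (emb f)
      valid f with facelet-view {h} f
      ... | t , a , b , refl = begin
        emb (g (facelet t a b))                                               ≡⟨ cong emb (g-facelet a b t) ⟩
        emb (facelet (π a b t) a b)
          ≡⟨ cong (λ u → emb (facelet u a b)) (run-inverse ms a b (π a b t)) ⟨
        emb (facelet (run (inverse ms) a b (run ms a b (π a b t))) a b)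
          ≡⟨ cong (λ u → emb (facelet (run (inverse ms) a b u) a b)) (solved a b t) ⟩
        emb (facelet (run (inverse ms) a b t) a b)                            ≡⟨ act-facelet (inverse ms) t a b ⟨
        act {size {h}} (map toMove (inverse ms)) (emb (facelet t a b))        ∎
        where open ≡-Reasoning

theorem18 : (n : ℕ) → 2 ≤ n → 2 ∣ n →
    (g : Facelet n → Facelet n) → InSconf n g →
    (∀ a → 1 ≤ a → a < n / 2 → sgn n g isCorner ≡ sgn n g (isCenterOrbit a a)) →
    (∀ a b → 1 ≤ a → a < n / 2 → 1 ≤ b → b < n / 2 → a ≢ b →
    sgn n g (isCenterOrbit a b)
    ≡ sgn n g isCorner * sgn n g (isEdgeOrbit a) * sgn n g (isEdgeOrbit b)) →
    cornerTwistSum n g % 3 ≡ 0 →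
    (∀ a → 1 ≤ a → a < n / 2 → ∀ s → isEdgeOrbit a s ≡ true →
    leftHanded s ≡ true → leftHanded (g s) ≡ true) →
    Valid n g
theorem18 .(zero ℕ.* 2) () (divides zero refl)
theorem18 .(suc h ℕ.* 2) _ (divides (suc h) refl) g conf corner-signs edge-signs twists handedness =
  conclude (stateOf g conf left) (g-stateOf g conf left)
  where
  depth< : ∀ (a : Fin h) → suc (toℕ a) < size {h} / 2
  depth< a = subst (suc (toℕ a) <_) (sym (half-size {h})) (s≤s (Finₚ.toℕ<n a))
  left : ∀ t (b : Fin h) → leftHanded (g (facelet t zero (suc b))) ≡ true
  left t b = handedness (suc (toℕ b)) (s≤s z≤n) (depth< b) (facelet t zero (suc b))
    (trans (isEdgeOrbit-key (suc (toℕ b)) (facelet t zero (suc b)))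
      (trans (cong (edgeKey (suc (toℕ b))) (orbitKey-facelet t zero (suc b))) (≡ᵇ-refl (toℕ b))))
    (leftHanded-facelet t zero (suc b) refl)
  conclude : (π : State {h}) → (∀ (a b : Layer {h}) t → g (facelet t a b) ≡ facelet (π a b t) a b) → Valid (size {h}) g
  conclude π g-facelet = solution⇒valid g conf π g-facelet (proj₁ solution) (proj₂ solution)
    where
    balanced : ∀ a b → a ≢ zero → b ≢ zero →
      sign₂₄ (π a b) ≡ sign₈ (π zero zero) * sign₂₄ (π zero a) * sign₂₄ (π zero b)
    balanced zero    b       a≢0 _   = contradiction refl a≢0
    balanced (suc _) zero    _   b≢0 = contradiction refl b≢0
    balanced (suc a) (suc b) _   _   = go (a Fin.≟ b)
      where
      open ≡-Reasoning
      c  = sign₈ (π zero zero)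
      eₐ = sign₂₄ (π zero (suc a))
      e_b = sign₂₄ (π zero (suc b))
      go : Dec (a ≡ b) → sign₂₄ (π (suc a) (suc b)) ≡ c * eₐ * e_b
      -- For `a ≡ b` the edge sign occurs twice and cancels, so the condition on center corners
      -- takes the form of that on center edges.
      go (yes refl) = begin
        sign₂₄ (π (suc a) (suc a))                                    ≡⟨ sgn-center g conf π g-facelet a a ⟨
        sgn (size {h}) g (isCenterOrbit (suc (toℕ a)) (suc (toℕ a)))  ≡⟨ corner-signs (suc (toℕ a)) (s≤s z≤n) (depth< a) ⟨
        sgn (size {h}) g isCorner                                     ≡⟨ sgn-corner g conf π g-facelet ⟩
        c                                                             ≡⟨ *-identityʳ c ⟨
        c * Sign.+                                                    ≡⟨ cong (c *_) (s*s≡+ eₐ) ⟨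
        c * (eₐ * eₐ)                                                 ≡⟨ *-assoc c eₐ eₐ ⟨
        c * eₐ * eₐ                                                   ∎
      go (no a≢b) = begin
        sign₂₄ (π (suc a) (suc b))                                    ≡⟨ sgn-center g conf π g-facelet a b ⟨
        sgn (size {h}) g (isCenterOrbit (suc (toℕ a)) (suc (toℕ b)))
          ≡⟨ edge-signs (suc (toℕ a)) (suc (toℕ b)) (s≤s z≤n) (depth< a) (s≤s z≤n) (depth< b)
               (λ eq → a≢b (Finₚ.toℕ-injective (ℕₚ.suc-injective eq))) ⟩
        sgn (size {h}) g isCorner * sgn (size {h}) g (isEdgeOrbit (suc (toℕ a))) * sgn (size {h}) g (isEdgeOrbit (suc (toℕ b)))
          ≡⟨ cong₂ _*_ (cong₂ _*_ (sgn-corner g conf π g-facelet) (sgn-edge g conf π g-facelet a)) (sgn-edge g conf π g-facelet b) ⟩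
        c * eₐ * e_b                                                  ∎
    solution : ∃ λ ms → ∀ a b t → (ms ▷ π) a b t ≡ t
    solution = solve record
      { injective = π-injective g conf π g-facelet
      ; coupled   = π-coupled g conf π g-facelet
      ; signs     = balanced
      ; untwisted = trans (cong (_% 3) (sym (cornerTwistSum-state g conf π g-facelet))) twists
      }
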